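{- Let $p$ be a prime, $q=p^n$, $r\ge1$ an integer, and $d$ an integer with $\gcd(d,p)=1$ and $d\ge q^r$. Let $f$ be chosen uniformly at random from $\mathcal{G}_d$, and put $N(f)=(\#C_f(\mathbb{F}_{q^r})-1)/p$. For each $e\mid r$ let $X_{e,1},\dots,X_{e,\pi(e)}$ be Bernoulli random variables with $\mathbb{P}(X_{e,i}=1)=1/p$, $\mathbb{P}(X_{e,i}=0)=1-1/p$, all of $\{X_{e,i}\}_{e\mid r,\,1\le i\le\pi(e)}$ independent. Then: (i) If $\gcd(r,p)=1$, then $N(f)$ has the same distribution as $\sum_{e\mid r}e\sum_{i=1}^{\pi(e)}X_{e,i}$; in particular the mean of $N(f)$ is $q^r/p$. (ii) If $p\mid r$, then $N(f)-q^{r/p}$ has the same distribution as $\sum_{e\mid r,\ \gcd(r/e,p)=1}e\sum_{i=1}^{\pi(e)}X_{e,i}$; in particular the mean of $N(f)$ is $\frac{q^r}{p}+\left(1-\frac1p\right)q^{r/p}$.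
   Context: $\mathcal{G}_d$ is the set of monic polynomials of degree $d$ in $\mathbb{F}_q[x]$. For $f\in\mathbb{F}_q[x]$ of degree $d$ prime to $p$, $C_f$ is the normalisation of the projective closure of the affine curve $y^p-y=f(x)$ over $\mathbb{F}_q$ (it has exactly one point outside the affine part, which is rational), and $\#C_f(\mathbb{F}_{q^r})$ is its number of $\mathbb{F}_{q^r}$-rational points. $\pi(e)$ is the number of monic irreducible polynomials of degree $e$ in $\mathbb{F}_q[x]$. -}

module Defs where

open import Level using (0ℓ)
open import Data.Nat using (ℕ; zero; suc; _≤_; _∸_; _/_; NonZero) renaming (_+_ to _+ℕ_; _*_ to _*ℕ_)
open import Data.Nat.Primality using (Prime; prime⇒nonZero)
open import Data.Nat.Coprimality using (Coprime; coprime?)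
open import Data.Nat.Divisibility using (_∣?_)
open import Data.Product using (Σ; ∃; _×_; _,_)
open import Data.List using (List; []; _∷_; [_]; _++_; length; map; filter; concatMap; cartesianProduct; applyUpTo; replicate; foldr)
open import Data.List.Membership.Propositional using (_∈_)
open import Data.List.Relation.Unary.Unique.Propositional using (Unique)
open import Data.Vec using (Vec; toList) renaming ([] to []ᵥ; _∷_ to _∷ᵥ_)
open import Relation.Binary.PropositionalEquality using (_≡_; _≢_)
open import Relation.Binary.Definitions using (DecidableEquality)
open import Relation.Nullary using (¬_; Dec; yes; no)
open import Data.Unit using (⊤; tt)
open import Data.Empty using (⊥)
import Data.Product
open import Algebra.Core using (Op₁; Op₂)
open import Algebra.Structures using (IsCommutativeRing)

record FiniteField : Set₁ where
  field
    Carrier  : Set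
    _+_ _*_  : Op₂ Carrier
    -_       : Op₁ Carrier
    0# 1#    : Carrier
    isCommutativeRing : IsCommutativeRing _≡_ _+_ _*_ -_ 0# 1#
    0≢1      : 0# ≢ 1#
    inverse  : ∀ x → x ≢ 0# → ∃ λ y → x * y ≡ 1#
    _≟_      : DecidableEquality Carrier
    elements : List Carrier
    complete : ∀ x → x ∈ elements
    unique   : Unique elements

  size : ℕ
  size = length elements

  pow : Carrier → ℕ → Carrier
  pow x zero    = 1#
  pow x (suc k) = x * pow x k

  _-_ : Op₂ Carrier
  x - y = x + (- y)

open FiniteField

record Hom (F L : FiniteField) : Set where
  field
    ι     : Carrier F → Carrier L
    ι-+   : ∀ x y → ι (_+_ F x y) ≡ _+_ L (ι x) (ι y)
    ι-*   : ∀ x y → ι (_*_ F x y) ≡ _*_ L (ι x) (ι y)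
    ι-1   : ι (1# F) ≡ 1# L

open Hom

-- Polynomials over F as coefficient lists (constant term first).

module _ (F : FiniteField) where

  addP : List (Carrier F) → List (Carrier F) → List (Carrier F)
  addP []       ys       = ys
  addP (x ∷ xs) []       = x ∷ xs
  addP (x ∷ xs) (y ∷ ys) = _+_ F x y ∷ addP xs ys

  mulP : List (Carrier F) → List (Carrier F) → List (Carrier F)
  mulP []       bs = []
  mulP (a ∷ as) bs = addP (map (_*_ F a) bs) (0# F ∷ mulP as bs)

  -- The monic polynomial x^d + a_{d-1} x^{d-1} + ... + a_0 given by
  -- the vector (a_0, ..., a_{d-1}).  These represent 𝒢_d bijectively.
  monic : ∀ {d} → Vec (Carrier F) d → List (Carrier F)
  monic v = toList v ++ [ 1# F ]

  allVecs : (d : ℕ) → List (Vec (Carrier F) d)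
  allVecs zero    = []ᵥ ∷ []
  allVecs (suc d) = concatMap (λ a → map (a ∷ᵥ_) (allVecs d)) (elements F)

  Irreducible : ∀ {e} → Vec (Carrier F) e → Set
  Irreducible {e} g =
    1 ≤ e ×
    ¬ (Σ ℕ λ a → Σ ℕ λ b → Σ (Vec (Carrier F) a) λ u → Σ (Vec (Carrier F) b) λ w →
         1 ≤ a × 1 ≤ b × mulP (monic u) (monic w) ≡ monic g)

  IsNumIrred : ℕ → ℕ → Set
  IsNumIrred e m =
    Σ (List (Vec (Carrier F) e)) λ xs →
      Unique xs × (∀ g → (g ∈ xs → Irreducible g) × (Irreducible g → g ∈ xs)) × length xs ≡ m

count : {A : Set} {P : A → Set} → ((a : A) → Dec (P a)) → List A → ℕ
count P? xs = length (filter P? xs)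

module _ (F L : FiniteField) (h : Hom F L) where

  evalL : List (Carrier F) → Carrier L → Carrier L
  evalL cs x = foldr (λ c acc → _+_ L (ι h c) (_*_ L x acc)) (0# L) cs

  affinePoints : (p : ℕ) → ∀ {d} → Vec (Carrier F) d → ℕ
  affinePoints p f =
    count (λ xy → _≟_ L (_-_ L (pow L (Data.Product.proj₂ xy) p) (Data.Product.proj₂ xy))
                        (evalL (monic F f) (Data.Product.proj₁ xy)))
          (cartesianProduct (elements L) (elements L))

  -- #C_f(L): the affine points plus the unique (rational) point at infinity
  -- of the normalisation of the projective closure
  numPoints : (p : ℕ) → ∀ {d} → Vec (Carrier F) d → ℕ
  numPoints p f = suc (affinePoints p f)

  Nf : (p : ℕ) → Prime p → ∀ {d} → Vec (Carrier F) d → ℕ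
  Nf p pp f = _/_ (numPoints p f ∸ 1) p {{prime⇒nonZero pp}}

-- Distribution of a weighted sum of independent Bernoulli(1/p) variables.
-- For weights ws = (w_1, ..., w_M), S = Σ w_j X_j, and
--   P(S = k) = bernWays p ws k / p ^ M .
-- bernWays counts outcomes with weight 1 for X_j = 1 and p-1 for X_j = 0.

bernWays : ℕ → List ℕ → ℕ → ℕ
bernWays p [] zero    = 1
bernWays p [] (suc k) = 0
bernWays p (w ∷ ws) k with w Data.Nat.≤? k
... | yes _ = bernWays p ws (k ∸ w) +ℕ (p ∸ 1) *ℕ bernWays p ws k
... | no  _ = (p ∸ 1) *ℕ bernWays p ws k

-- the list of weights: for every e ∣ r (1 ≤ e ≤ r) satisfying the extra
-- condition, the weight e repeated π(e) times (one per X_{e,i})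
weightsWhere : (r : ℕ) → (π : ℕ → ℕ) → (cond : ℕ → Set) → ((e : ℕ) → Dec (cond e)) → List ℕ
weightsWhere r π cond cond? =
  concatMap (λ e → replicate (π e) e) (filter cond? (filter (_∣? r) (applyUpTo suc r)))

weightsAll : (r : ℕ) → (π : ℕ → ℕ) → List ℕ
weightsAll r π = weightsWhere r π (λ _ → ⊤) (λ _ → yes tt)

CoprimeQuot : ℕ → ℕ → ℕ → Set
CoprimeQuot r p zero    = ⊥
CoprimeQuot r p (suc k) = Coprime (r / suc k) p

coprimeQuot? : (r p e : ℕ) → Dec (CoprimeQuot r p e)
coprimeQuot? r p zero    = no (λ ())
coprimeQuot? r p (suc k) = coprime? (r / suc k) p

weightsCop : (r p : ℕ) → (π : ℕ → ℕ) → List ℕ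
weightsCop r p π = weightsWhere r π (CoprimeQuot r p) (coprimeQuot? r p)

{-# OPTIONS --safe #-}
module Submission where

-- Write q = p^n, σ x = x^q and Tr for the trace of L over its prime field.  By the additive Hilbert 90,
-- y^p - y = b has p solutions y in L if Tr b = 0 and none otherwise, so N(f) is the number of x ∈ L with
-- Tr f(x) = 0.  The elements of L are grouped into σ-orbits, and the orbits of size e ∣ r are the root sets of
-- the monic irreducible polynomials of degree e; Tr f(x) is constant on each of them.
-- On an orbit of size e with p ∣ r/e the trace of f(x) always vanishes, which contributes q^(r/p) in total.
-- On every other orbit, Lagrange interpolation and descent to F give a polynomial v of degree < d with
-- Tr v(x) ≠ 0 there and v = 0 on all other orbits.  Replacing f by f + t v for t = 0, …, p-1 then permutes 𝒢_d,
-- makes Tr f(x) vanish for exactly one t and does not affect the other orbits, so that the events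
-- Tr f(x) = 0 are independent of probability 1/p.

open import Defs
open import Level using (0ℓ)
open import Algebra.Bundles using (CommutativeRing; CommutativeMonoid)
open import Algebra.Structures using (IsCommutativeMonoid)
open import Data.Bool using (true; false; if_then_else_)
open import Data.Empty using (⊥-elim)
open import Data.Unit using (tt)
open import Data.Product using (Σ; ∃; _×_; _,_; proj₁; proj₂)
open import Data.Sum using (inj₁; inj₂)
open import Data.Nat as ℕ using (ℕ; zero; suc; z≤n; s≤s)
import Data.Nat.Properties as ℕ
open import Data.Nat.Combinatorics using (_C_; nCk+nC[k+1]≡[n+1]C[k+1]; nCn≡1; nC1≡n; k>n⇒nCk≡0)
open import Data.Nat.Coprimality using (Coprime; prime⇒coprime; coprime-Bézout)
import Data.Nat.Coprimality as Coprimality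
open import Data.Nat.Divisibility using (_∣_; divides; _∣?_; ∣⇒≤; ∣-trans; m∣m*n; m/n∣m; m%n≡0⇒n∣m; 0∣⇒≡0)
open import Data.Nat.DivMod using (_%_; _/_; m≡m%n+[m/n]*n; m%n<n; m/n*n≡m; m*n/n≡m)
open import Data.Nat.GCD using (module Bézout)
open import Data.Nat.Induction using (<-wellFounded; Acc; acc)
open import Data.Nat.ListAction using (sum)
open import Data.Nat.ListAction.Properties using (sum-++; sum-↭)
open import Data.Nat.Primality using (Prime; euclidsLemma; prime⇒nonZero; prime⇒nonTrivial; prime⇒irreducible; ¬prime[0])
open import Data.Nat.Solver using (module +-*-Solver)
open import Data.Fin as Fin using (Fin; inject₁; fromℕ)
import Data.Fin.Properties as Fin
open import Data.List as List using (List; []; _∷_; _++_; length; filter; concatMap; cartesianProduct; upTo; applyUpTo)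
import Data.List.Properties as List
open import Data.List.Membership.Propositional using (_∈_; _∉_; find; lose)
open import Data.List.Membership.Propositional.Properties
open import Data.List.Relation.Binary.Permutation.Propositional using (_↭_; ↭⇒↭ₛ; ↭-refl; ↭-trans; ↭-prep)
open import Data.List.Relation.Binary.Permutation.Propositional.Properties using (↭-length; ∈-resp-↭)
import Data.List.Relation.Binary.Permutation.Propositional.Properties as Permutation
open import Data.List.Relation.Binary.Permutation.Setoid.Properties using (foldr-commMonoid; Unique-resp-↭)
open import Data.List.Relation.Unary.All as All using (All; []; _∷_)
import Data.List.Relation.Unary.All.Properties as All
open import Data.List.Relation.Unary.AllPairs as AllPairs using (AllPairs; []; _∷_)
import Data.List.Relation.Unary.AllPairs.Properties as AllPairs
open import Data.List.Relation.Unary.Any as Any using (Any; here; there; any?)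
open import Data.List.Relation.Unary.Unique.Propositional using (Unique)
open import Data.List.Relation.Unary.Unique.Propositional.Properties as Unique using (Unique[x∷xs]⇒x∉xs)
open import Data.Vec as Vec using (Vec; []; _∷_; toList; replicate; zipWith; _∷ʳ_)
import Data.Vec.Properties as Vec
open import Function using (_∘_)
open import Relation.Binary.Definitions using (DecidableEquality; tri<; tri≈; tri>)
open import Relation.Binary.PropositionalEquality
open import Relation.Nullary using (¬_; ¬?; Dec; yes; no; does; contradiction)

-- `L` is known only through its size, so even a root in `L` of an irreducible `g` of degree e ∣ r
-- has to be found: Fermat's theorem in F[X]/(g) shows that `g` divides X^(q^r) - X, which vanishes
-- on all of `L`, and counting the roots of the cofactor leaves one for `g`. The bound d ≥ q^r and
-- the condition gcd(r/e, p) = 1 both come from the polynomial `v`. A function on `L` supported at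
-- one point `a` is a polynomial of degree q^r - 1, and adding a polynomial of such a degree keeps
-- `f` monic of degree d. Summing the r conjugates brings it down to `F`, but r/e of them contribute
-- at `a`, so the trace there is r/e times the original one and can be made nonzero just when p does
-- not divide r/e. Both cases are instances of N(f) = S(f) + `base`, with S(f) the random part and
-- `base` the number of elements of `L` in orbits with p ∣ r/e; only at the end is `base` identified
-- as 0 or q^(r/p). Independence is an induction over the orbits in which an arbitrary weight on 𝒢_d
-- records the conditions already imposed.

-- Finite sums over lists, indicators of decidable events, counting by inclusion

module Summation where
  open import Data.Nat
  open import Data.Nat.Properties hiding (_≟_)

  private variable
    A B : Set
    P Q : Set

  ∑ : List A → (A → ℕ) → ℕ
  ∑ xs f = sum (List.map f xs)

  ∑-cong-∈ : ∀ (xs : List A) {f g : A → ℕ} → (∀ x → x ∈ xs → f x ≡ g x) → ∑ xs f ≡ ∑ xs g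
  ∑-cong-∈ []       eq = refl
  ∑-cong-∈ (x ∷ xs) eq = cong₂ _+_ (eq x (here refl)) (∑-cong-∈ xs (λ y m → eq y (there m)))

  ∑-cong : ∀ (xs : List A) {f g : A → ℕ} → (∀ x → f x ≡ g x) → ∑ xs f ≡ ∑ xs g
  ∑-cong xs eq = ∑-cong-∈ xs (λ x _ → eq x)

  ∑-const : ∀ (xs : List A) {f : A → ℕ} c → (∀ x → x ∈ xs → f x ≡ c) → ∑ xs f ≡ length xs * c
  ∑-const []       c eq = refl
  ∑-const (x ∷ xs) c eq = cong₂ _+_ (eq x (here refl)) (∑-const xs c (λ y m → eq y (there m)))

  ∑-zero : ∀ (xs : List A) {f : A → ℕ} → (∀ x → x ∈ xs → f x ≡ 0) → ∑ xs f ≡ 0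
  ∑-zero xs eq = trans (∑-const xs 0 eq) (*-zeroʳ (length xs))

  ∑-+ : ∀ (xs : List A) (f g : A → ℕ) → ∑ xs (λ x → f x + g x) ≡ ∑ xs f + ∑ xs g
  ∑-+ []       f g = refl
  ∑-+ (x ∷ xs) f g = trans (cong (f x + g x +_) (∑-+ xs f g)) (interchange (f x) (g x) (∑ xs f) (∑ xs g))
    where open import Algebra.Properties.CommutativeSemigroup +-commutativeSemigroup using (interchange)

  ∑-*ˡ : ∀ (xs : List A) c (f : A → ℕ) → ∑ xs (λ x → c * f x) ≡ c * ∑ xs f
  ∑-*ˡ []       c f = sym (*-zeroʳ c)
  ∑-*ˡ (x ∷ xs) c f = trans (cong (c * f x +_) (∑-*ˡ xs c f)) (sym (*-distribˡ-+ c (f x) _))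

  ∑-*ʳ : ∀ (xs : List A) (f : A → ℕ) c → ∑ xs (λ x → f x * c) ≡ ∑ xs f * c
  ∑-*ʳ xs f c = trans (∑-cong xs (λ x → *-comm (f x) c)) (trans (∑-*ˡ xs c f) (*-comm c _))

  ∑-swap : ∀ (xs : List A) (ys : List B) (f : A → B → ℕ) →
           ∑ xs (λ x → ∑ ys (f x)) ≡ ∑ ys (λ y → ∑ xs (λ x → f x y))
  ∑-swap []       ys f = sym (∑-zero ys (λ _ _ → refl))
  ∑-swap (x ∷ xs) ys f = trans (cong (∑ ys (f x) +_) (∑-swap xs ys f)) (sym (∑-+ ys (f x) _))

  ∑-++ : ∀ (xs ys : List A) (f : A → ℕ) → ∑ (xs ++ ys) f ≡ ∑ xs f + ∑ ys f
  ∑-++ xs ys f = trans (cong sum (List.map-++ f xs ys)) (sum-++ (List.map f xs) (List.map f ys))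

  ∑-map : ∀ (g : A → B) (xs : List A) (f : B → ℕ) → ∑ (List.map g xs) f ≡ ∑ xs (λ x → f (g x))
  ∑-map g xs f = cong sum (sym (List.map-∘ xs))

  ∑-concatMap : ∀ (g : A → List B) (xs : List A) (f : B → ℕ) →
                ∑ (concatMap g xs) f ≡ ∑ xs (λ x → ∑ (g x) f)
  ∑-concatMap g []       f = refl
  ∑-concatMap g (x ∷ xs) f = trans (∑-++ (g x) (concatMap g xs) f) (cong (∑ (g x) f +_) (∑-concatMap g xs f))

  ∑-↭ : ∀ {xs ys : List A} (f : A → ℕ) → xs ↭ ys → ∑ xs f ≡ ∑ ys f
  ∑-↭ f p = sum-↭ (Permutation.map⁺ f p)

  ∑-single : ∀ {xs : List A} (f : A → ℕ) {x} → Unique xs → x ∈ xs →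
             (∀ y → y ∈ xs → y ≢ x → f y ≡ 0) → ∑ xs f ≡ f x
  ∑-single {xs = x ∷ xs} f u@(_ ∷ _) (here refl) z =
    trans (cong (f x +_) (∑-zero xs (λ y m → z y (there m) λ { refl → Unique[x∷xs]⇒x∉xs u m }))) (+-identityʳ _)
  ∑-single {xs = y ∷ xs} f u@(_ ∷ us) (there m) z =
    trans (cong (_+ ∑ xs f) (z y (here refl) λ { refl → Unique[x∷xs]⇒x∉xs u m }))
          (∑-single f us m (λ y m′ → z y (there m′)))

  ∑-cartesianProduct : ∀ (xs : List A) (ys : List B) (f : A × B → ℕ) →
    ∑ (cartesianProduct xs ys) f ≡ ∑ xs (λ x → ∑ ys (λ y → f (x , y)))
  ∑-cartesianProduct []       ys f = refl
  ∑-cartesianProduct (x ∷ xs) ys f =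
    trans (∑-++ (List.map (x ,_) ys) _ f) (cong₂ _+_ (∑-map (x ,_) ys f) (∑-cartesianProduct xs ys f))

  𝟙 : Dec P → ℕ
  𝟙 d = if does d then 1 else 0

  𝟙-yes : (d : Dec P) → P → 𝟙 d ≡ 1
  𝟙-yes (yes _) _ = refl
  𝟙-yes (no ¬p) p = contradiction p ¬p

  𝟙-no : (d : Dec P) → ¬ P → 𝟙 d ≡ 0
  𝟙-no (yes p) ¬p = contradiction p ¬p
  𝟙-no (no _)  _  = refl

  𝟙-⇔ : (d : Dec P) (d′ : Dec Q) → (P → Q) → (Q → P) → 𝟙 d ≡ 𝟙 d′
  𝟙-⇔ (yes p) d′ f g = sym (𝟙-yes d′ (f p))
  𝟙-⇔ (no ¬p) d′ f g = sym (𝟙-no d′ (λ q → ¬p (g q)))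

  count≡∑ : {P : A → Set} (P? : ∀ a → Dec (P a)) (xs : List A) → count P? xs ≡ ∑ xs (λ x → 𝟙 (P? x))
  count≡∑ P? [] = refl
  count≡∑ P? (x ∷ xs) with does (P? x)
  ... | true  = cong suc (count≡∑ P? xs)
  ... | false = count≡∑ P? xs

  ∑-filter : {P : A → Set} (P? : ∀ a → Dec (P a)) (xs : List A) (f : A → ℕ) →
             ∑ xs f ≡ ∑ (filter P? xs) f + ∑ (filter (λ a → ¬? (P? a)) xs) f
  ∑-filter P? [] f = refl
  ∑-filter P? (x ∷ xs) f with does (P? x)
  ... | true  = trans (cong (f x +_) (∑-filter P? xs f)) (sym (+-assoc (f x) _ _))
  ... | false = trans (cong (f x +_) (∑-filter P? xs f))
                      (x∙yz≈y∙xz (f x) (∑ (filter P? xs) f) _)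
    where open import Algebra.Properties.CommutativeSemigroup +-commutativeSemigroup using (x∙yz≈y∙xz)

  ∈⇒↭ : ∀ {x : A} {xs} → x ∈ xs → ∃ λ ys → xs ↭ x ∷ ys
  ∈⇒↭ {x = x} m with ys , zs , refl ← ∈-∃++ m = ys ++ zs , Permutation.shift x ys zs

  unique-⊆-↭ : ∀ {xs ys : List A} → Unique xs → (∀ {x} → x ∈ xs → x ∈ ys) →
               ∃ λ zs → ys ↭ xs ++ zs
  unique-⊆-↭ {xs = []} {ys} u s = ys , ↭-refl
  unique-⊆-↭ {xs = x ∷ xs} u@(_ ∷ us) s with ∈⇒↭ (s (here refl))
  ... | ys′ , p with unique-⊆-↭ us s′
    where
    s′ : ∀ {z} → z ∈ xs → z ∈ ys′
    s′ m with ∈-resp-↭ p (s (there m))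
    ... | here refl = contradiction m (Unique[x∷xs]⇒x∉xs u)
    ... | there m′  = m′
  ... | zs , p′ = zs , ↭-trans p (↭-prep x p′)

  unique-⊆-length : ∀ {xs ys : List A} → Unique xs → (∀ {x} → x ∈ xs → x ∈ ys) → length xs ≤ length ys
  unique-⊆-length {xs = xs} u s with zs , p ← unique-⊆-↭ u s =
    subst (length xs ≤_) (sym (trans (↭-length p) (List.length-++ xs))) (m≤m+n _ _)

  -- By lengths nothing of `ys` is left over. The permutation arguments below are instances: an
  -- injective map of a finite set into itself is a bijection, and a set of roots as large as the
  -- degree allows is complete.
  unique-⊆-≤⇒↭ : ∀ {xs ys : List A} → Unique xs → (∀ {x} → x ∈ xs → x ∈ ys) → length ys ≤ length xs → ys ↭ xs
  unique-⊆-≤⇒↭ {xs = xs} {ys} u s le with unique-⊆-↭ u s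
  ... | []     , p = subst (ys ↭_) (List.++-identityʳ xs) p
  ... | z ∷ zs , p = contradiction le (<⇒≱ (subst (length xs <_) (sym (trans (↭-length p) (List.length-++ xs)))
                       (m<m+n _ (s≤s z≤n))))

open Summation

-- Powers and products in a commutative monoid, and Fermat's theorem for one with a zero

module Power {A : Set} (_·_ : A → A → A) (ε : A) where

  power : A → ℕ → A
  power x zero    = ε
  power x (suc n) = x · power x n

  prod : List A → A
  prod = List.foldr _·_ ε

  module Laws (isCM : IsCommutativeMonoid _≡_ _·_ ε) where
    open IsCommutativeMonoid isCM using (assoc; identityˡ; identityʳ) renaming (comm to ·-comm)

    private
      commutativeMonoid : CommutativeMonoid 0ℓ 0ℓ
      commutativeMonoid = record { isCommutativeMonoid = isCM }

    open import Algebra.Properties.CommutativeSemigroup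
      (CommutativeMonoid.commutativeSemigroup commutativeMonoid) public using (interchange)

    power-+ : ∀ x m n → power x (m ℕ.+ n) ≡ power x m · power x n
    power-+ x zero    n = sym (identityˡ _)
    power-+ x (suc m) n = trans (cong (x ·_) (power-+ x m n)) (sym (assoc x _ _))

    power-* : ∀ x m n → power x (m ℕ.* n) ≡ power (power x n) m
    power-* x zero    n = refl
    power-* x (suc m) n = trans (power-+ x n (m ℕ.* n)) (cong (power x n ·_) (power-* x m n))

    power-·  : ∀ x y n → power (x · y) n ≡ power x n · power y n
    power-· x y zero    = sym (identityˡ _)
    power-· x y (suc n) = trans (cong ((x · y) ·_) (power-· x y n)) (interchange x y _ _)

    power-ε : ∀ n → power ε n ≡ ε
    power-ε zero    = refl
    power-ε (suc n) = trans (identityˡ _) (power-ε n)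

    prod-↭ : ∀ {xs ys} → xs ↭ ys → prod xs ≡ prod ys
    prod-↭ p = foldr-commMonoid (setoid A) isCM (↭⇒↭ₛ p)

    prod-map : ∀ a xs → prod (List.map (a ·_) xs) ≡ power a (length xs) · prod xs
    prod-map a []       = sym (identityˡ ε)
    prod-map a (x ∷ xs) = trans (cong ((a · x) ·_) (prod-map a xs)) (interchange a x _ _)

    -- Multiplication by x permutes the elements other than 0; compare the products before and after.
    fermat : (z : A) → (∀ x → x · z ≡ z) → (∀ {a x y} → a ≢ z → a · x ≡ a · y → x ≡ y) →
             DecidableEquality A → (els : List A) → (∀ x → x ∈ els) → Unique els →
             ∀ x → power x (length els) ≡ x
    fermat z zr cancel _≟_ els complete unique x with ∈⇒↭ (complete z)
    ... | nz , p = trans (cong (power x) (↭-length p)) goal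
      where
      unique-z∷nz : Unique (z ∷ nz)
      unique-z∷nz = Unique-resp-↭ (setoid A) (↭⇒↭ₛ p) unique
      z∉nz : z ∉ nz
      z∉nz = Unique[x∷xs]⇒x∉xs unique-z∷nz
      unz : Unique nz
      unz with _ ∷ u ← unique-z∷nz = u
      ∈nz : ∀ {y} → y ≢ z → y ∈ nz
      ∈nz {y} ne with ∈-resp-↭ p (complete y)
      ... | here e  = contradiction e ne
      ... | there m = m
      no-zero-divisor : ∀ {a b} → a ≢ z → b ≢ z → a · b ≢ z
      no-zero-divisor na nb e = nb (cancel na (trans e (sym (zr _))))
      goal : power x (suc (length nz)) ≡ x
      goal with x ≟ z
      ... | yes refl = trans (·-comm z _) (zr _)
      ... | no x≢z = trans (cong (x ·_) (cancel prod≢z (sym eq))) (identityʳ x)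
        where
        ε≢z : ε ≢ z
        ε≢z refl = x≢z (trans (sym (identityʳ x)) (zr x))
        prod≢z′ : ∀ ys → z ∉ ys → prod ys ≢ z
        prod≢z′ []       _ = ε≢z
        prod≢z′ (y ∷ ys) n = no-zero-divisor (λ e → n (here (sym e))) (prod≢z′ ys (n ∘ there))
        prod≢z : prod nz ≢ z
        prod≢z = prod≢z′ nz z∉nz
        perm : nz ↭ List.map (x ·_) nz
        perm = unique-⊆-≤⇒↭ (Unique.map⁺ (cancel x≢z) unz)
          (λ m → let (y , y∈ , e) = ∈-map⁻ (x ·_) m in
                 subst (_∈ nz) (sym e) (∈nz (no-zero-divisor x≢z λ { refl → z∉nz y∈ })))
          (ℕ.≤-reflexive (sym (List.length-map (x ·_) nz)))
        eq : prod nz · ε ≡ prod nz · power x (length nz)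
        eq = trans (identityʳ _) (trans (prod-↭ perm) (trans (prod-map x nz) (·-comm _ _)))

-- Divisibility of binomial coefficients by a prime

absorption : ∀ n k → suc k ℕ.* (suc n C suc k) ≡ suc n ℕ.* (n C k)
absorption zero zero = refl
absorption zero (suc k) = cong₂ ℕ._*_ {x = suc (suc k)} refl (k>n⇒nCk≡0 {1} {suc (suc k)} (s≤s (s≤s z≤n)))
                     ⟨ trans ⟩ trans (ℕ.*-zeroʳ (suc (suc k))) (sym (cong (1 ℕ.*_) (k>n⇒nCk≡0 {0} {suc k} (s≤s z≤n))))
  where open import Function using (_⟨_⟩_)
absorption (suc n) zero = trans (ℕ.*-identityˡ _) (trans (nC1≡n (suc (suc n))) (sym (ℕ.*-identityʳ _)))
absorption (suc n) (suc k) = begin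
  suc (suc k) ℕ.* (suc (suc n) C suc (suc k))
    ≡⟨ cong (suc (suc k) ℕ.*_) (sym (nCk+nC[k+1]≡[n+1]C[k+1] (suc n) (suc k))) ⟩
  suc (suc k) ℕ.* (a ℕ.+ b)                 ≡⟨ ℕ.*-distribˡ-+ (suc (suc k)) a b ⟩
  (a ℕ.+ suc k ℕ.* a) ℕ.+ suc (suc k) ℕ.* b ≡⟨ cong₂ (λ u v → (a ℕ.+ u) ℕ.+ v) (absorption n k) (absorption n (suc k)) ⟩
  (a ℕ.+ suc n ℕ.* (n C k)) ℕ.+ suc n ℕ.* (n C suc k) ≡⟨ ℕ.+-assoc a _ _ ⟩
  a ℕ.+ (suc n ℕ.* (n C k) ℕ.+ suc n ℕ.* (n C suc k)) ≡⟨ cong (a ℕ.+_) (sym (ℕ.*-distribˡ-+ (suc n) (n C k) _)) ⟩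
  a ℕ.+ suc n ℕ.* (n C k ℕ.+ n C suc k) ≡⟨ cong (λ u → a ℕ.+ suc n ℕ.* u) (nCk+nC[k+1]≡[n+1]C[k+1] n k) ⟩
  a ℕ.+ suc n ℕ.* a ∎
  where
  open ≡-Reasoning
  a = suc n C suc k
  b = suc n C suc (suc k)

-- In (k+1) C(p, k+1) = p C(p-1, k) the factor k+1 is smaller than p, so Euclid's lemma leaves only
-- the binomial coefficient.
prime∣binomial : ∀ {p} → Prime p → ∀ {k} → suc k ℕ.< p → p ∣ (p C suc k)
prime∣binomial {suc p} pp {k} k<p with euclidsLemma (suc k) (suc p C suc k) pp
    (subst (suc p ∣_) (sym (absorption p k)) (m∣m*n (p C k)))
... | inj₁ p∣k = contradiction (∣⇒≤ p∣k) (ℕ.<⇒≱ k<p)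
... | inj₂ p∣C = p∣C

-- Finite fields: polynomial functions, the bound on roots, Frobenius

module Field (K : FiniteField) where
  open FiniteField K public
    renaming (_+_ to infixl 6 _+_; _*_ to infixl 7 _*_; -_ to infix 8 -_; _-_ to infixl 6 _-_; _≟_ to infix 4 _≟_)

  commutativeRing : CommutativeRing 0ℓ 0ℓ
  commutativeRing = record { isCommutativeRing = isCommutativeRing }

  open CommutativeRing commutativeRing public
    using (commutativeSemiring; semiring; +-group; +-isCommutativeMonoid; *-isCommutativeMonoid;
           +-assoc; +-comm; +-identityˡ; +-identityʳ; -‿inverseˡ; -‿inverseʳ;
           *-assoc; *-comm; *-identityˡ; *-identityʳ; distribˡ; distribʳ; zeroˡ; zeroʳ)

  open import Algebra.Properties.Group +-group public
    using () renaming (∙-cancelˡ to +-cancelˡ; ∙-cancelʳ to +-cancelʳ; inverseˡ-unique to -‿uniqueˡ)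
  open import Algebra.Properties.Ring (CommutativeRing.ring commutativeRing) public
    using (-‿distribˡ-*; -‿distribʳ-*; -‿+-comm)

  open import Algebra.Properties.CommutativeSemigroup
    (CommutativeMonoid.commutativeSemigroup (CommutativeRing.+-commutativeMonoid commutativeRing)) public
    using () renaming (interchange to +-interchange)
  open import Algebra.Properties.CommutativeSemigroup
    (CommutativeMonoid.commutativeSemigroup (CommutativeRing.*-commutativeMonoid commutativeRing)) public
    using () renaming (x∙yz≈y∙xz to x*yz≡y*xz)

  module Solver where
    open import Algebra.Solver.Ring.NaturalCoefficients.Default commutativeSemiring public

  x-y≡0⇒x≡y : ∀ {x y} → x - y ≡ 0# → x ≡ y
  x-y≡0⇒x≡y {x} {y} e = trans (sym (+-identityʳ x)) (trans (cong (x +_) (sym (-‿inverseˡ y)))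
    (trans (sym (+-assoc x (- y) y)) (trans (cong (_+ y) e) (+-identityˡ y))))

  *-cancelˡ : ∀ {a x y} → a ≢ 0# → a * x ≡ a * y → x ≡ y
  *-cancelˡ {a} {x} {y} na e with b , ab ← inverse a na = trans (sym (lem x)) (trans (cong (b *_) e) (lem y))
    where
    lem : ∀ z → b * (a * z) ≡ z
    lem z = trans (sym (*-assoc b a z)) (trans (cong (_* z) (trans (*-comm b a) ab)) (*-identityˡ z))

  xy≡0⇒y≡0 : ∀ {x y} → x ≢ 0# → x * y ≡ 0# → y ≡ 0#
  xy≡0⇒y≡0 {x} nx e = *-cancelˡ nx (trans e (sym (zeroʳ x)))

  open Power _*_ 1# using (power; module Laws)

  pow≡power : ∀ x n → pow x n ≡ power x n
  pow≡power x zero    = refl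
  pow≡power x (suc n) = cong (x *_) (pow≡power x n)

  pow-+ : ∀ x m n → pow x (m ℕ.+ n) ≡ pow x m * pow x n
  pow-+ x m n rewrite pow≡power x (m ℕ.+ n) | pow≡power x m | pow≡power x n =
    Laws.power-+ *-isCommutativeMonoid x m n

  pow-^* : ∀ x m n → pow x (m ℕ.* n) ≡ pow (pow x n) m
  pow-^* x m n rewrite pow≡power x (m ℕ.* n) | pow≡power (pow x n) m | pow≡power x n =
    Laws.power-* *-isCommutativeMonoid x m n

  pow-distrib-* : ∀ x y n → pow (x * y) n ≡ pow x n * pow y n
  pow-distrib-* x y n rewrite pow≡power (x * y) n | pow≡power x n | pow≡power y n =
    Laws.power-· *-isCommutativeMonoid x y n

  pow-1# : ∀ n → pow 1# n ≡ 1#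
  pow-1# n rewrite pow≡power 1# n = Laws.power-ε *-isCommutativeMonoid n

  pow-0# : ∀ n → .{{ℕ.NonZero n}} → pow 0# n ≡ 0#
  pow-0# (suc n) = zeroˡ _

  pow-size : ∀ x → pow x size ≡ x
  pow-size x = trans (pow≡power x size)
    (Laws.fermat *-isCommutativeMonoid 0# zeroʳ *-cancelˡ _≟_ elements complete unique x)

  open import Algebra.Properties.Semiring.Mult semiring public
    using () renaming (_×_ to _·1×_)

  infixr 8 _×#_
  _×#_ : ℕ → Carrier → Carrier
  n ×# x = n ·1× x

  open import Algebra.Properties.Semiring.Mult semiring public
    using (×-assoc-*; ×1-homo-*; ×-homo-+)

  ×#≡* : ∀ n x → n ×# x ≡ (n ×# 1#) * x
  ×#≡* n x = sym (trans (×-assoc-* n 1# x) (cong (n ×#_) (*-identityˡ x)))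

  ×#-0 : ∀ n → n ×# 0# ≡ 0#
  ×#-0 n = trans (×#≡* n 0#) (zeroʳ _)

  -- Additive counterpart of `fermat`: translation by `1#` permutes the field, and the sum of all
  -- elements before and after differs by `size` copies of `1#`.
  size×#1≡0 : size ×# 1# ≡ 0#
  size×#1≡0 = +-cancelʳ (+prod elements) _ _ (trans (sym eq) (sym (+-identityˡ _)))
    where
    open Power _+_ 0# using () renaming (prod to +prod; power to +power; module Laws to +Laws)
    perm : elements ↭ List.map (1# +_) elements
    perm = unique-⊆-≤⇒↭ (Unique.map⁺ (+-cancelˡ 1# _ _) unique) (λ _ → complete _)
      (ℕ.≤-reflexive (sym (List.length-map _ elements)))
    +power≡ : ∀ n → +power 1# n ≡ n ×# 1#
    +power≡ zero    = refl
    +power≡ (suc n) = cong (1# +_) (+power≡ n)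
    eq : +prod elements ≡ size ×# 1# + +prod elements
    eq = trans (+Laws.prod-↭ +-isCommutativeMonoid perm)
      (trans (+Laws.prod-map +-isCommutativeMonoid 1# elements) (cong (_+ +prod elements) (+power≡ size)))

  -- Poly k f: f is given by a polynomial with k coefficients (degree < k);
  -- Monic k f: f is given by a monic polynomial of degree k.
  Poly Monic : ℕ → (Carrier → Carrier) → Set
  Poly zero    f = ∀ x → f x ≡ 0#
  Poly (suc k) f = ∃ λ c → ∃ λ g → Poly k g × ∀ x → f x ≡ c + x * g x
  Monic zero    f = ∀ x → f x ≡ 1#
  Monic (suc k) f = ∃ λ c → ∃ λ g → Monic k g × ∀ x → f x ≡ c + x * g x

  Poly-cong : ∀ k {f g} → (∀ x → g x ≡ f x) → Poly k f → Poly k g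
  Poly-cong zero    e P             = λ x → trans (e x) (P x)
  Poly-cong (suc k) e (c , h , P , q) = c , h , P , λ x → trans (e x) (q x)

  Monic-cong : ∀ k {f g} → (∀ x → g x ≡ f x) → Monic k f → Monic k g
  Monic-cong zero    e P             = λ x → trans (e x) (P x)
  Monic-cong (suc k) e (c , h , P , q) = c , h , P , λ x → trans (e x) (q x)

  c+x*0 : ∀ c x → c ≡ c + x * 0#
  c+x*0 c x = sym (trans (cong (c +_) (zeroʳ x)) (+-identityʳ c))

  Poly-0 : ∀ k → Poly k (λ _ → 0#)
  Poly-0 zero    = λ _ → refl
  Poly-0 (suc k) = 0# , (λ _ → 0#) , Poly-0 k , c+x*0 0#

  Poly-const : ∀ k c → Poly (suc k) (λ _ → c)
  Poly-const k c = c , (λ _ → 0#) , Poly-0 k , c+x*0 c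

  Poly-x* : ∀ k {f} → Poly k f → Poly (suc k) (λ x → x * f x)
  Poly-x* k P = 0# , _ , P , λ x → sym (+-identityˡ _)

  Monic-x* : ∀ k {f} → Monic k f → Monic (suc k) (λ x → x * f x)
  Monic-x* k P = 0# , _ , P , λ x → sym (+-identityˡ _)

  private
    +-step : ∀ c d x u v → (c + x * u) + (d + x * v) ≡ (c + d) + x * (u + v)
    +-step = solve 5 (λ c d x u v → (c :+ x :* u) :+ (d :+ x :* v) := (c :+ d) :+ x :* (u :+ v)) refl
      where open Solver

  Poly-+ : ∀ k {f g} → Poly k f → Poly k g → Poly k (λ x → f x + g x)
  Poly-+ zero    P Q x = trans (cong₂ _+_ (P x) (Q x)) (+-identityˡ 0#)
  Poly-+ (suc k) (c , f , P , p) (d , g , Q , q) = c + d , _ , Poly-+ k P Q ,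
    λ x → trans (cong₂ _+_ (p x) (q x)) (+-step c d x (f x) (g x))

  Monic+Poly : ∀ k {f g} → Monic k f → Poly k g → Monic k (λ x → f x + g x)
  Monic+Poly zero    P Q x = trans (cong₂ _+_ (P x) (Q x)) (+-identityʳ 1#)
  Monic+Poly (suc k) (c , f , P , p) (d , g , Q , q) = c + d , _ , Monic+Poly k P Q ,
    λ x → trans (cong₂ _+_ (p x) (q x)) (+-step c d x (f x) (g x))

  Poly-*ˡ : ∀ k a {f} → Poly k f → Poly k (λ x → a * f x)
  Poly-*ˡ zero    a P x = trans (cong (a *_) (P x)) (zeroʳ a)
  Poly-*ˡ (suc k) a (c , f , P , p) = a * c , _ , Poly-*ˡ k a P ,
    λ x → trans (cong (a *_) (p x)) (lem a c x (f x))
    where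
    open Solver
    lem : ∀ a c x u → a * (c + x * u) ≡ a * c + x * (a * u)
    lem = solve 4 (λ a c x u → a :* (c :+ x :* u) := a :* c :+ x :* (a :* u)) refl

  Poly-≤ : ∀ {k l f} → k ℕ.≤ l → Poly k f → Poly l f
  Poly-≤ {l = l} z≤n     P               = Poly-cong l P (Poly-0 l)
  Poly-≤         (s≤s m) (c , f , P , p) = c , f , Poly-≤ m P , p

  Monic⇒Poly : ∀ k {f} → Monic k f → Poly (suc k) f
  Monic⇒Poly zero    P               = Poly-cong 1 P (Poly-const 0 1#)
  Monic⇒Poly (suc k) (c , f , P , p) = c , f , Monic⇒Poly k P , p

  Monic-pow : ∀ k → Monic k (λ x → pow x k)
  Monic-pow zero    x = refl
  Monic-pow (suc k) = Monic-x* k (Monic-pow k)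

  Monic-pow* : ∀ m {k f} → Monic k f → Monic (m ℕ.+ k) (λ x → pow x m * f x)
  Monic-pow* zero    {k} P = Monic-cong k (λ x → *-identityˡ _) P
  Monic-pow* (suc m) {k} P = Monic-cong (suc (m ℕ.+ k)) (λ x → *-assoc x _ _) (Monic-x* (m ℕ.+ k) (Monic-pow* m P))

  -- Synthetic division f(x) - f(a) = (x - a) g(x), arranged without subtraction so that the solver
  -- for commutative semirings applies.
  Monic-factor : ∀ k {f} → Monic (suc k) f → ∀ a → ∃ λ g → Monic k g × ∀ x → f x + a * g x ≡ x * g x + f a
  Monic-factor zero (c , f , P , p) a = (λ _ → 1#) , (λ _ → refl) , λ x →
    trans (cong (_+ a * 1#) (trans (p x) (cong (λ u → c + x * u) (P x))))
      (trans (lem c x a) (cong (x * 1# +_) (sym (trans (p a) (cong (λ u → c + a * u) (P a))))))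
    where
    open Solver
    lem : ∀ c x a → (c + x * 1#) + a * 1# ≡ x * 1# + (c + a * 1#)
    lem = solve 3 (λ c x a → (c :+ x :* con 1) :+ a :* con 1 := x :* con 1 :+ (c :+ a :* con 1)) refl
  Monic-factor (suc k) (c , f , P , p) a with g , G , q ← Monic-factor k P a =
    (λ x → f x + a * g x) , Monic+Poly (suc k) P (Poly-*ˡ (suc k) a (Monic⇒Poly k G)) , λ x →
      trans (cong (_+ a * (f x + a * g x)) (p x))
      (trans (cong (λ u → (c + x * f x) + a * u) (q x))
      (trans (lem c x (f x) a (g x) (f a)) (cong (x * (f x + a * g x) +_) (sym (p a)))))
    where
    open Solver
    lem : ∀ c x u a v w → (c + x * u) + a * (x * v + w) ≡ x * (u + a * v) + (c + a * w)
    lem = solve 6 (λ c x u a v w → (c :+ x :* u) :+ a :* (x :* v :+ w) := x :* (u :+ a :* v) :+ (c :+ a :* w)) refl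

  root-bound : ∀ k {f xs} → Monic k f → Unique xs → (∀ x → x ∈ xs → f x ≡ 0#) → length xs ℕ.≤ k
  root-bound k       {xs = []}     P u z = z≤n
  root-bound zero    {xs = x ∷ xs} P u z = contradiction (trans (sym (z x (here refl))) (P x)) 0≢1
  root-bound (suc k) {f} {a ∷ xs} P u@(_ ∷ us) z with g , G , q ← Monic-factor k P a =
    s≤s (root-bound k G us gz)
    where
    gz : ∀ x → x ∈ xs → g x ≡ 0#
    gz x m with g x ≟ 0#
    ... | yes e = e
    -- As `f` vanishes at `a` and at `x`, the factorisation says that `a` and `x` have the same
    -- product with `g x`; cancelling gives `a ≡ x`, against the absence of duplicates.
    ... | no ne = contradiction (*-cancelˡ ne eq) λ { refl → Unique[x∷xs]⇒x∉xs u m }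
      where
      eq : g x * a ≡ g x * x
      eq = trans (*-comm _ a) (trans (sym (+-identityˡ _)) (trans (cong (_+ a * g x) (sym (z x (there m))))
        (trans (q x) (trans (cong (x * g x +_) (z a (here refl))) (trans (+-identityʳ _) (*-comm x _))))))

  size≥2 : 2 ℕ.≤ size
  size≥2 = unique-⊆-length {xs = 0# ∷ 1# ∷ []} ((0≢1 ∷ []) ∷ [] ∷ []) (λ _ → complete _)

  x≡y⇒x-y≡0 : ∀ {x y} → x ≡ y → x + (- 1#) * y ≡ 0#
  x≡y⇒x-y≡0 {x} refl = trans (cong (_+ (- 1#) * x) (sym (*-identityˡ x))) (trans (sym (distribʳ x 1# (- 1#)))
    (trans (cong (_* x) (-‿inverseʳ 1#)) (zeroˡ x)))

  Poly-id : Poly 2 (λ x → x)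
  Poly-id = Poly-cong 2 (λ x → sym (*-identityʳ x)) (Poly-x* 1 (Poly-const 0 1#))

  -- The points are roots of X^k - X; with k ≥ 2 the linear term lies below the leading one, so this
  -- is monic of degree k.
  fixed-bound : ∀ k {xs} → 2 ℕ.≤ k → Unique xs → (∀ x → x ∈ xs → pow x k ≡ x) → length xs ℕ.≤ k
  fixed-bound k k≥2 u fix = root-bound k
    (Monic+Poly k (Monic-pow k) (Poly-≤ k≥2 (Poly-*ˡ 2 (- 1#) Poly-id))) u
    (λ x m → x≡y⇒x-y≡0 (fix x m))

  module Characteristic (p : ℕ) (pp : Prime p) (N : ℕ) (size≡ : size ≡ p ℕ.^ N) where

    ×#1-^ : ∀ m → (m ℕ.^ N) ×# 1# ≡ pow (m ×# 1#) N
    ×#1-^ m = go N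
      where
      go : ∀ N → (m ℕ.^ N) ×# 1# ≡ pow (m ×# 1#) N
      go zero    = +-identityʳ 1#
      go (suc N) = trans (×1-homo-* m (m ℕ.^ N)) (cong ((m ×# 1#) *_) (go N))

    pow≡0 : ∀ {x} n → pow x n ≡ 0# → x ≡ 0#
    pow≡0 zero    e = contradiction (sym e) 0≢1
    pow≡0 {x} (suc n) e with x ≟ 0#
    ... | yes x≡0 = x≡0
    ... | no x≢0  = pow≡0 n (xy≡0⇒y≡0 x≢0 e)

    -- The N-th power of `p ×# 1#` is `size ×# 1#`, which is zero, and a field has no nilpotent
    -- elements.
    char : p ×# 1# ≡ 0#
    char = pow≡0 N (trans (sym (×#1-^ p)) (trans (cong (_×# 1#) (sym size≡)) size×#1≡0))

    ∣⇒×#≡0 : ∀ {m} → p ∣ m → ∀ x → m ×# x ≡ 0#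
    ∣⇒×#≡0 (divides k refl) x = trans (×#≡* (k ℕ.* p) x)
      (trans (cong (_* x) (trans (×1-homo-* k p) (trans (cong ((k ×# 1#) *_) char) (zeroʳ _)))) (zeroˡ x))

    open import Algebra.Properties.CommutativeSemiring.Binomial commutativeSemiring
      using (binomialTerm; binomialExpansion) renaming (theorem to binomial-theorem)
    open import Algebra.Properties.Semiring.Sum semiring using (sum-init-last; sum-cong-≗; sum-replicate-zero) renaming (sum to sumᶠ)
    open import Algebra.Properties.Semiring.Exp semiring using (_^_)

    pow≡^ : ∀ x n → pow x n ≡ x ^ n
    pow≡^ x zero    = refl
    pow≡^ x (suc n) = cong (x *_) (pow≡^ x n)

    frobenius-+ : ∀ x y → pow (x + y) p ≡ pow x p + pow y p
    frobenius-+ x y = main p pp refl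
      where
      -- The module parameter `p` cannot be matched, hence the variable `m`; the shape `suc (suc m)`
      -- exposes the first and last terms of the expansion, and the binomial coefficients between
      -- them vanish.
      main : ∀ m → Prime m → m ≡ p → pow (x + y) m ≡ pow x m + pow y m
      main (suc (suc m)) pm refl = begin
        pow (x + y) n               ≡⟨ pow≡^ (x + y) n ⟩
        (x + y) ^ n                 ≡⟨ binomial-theorem n x y ⟩
        binomialExpansion x y n     ≡⟨⟩
        t Fin.zero + sumᶠ {suc (suc m)} (t ∘ Fin.suc)
                                    ≡⟨ cong (t Fin.zero +_) (sum-init-last {suc m} (t ∘ Fin.suc)) ⟩
        t Fin.zero + (sumᶠ {suc m} (λ i → t (Fin.suc (inject₁ i))) + t (fromℕ n))
          ≡⟨ cong (λ u → t Fin.zero + (u + t (fromℕ n)))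
               (trans (sum-cong-≗ middle) (sum-replicate-zero (suc m))) ⟩
        t Fin.zero + (0# + t (fromℕ n))
          ≡⟨ cong₂ (λ u v → u + (0# + v)) first last ⟩
        y ^ n + (0# + x ^ n)    ≡⟨ cong (y ^ n +_) (+-identityˡ _) ⟩
        y ^ n + x ^ n           ≡⟨ +-comm _ _ ⟩
        x ^ n + y ^ n           ≡⟨ cong₂ _+_ (sym (pow≡^ x n)) (sym (pow≡^ y n)) ⟩
        pow x n + pow y n       ∎
        where
        open ≡-Reasoning
        n = suc (suc m)
        t : Fin (suc n) → Carrier
        t = binomialTerm x y n
        first : t Fin.zero ≡ y ^ n
        first = trans (+-identityʳ _) (*-identityˡ _)
        last : t (fromℕ n) ≡ x ^ n
        last = trans (cong (λ k → (n C k) ×# (x ^ k * y ^ (n ℕ.∸ k))) (Fin.toℕ-fromℕ n))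
          (trans (cong₂ (λ a b → a ×# (x ^ n * y ^ b)) (nCn≡1 n) (ℕ.n∸n≡0 n))
            (trans (+-identityʳ _) (*-identityʳ _)))
        middle : ∀ i → t (Fin.suc (inject₁ i)) ≡ 0#
        middle i = ∣⇒×#≡0 (prime∣binomial pm
          (s≤s (subst (ℕ._< suc m) (sym (Fin.toℕ-inject₁ i)) (Fin.toℕ<n i)))) _

    frobenius^-+ : ∀ k x y → pow (x + y) (p ℕ.^ k) ≡ pow x (p ℕ.^ k) + pow y (p ℕ.^ k)
    frobenius^-+ zero    x y = trans (*-identityʳ _) (cong₂ _+_ (sym (*-identityʳ x)) (sym (*-identityʳ y)))
    frobenius^-+ (suc k) x y = trans (pow-^* (x + y) p (p ℕ.^ k))
      (trans (cong (λ z → pow z p) (frobenius^-+ k x y))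
      (trans (frobenius-+ _ _) (cong₂ _+_ (sym (pow-^* x p (p ℕ.^ k))) (sym (pow-^* y p (p ℕ.^ k))))))

-- Polynomials as coefficient lists, division by monic polynomials, modules over F[X]

module Polynomial (F : FiniteField) where
  open Field F

  infixl 6 _⊕_
  infixl 7 _⊗_
  _⊕_ _⊗_ : List Carrier → List Carrier → List Carrier
  _⊕_ = addP F
  _⊗_ = mulP F

  ⊕-identityʳ : ∀ xs → xs ⊕ [] ≡ xs
  ⊕-identityʳ []       = refl
  ⊕-identityʳ (x ∷ xs) = refl

  ⊕-comm : ∀ xs ys → xs ⊕ ys ≡ ys ⊕ xs
  ⊕-comm []       ys       = sym (⊕-identityʳ ys)
  ⊕-comm (x ∷ xs) []       = refl
  ⊕-comm (x ∷ xs) (y ∷ ys) = cong₂ _∷_ (+-comm x y) (⊕-comm xs ys)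

  ⊕-assoc : ∀ xs ys zs → (xs ⊕ ys) ⊕ zs ≡ xs ⊕ (ys ⊕ zs)
  ⊕-assoc []       ys       zs       = refl
  ⊕-assoc (x ∷ xs) []       zs       = refl
  ⊕-assoc (x ∷ xs) (y ∷ ys) []       = refl
  ⊕-assoc (x ∷ xs) (y ∷ ys) (z ∷ zs) = cong₂ _∷_ (+-assoc x y z) (⊕-assoc xs ys zs)

  ⊕-zeros : ∀ {k} xs → k ℕ.≤ length xs → xs ⊕ toList (replicate k 0#) ≡ xs
  ⊕-zeros {zero}  xs       le       = ⊕-identityʳ xs
  ⊕-zeros {suc k} (x ∷ xs) (s≤s le) = cong₂ _∷_ (+-identityʳ x) (⊕-zeros xs le)

  infixl 6 _+ᵛ_
  infixr 7 _*ᵛ_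
  _+ᵛ_ : ∀ {k} → Vec Carrier k → Vec Carrier k → Vec Carrier k
  _+ᵛ_ = zipWith _+_

  _*ᵛ_ : ∀ {k} → Carrier → Vec Carrier k → Vec Carrier k
  a *ᵛ v = Vec.map (a *_) v

  0ᵛ : ∀ {k} → Vec Carrier k
  0ᵛ = replicate _ 0#

  toList-+ᵛ : ∀ {k} (u v : Vec Carrier k) → toList (u +ᵛ v) ≡ toList u ⊕ toList v
  toList-+ᵛ []       []       = refl
  toList-+ᵛ (x ∷ u) (y ∷ v) = cong (x + y ∷_) (toList-+ᵛ u v)

  -- For `v` of length k the polynomial c + X v has k + 1 coefficients: `push c v` keeps the lower k
  -- of them and `pop c v` is the one that overflows.
  push : ∀ {k} → Carrier → Vec Carrier k → Vec Carrier k
  push c []      = []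
  push c (x ∷ v) = c ∷ push x v

  pop : ∀ {k} → Carrier → Vec Carrier k → Carrier
  pop c []      = c
  pop c (x ∷ v) = pop x v

  toList-push : ∀ {k} c (v : Vec Carrier k) → c ∷ toList v ≡ toList (push c v) ++ pop c v ∷ []
  toList-push c []      = refl
  toList-push c (x ∷ v) = cong (c ∷_) (toList-push x v)

  -- One step of reduction modulo the monic polynomial of u, applied to c + X t.
  reduce : ∀ {k} → Vec Carrier k → Carrier → Vec Carrier k → Vec Carrier k
  reduce u c t = push c t +ᵛ ((- pop c t) *ᵛ u)

  cancel-step : ∀ b x y → b * y + (x + (- b) * y) ≡ x
  cancel-step b x y = trans (lem (b * y) x ((- b) * y)) (trans (cong (x +_)
    (trans (sym (distribʳ y b (- b))) (trans (cong (_* y) (-‿inverseʳ b)) (zeroˡ y)))) (+-identityʳ x))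
    where
    open Solver
    lem : ∀ u x v → u + (x + v) ≡ x + (u + v)
    lem = solve 3 (λ u x v → u :+ (x :+ v) := x :+ (u :+ v)) refl

  toList-reduce′ : ∀ {k} b (x u : Vec Carrier k) →
    List.map (b *_) (monic F u) ⊕ toList (x +ᵛ ((- b) *ᵛ u)) ≡ toList x ++ b ∷ []
  toList-reduce′ b []      []      = cong (_∷ []) (*-identityʳ b)
  toList-reduce′ b (x ∷ v) (y ∷ u) = cong₂ _∷_ (cancel-step b x y) (toList-reduce′ b v u)

  toList-reduce : ∀ {k} (u : Vec Carrier k) c t →
    c ∷ toList t ≡ List.map (pop c t *_) (monic F u) ⊕ toList (reduce u c t)
  toList-reduce u c t = trans (toList-push c t) (sym (toList-reduce′ (pop c t) (push c t) u))

  monic-difference : ∀ {k} (u w : Vec Carrier k) →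
    List.map (1# *_) (monic F u) ⊕ toList (w +ᵛ ((- 1#) *ᵛ u)) ≡ monic F w
  monic-difference u w = toList-reduce′ 1# w u

  1⊗ : ∀ {k} (u : Vec Carrier k) → (1# ∷ []) ⊗ monic F u ≡ List.map (1# *_) (monic F u)
  1⊗ []      = cong (_∷ []) (+-identityʳ _)
  1⊗ (x ∷ u) = cong₂ _∷_ (+-identityʳ _) (⊕-identityʳ _)

  -- Horner-style division by U = `monic F u`: from w = s U + t follows c + X w = (b + X s) U + t′,
  -- where b is the top coefficient of c + X t. Dividend and divisor are monic, hence so is the
  -- quotient, and only its lower coefficients are returned.
  divMod : ∀ {k} (u : Vec Carrier k) j (w : Vec Carrier (j ℕ.+ k)) →
    Σ (Vec Carrier j) λ s → Σ (Vec Carrier k) λ t → (monic F s ⊗ monic F u) ⊕ toList t ≡ monic F w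
  divMod u zero w = [] , _ , trans (cong (_⊕ toList (w +ᵛ ((- 1#) *ᵛ u))) (1⊗ u)) (monic-difference u w)
  divMod u (suc j) (c ∷ w) with s , t , e ← divMod u j w = b ∷ s , t′ , (begin
    (bU ⊕ (0# ∷ M)) ⊕ toList t′     ≡⟨ cong (_⊕ toList t′) (⊕-comm bU (0# ∷ M)) ⟩
    ((0# ∷ M) ⊕ bU) ⊕ toList t′     ≡⟨ ⊕-assoc (0# ∷ M) bU (toList t′) ⟩
    (0# ∷ M) ⊕ (bU ⊕ toList t′)     ≡⟨ cong ((0# ∷ M) ⊕_) (toList-reduce u c t) ⟨
    0# + c ∷ (M ⊕ toList t)         ≡⟨ cong₂ _∷_ (+-identityˡ c) e ⟩
    c ∷ monic F w                   ∎)
    where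
    open ≡-Reasoning
    b  = pop c t
    t′ = reduce u c t
    M  = monic F s ⊗ monic F u
    bU = List.map (b *_) (monic F u)

  length-⊕ : ∀ xs ys → length (xs ⊕ ys) ≡ length xs ℕ.⊔ length ys
  length-⊕ []       ys       = refl
  length-⊕ (x ∷ xs) []       = refl
  length-⊕ (x ∷ xs) (y ∷ ys) = cong suc (length-⊕ xs ys)

  length-monic : ∀ {k} (v : Vec Carrier k) → length (monic F v) ≡ suc k
  length-monic []      = refl
  length-monic (x ∷ v) = cong suc (length-monic v)

  length-product : ∀ {j k} (s : Vec Carrier j) (u : Vec Carrier k) →
    length (monic F s ⊗ monic F u) ≡ suc (j ℕ.+ k)
  length-product {k = k} []          u = trans (length-⊕ (List.map (1# *_) (monic F u)) _)
    (cong (ℕ._⊔ 1) (trans (List.length-map _ (monic F u)) (length-monic u)) ⟨ trans ⟩ cong suc (ℕ.⊔-identityʳ k))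
    where open import Function using (_⟨_⟩_)
  length-product {suc j} {k} (c ∷ s) u = trans (length-⊕ (List.map (c *_) (monic F u)) _)
    (trans (cong₂ ℕ._⊔_ (trans (List.length-map _ (monic F u)) (length-monic u)) (cong suc (length-product s u)))
      (cong suc (ℕ.m≤n⇒m⊔n≡n (ℕ.≤-trans (ℕ.m≤n+m k j) (ℕ.n≤1+n _)))))

  product-zeros : ∀ {j k} (s : Vec Carrier j) (u : Vec Carrier k) →
    (monic F s ⊗ monic F u) ⊕ toList (0ᵛ {k}) ≡ monic F s ⊗ monic F u
  product-zeros {j} {k} s u = ⊕-zeros _ (subst (k ℕ.≤_) (sym (length-product s u)) (ℕ.≤-trans (ℕ.m≤n+m k j) (ℕ.n≤1+n _)))

  -- X^(n+2) - X
  X^-X : ∀ n → Vec Carrier (suc (suc n))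
  X^-X n = 0# ∷ - 1# ∷ replicate n 0#

  -- An F-vector space M with a linear operator T, i.e. a module over F[X].
  record Action (M : Set) : Set where
    infixl 6 _+ᴹ_
    infixr 7 _·_
    field
      _+ᴹ_       : M → M → M
      0ᴹ         : M
      _·_        : Carrier → M → M
      T          : M → M
      isCM       : IsCommutativeMonoid _≡_ _+ᴹ_ 0ᴹ
      ·-distribʳ : ∀ m a b → (a + b) · m ≡ a · m +ᴹ b · m
      ·-distribˡ : ∀ a m n → a · (m +ᴹ n) ≡ a · m +ᴹ a · n
      ·-assoc    : ∀ a b m → (a * b) · m ≡ a · (b · m)
      1·         : ∀ m → 1# · m ≡ m
      0·         : ∀ m → 0# · m ≡ 0ᴹ
      T-+        : ∀ m n → T (m +ᴹ n) ≡ T m +ᴹ T n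
      T-·        : ∀ a m → T (a · m) ≡ a · T m

    open IsCommutativeMonoid isCM public using () renaming (assoc to +ᴹ-assoc; comm to +ᴹ-comm;
      identityˡ to +ᴹ-identityˡ; identityʳ to +ᴹ-identityʳ)
    open Power.Laws _+ᴹ_ 0ᴹ isCM using (interchange)

    ·0ᴹ : ∀ a → a · 0ᴹ ≡ 0ᴹ
    ·0ᴹ a = trans (cong (a ·_) (sym (0· 0ᴹ))) (trans (sym (·-assoc a 0# 0ᴹ))
      (trans (cong (_· 0ᴹ) (zeroʳ a)) (0· 0ᴹ)))

    T0ᴹ : T 0ᴹ ≡ 0ᴹ
    T0ᴹ = trans (cong T (sym (0· 0ᴹ))) (trans (T-· 0# 0ᴹ) (0· _))

    act : List Carrier → M → M
    act []       m = 0ᴹ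
    act (c ∷ cs) m = c · m +ᴹ T (act cs m)

    act-⊕ : ∀ P R m → act (P ⊕ R) m ≡ act P m +ᴹ act R m
    act-⊕ []       R        m = sym (+ᴹ-identityˡ _)
    act-⊕ (a ∷ P) []       m = sym (+ᴹ-identityʳ _)
    act-⊕ (a ∷ P) (b ∷ R) m = trans (cong₂ _+ᴹ_ (·-distribʳ m a b) (trans (cong T (act-⊕ P R m)) (T-+ _ _)))
      (interchange (a · m) (b · m) (T (act P m)) (T (act R m)))

    act-map : ∀ a P m → act (List.map (a *_) P) m ≡ a · act P m
    act-map a []      m = sym (·0ᴹ a)
    act-map a (c ∷ P) m = trans (cong₂ _+ᴹ_ (·-assoc a c m) (trans (cong T (act-map a P m)) (T-· a _)))
      (sym (·-distribˡ a (c · m) _))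

    act-⊗ : ∀ P R m → act (P ⊗ R) m ≡ act P (act R m)
    act-⊗ []      R m = refl
    act-⊗ (a ∷ P) R m = trans (act-⊕ (List.map (a *_) R) (0# ∷ P ⊗ R) m)
      (cong₂ _+ᴹ_ (act-map a R m)
        (trans (cong₂ _+ᴹ_ (0· m) (cong T (act-⊗ P R m))) (+ᴹ-identityˡ _)))

    act-0ᴹ : ∀ P → act P 0ᴹ ≡ 0ᴹ
    act-0ᴹ []      = refl
    act-0ᴹ (a ∷ P) = trans (cong₂ _+ᴹ_ (·0ᴹ a) (trans (cong T (act-0ᴹ P)) T0ᴹ)) (+ᴹ-identityˡ _)

    act-+ : ∀ P m n → act P (m +ᴹ n) ≡ act P m +ᴹ act P n
    act-+ []      m n = sym (+ᴹ-identityˡ _)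
    act-+ (a ∷ P) m n = trans (cong₂ _+ᴹ_ (·-distribˡ a m n) (trans (cong T (act-+ P m n)) (T-+ _ _)))
      (interchange _ _ _ _)

    ·-comm : ∀ a b m → a · (b · m) ≡ b · (a · m)
    ·-comm a b m = trans (sym (·-assoc a b m)) (trans (cong (_· m) (*-comm a b)) (·-assoc b a m))

    act-· : ∀ P a m → act P (a · m) ≡ a · act P m
    act-· []      a m = sym (·0ᴹ a)
    act-· (b ∷ P) a m = trans (cong₂ _+ᴹ_ (·-comm b a m) (trans (cong T (act-· P a m)) (T-· a _)))
      (sym (·-distribˡ a _ _))

    act-T : ∀ P m → act P (T m) ≡ T (act P m)
    act-T []      m = sym T0ᴹ
    act-T (a ∷ P) m = trans (cong₂ _+ᴹ_ (sym (T-· a m)) (cong T (act-T P m))) (sym (T-+ _ _))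

    act-act : ∀ P R m → act P (act R m) ≡ act R (act P m)
    act-act P []      m = act-0ᴹ P
    act-act P (b ∷ R) m = trans (act-+ P _ _)
      (cong₂ _+ᴹ_ (act-· P b m) (trans (act-T P _) (cong T (act-act P R m))))

    act-zeros : ∀ k m → act (toList (0ᵛ {k})) m ≡ 0ᴹ
    act-zeros zero    m = refl
    act-zeros (suc k) m = trans (cong₂ _+ᴹ_ (0· m) (trans (cong T (act-zeros k m)) T0ᴹ)) (+ᴹ-identityˡ _)

    act-∷ʳ0 : ∀ P m → act (P ++ 0# ∷ []) m ≡ act P m
    act-∷ʳ0 []      m = trans (cong₂ _+ᴹ_ (0· m) T0ᴹ) (+ᴹ-identityˡ _)
    act-∷ʳ0 (a ∷ P) m = cong (λ z → a · m +ᴹ T z) (act-∷ʳ0 P m)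

    iter : ℕ → M → M
    iter zero    m = m
    iter (suc n) m = T (iter n m)

    act-Xⁿ : ∀ n m → act (monic F (replicate n 0#)) m ≡ iter n m
    act-Xⁿ zero    m = trans (cong₂ _+ᴹ_ (1· m) T0ᴹ) (+ᴹ-identityʳ m)
    act-Xⁿ (suc n) m = trans (cong₂ _+ᴹ_ (0· m) (cong T (act-Xⁿ n m))) (+ᴹ-identityˡ _)

    act-X^-X′ : ∀ n m → act (monic F (X^-X n)) m ≡ (- 1#) · T m +ᴹ iter (suc (suc n)) m
    act-X^-X′ n m = trans (cong₂ _+ᴹ_ (0· m) (T-+ _ _)) (trans (+ᴹ-identityˡ _)
      (cong₂ _+ᴹ_ (T-· (- 1#) m) (cong (T ∘ T) (act-Xⁿ n m))))

    -m+m : ∀ m → (- 1#) · m +ᴹ m ≡ 0ᴹ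
    -m+m m = trans (cong ((- 1#) · m +ᴹ_) (sym (1· m))) (trans (sym (·-distribʳ m (- 1#) 1#))
      (trans (cong (_· m) (-‿inverseˡ 1#)) (0· m)))

    -- Applied to the unit of `L` or of F[X]/(g), where iterating `T` forms powers, this turns a
    -- Frobenius identity into a polynomial relation.
    act-X^-X : ∀ n m → iter (suc (suc n)) m ≡ T m → act (monic F (X^-X n)) m ≡ 0ᴹ
    act-X^-X n m e = trans (act-X^-X′ n m) (trans (cong ((- 1#) · T m +ᴹ_) e) (-m+m (T m)))

    act-X^-X⁻¹ : ∀ n m → act (monic F (X^-X n)) m ≡ 0ᴹ → iter (suc (suc n)) m ≡ T m
    act-X^-X⁻¹ n m e = trans (sym (+ᴹ-identityˡ _)) (trans (cong (_+ᴹ y) (sym (trans (+ᴹ-comm (T m) _) (-m+m (T m)))))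
      (trans (+ᴹ-assoc (T m) _ y) (trans (cong (T m +ᴹ_) (trans (sym (act-X^-X′ n m)) e)) (+ᴹ-identityʳ _))))
      where
      y = iter (suc (suc n)) m

    act-divMod : ∀ {j k} {P} (s : Vec Carrier j) (u t : Vec Carrier k) m →
      (monic F s ⊗ monic F u) ⊕ toList t ≡ P →
      act P m ≡ act (monic F s) (act (monic F u) m) +ᴹ act (toList t) m
    act-divMod s u t m refl = trans (act-⊕ (monic F s ⊗ monic F u) (toList t) m)
      (cong (_+ᴹ act (toList t) m) (act-⊗ (monic F s) (monic F u) m))

    remainder-act : ∀ {j k} {P} (s : Vec Carrier j) (u t : Vec Carrier k) m →
      (monic F s ⊗ monic F u) ⊕ toList t ≡ P → act (monic F u) m ≡ 0ᴹ → act P m ≡ act (toList t) m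
    remainder-act s u t m e z = trans (act-divMod s u t m e)
      (trans (cong (_+ᴹ act (toList t) m) (trans (cong (act (monic F s)) z) (act-0ᴹ (monic F s)))) (+ᴹ-identityˡ _))

    -- The annihilator of m ≠ 0 is a proper ideal containing the irreducible g, hence is generated by g:
    -- a monic annihilator u of least degree < deg g would divide g.
    no-smaller-annihilator : ∀ {e} (g : Vec Carrier e) → Irreducible F g → ∀ {m} → m ≢ 0ᴹ →
      act (monic F g) m ≡ 0ᴹ → ∀ k → k ℕ.< e → (∀ (t : Vec Carrier k) → act (toList t) m ≡ 0ᴹ → t ≡ 0ᵛ) →
      (u : Vec Carrier k) → act (monic F u) m ≢ 0ᴹ
    no-smaller-annihilator g irr m≢0 gm zero k<e minimal [] um =
      m≢0 (trans (sym (trans (cong₂ _+ᴹ_ (1· _) T0ᴹ) (+ᴹ-identityʳ _))) um)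
    no-smaller-annihilator {e} g (_ , irr) {m} m≢0 gm k@(suc _) k<e minimal u um
      with j , k+j ← ℕ.m≤n⇒∃[o]m+o≡n (ℕ.<⇒≤ k<e) = divide j (trans (ℕ.+-comm j k) k+j)
      where
      divide : ∀ j → j ℕ.+ k ≢ e
      divide zero    refl = ℕ.<-irrefl refl k<e
      divide (suc j) refl with s , t , eq ← divMod u (suc j) g
        with refl ← minimal t (trans (sym (remainder-act s u t m eq um)) gm) =
        irr (suc j , k , s , u , s≤s z≤n , s≤s z≤n , trans (sym (product-zeros s u)) eq)

    -- Induction on the length. A zero top coefficient is dropped; a nonzero one is scaled to 1,
    -- which gives a monic annihilator of degree k < e, while by induction no nonzero polynomial of
    -- degree < k annihilates `m`.
    irreducible-annihilator : ∀ {e} (g : Vec Carrier e) → Irreducible F g → ∀ {m} → m ≢ 0ᴹ →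
      act (monic F g) m ≡ 0ᴹ → ∀ k → k ℕ.≤ e → (v : Vec Carrier k) → act (toList v) m ≡ 0ᴹ → v ≡ 0ᵛ
    irreducible-annihilator g irr m≢0 gm zero k≤e [] vm = refl
    irreducible-annihilator g irr {m} m≢0 gm (suc k) k<e v vm with Vec.initLast v
    ... | v′ , b , refl with b ≟ 0#
    ...   | yes refl = trans (cong (_∷ʳ 0#) (irreducible-annihilator g irr m≢0 gm k (ℕ.<⇒≤ k<e) v′ v′m)) (zeros k)
      where
      zeros : ∀ k → 0ᵛ {k} ∷ʳ 0# ≡ 0ᵛ
      zeros zero    = refl
      zeros (suc k) = cong (0# ∷_) (zeros k)
      v′m : act (toList v′) m ≡ 0ᴹ
      v′m = trans (sym (act-∷ʳ0 (toList v′) m)) (trans (cong (λ l → act l m) (sym (Vec.toList-∷ʳ 0# v′))) vm)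
    ...   | no b≢0 with c , bc ← inverse b b≢0 = contradiction um
        (no-smaller-annihilator g irr m≢0 gm k k<e
          (irreducible-annihilator g irr m≢0 gm k (ℕ.<⇒≤ k<e)) (c *ᵛ v′))
      where
      monic-c* : ∀ {l} (w : Vec Carrier l) → monic F (c *ᵛ w) ≡ List.map (c *_) (toList (w ∷ʳ b))
      monic-c* []      = cong (_∷ []) (trans (sym bc) (*-comm b c))
      monic-c* (x ∷ w) = cong (c * x ∷_) (monic-c* w)
      um : act (monic F (c *ᵛ v′)) m ≡ 0ᴹ
      um = trans (cong (λ l → act l m) (monic-c* v′))
        (trans (act-map c (toList (v′ ∷ʳ b)) m) (trans (cong (c ·_) vm) (·0ᴹ c)))

-- Coefficient vectors and the field F[X]/(g)

module Vectors (F : FiniteField) where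
  open Field F
  open Polynomial F

  allVecs-complete : ∀ {k} (v : Vec Carrier k) → v ∈ allVecs F k
  allVecs-complete []      = here refl
  allVecs-complete (a ∷ v) = ∈-concatMap⁺ _ (Any.map (λ { refl → ∈-map⁺ (a ∷_) (allVecs-complete v) }) (complete a))

  allVecs-unique : ∀ k → Unique (allVecs F k)
  allVecs-unique zero    = All.[] ∷ []
  allVecs-unique (suc k) = Unique.concat⁺
    (All.map⁺ (All.universal (λ a → Unique.map⁺ (proj₂ ∘ Vec.∷-injective) (allVecs-unique k)) elements))
    (AllPairs.map⁺ (AllPairs.map disjoint unique))
    where
    disjoint : ∀ {a b} → a ≢ b → ∀ {v} →
      ¬ (v ∈ List.map (a ∷_) (allVecs F k) × v ∈ List.map (b ∷_) (allVecs F k))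
    disjoint a≢b (m , n) with _ , _ , refl ← ∈-map⁻ _ m | _ , _ , e ← ∈-map⁻ _ n = a≢b (proj₁ (Vec.∷-injective e))

  allVecs-length : ∀ k → length (allVecs F k) ≡ size ℕ.^ k
  allVecs-length zero    = refl
  allVecs-length (suc k) = go elements
    where
    go : ∀ xs → length (concatMap (λ a → List.map (a ∷_) (allVecs F k)) xs) ≡ length xs ℕ.* size ℕ.^ k
    go []       = refl
    go (x ∷ xs) = trans (List.length-++ (List.map (x ∷_) (allVecs F k)))
      (cong₂ ℕ._+_ (trans (List.length-map _ (allVecs F k)) (allVecs-length k)) (go xs))

  _≟ᵛ_ : ∀ {k} → DecidableEquality (Vec Carrier k)
  _≟ᵛ_ = Vec.≡-dec _≟_

  +ᵛ-isCommutativeMonoid : ∀ {k} → IsCommutativeMonoid _≡_ (_+ᵛ_ {k}) 0ᵛ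
  +ᵛ-isCommutativeMonoid = record
    { isMonoid = record
      { isSemigroup = record
        { isMagma = record { isEquivalence = isEquivalence ; ∙-cong = cong₂ _+ᵛ_ }
        ; assoc = Vec.zipWith-assoc +-assoc }
      ; identity = Vec.zipWith-identityˡ +-identityˡ , Vec.zipWith-identityʳ +-identityʳ }
    ; comm = Vec.zipWith-comm +-comm }

  *ᵛ-distribʳ : ∀ {k} (v : Vec Carrier k) a b → (a + b) *ᵛ v ≡ a *ᵛ v +ᵛ b *ᵛ v
  *ᵛ-distribʳ []      a b = refl
  *ᵛ-distribʳ (x ∷ v) a b = cong₂ _∷_ (distribʳ x a b) (*ᵛ-distribʳ v a b)

  *ᵛ-distribˡ : ∀ {k} a (u v : Vec Carrier k) → a *ᵛ (u +ᵛ v) ≡ a *ᵛ u +ᵛ a *ᵛ v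
  *ᵛ-distribˡ a []      []      = refl
  *ᵛ-distribˡ a (x ∷ u) (y ∷ v) = cong₂ _∷_ (distribˡ a x y) (*ᵛ-distribˡ a u v)

  *ᵛ-assoc : ∀ {k} a b (v : Vec Carrier k) → (a * b) *ᵛ v ≡ a *ᵛ (b *ᵛ v)
  *ᵛ-assoc a b []      = refl
  *ᵛ-assoc a b (x ∷ v) = cong₂ _∷_ (*-assoc a b x) (*ᵛ-assoc a b v)

  1*ᵛ : ∀ {k} (v : Vec Carrier k) → 1# *ᵛ v ≡ v
  1*ᵛ []      = refl
  1*ᵛ (x ∷ v) = cong₂ _∷_ (*-identityˡ x) (1*ᵛ v)

  0*ᵛ : ∀ {k} (v : Vec Carrier k) → 0# *ᵛ v ≡ 0ᵛ
  0*ᵛ []      = refl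
  0*ᵛ (x ∷ v) = cong₂ _∷_ (zeroˡ x) (0*ᵛ v)

  v-v : ∀ {k} (v : Vec Carrier k) → v +ᵛ ((- 1#) *ᵛ v) ≡ 0ᵛ
  v-v v = trans (cong (_+ᵛ ((- 1#) *ᵛ v)) (sym (1*ᵛ v))) (trans (sym (*ᵛ-distribʳ v 1# (- 1#)))
    (trans (cong (_*ᵛ v) (-‿inverseʳ 1#)) (0*ᵛ v)))

  x-y≡0ᵛ⇒x≡y : ∀ {k} (u v : Vec Carrier k) → u +ᵛ ((- 1#) *ᵛ v) ≡ 0ᵛ → u ≡ v
  x-y≡0ᵛ⇒x≡y []      []      e = refl
  x-y≡0ᵛ⇒x≡y (x ∷ u) (y ∷ v) e = cong₂ _∷_
    (x-y≡0⇒x≡y (trans (cong (x +_) (trans (cong -_ (sym (*-identityˡ y))) (-‿distribˡ-* 1# y)))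
      (proj₁ (Vec.∷-injective e))))
    (x-y≡0ᵛ⇒x≡y u v (proj₂ (Vec.∷-injective e)))

  push-+ : ∀ {k} c d (u v : Vec Carrier k) → push (c + d) (u +ᵛ v) ≡ push c u +ᵛ push d v
  push-+ c d []      []      = refl
  push-+ c d (x ∷ u) (y ∷ v) = cong (c + d ∷_) (push-+ x y u v)

  pop-+ : ∀ {k} c d (u v : Vec Carrier k) → pop (c + d) (u +ᵛ v) ≡ pop c u + pop d v
  pop-+ c d []      []      = refl
  pop-+ c d (x ∷ u) (y ∷ v) = pop-+ x y u v

  push-* : ∀ {k} a c (v : Vec Carrier k) → push (a * c) (a *ᵛ v) ≡ a *ᵛ push c v
  push-* a c []      = refl
  push-* a c (x ∷ v) = cong (a * c ∷_) (push-* a x v)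

  pop-* : ∀ {k} a c (v : Vec Carrier k) → pop (a * c) (a *ᵛ v) ≡ a * pop c v
  pop-* a c []      = refl
  pop-* a c (x ∷ v) = pop-* a x v

  reduce-+ : ∀ {k} (g : Vec Carrier k) c d u v → reduce g (c + d) (u +ᵛ v) ≡ reduce g c u +ᵛ reduce g d v
  reduce-+ g c d u v = trans (cong₂ (λ x y → x +ᵛ (y *ᵛ g)) (push-+ c d u v)
      (trans (cong -_ (pop-+ c d u v)) (sym (-‿+-comm (pop c u) (pop d v)))))
    (trans (cong (push c u +ᵛ push d v +ᵛ_) (*ᵛ-distribʳ g _ _)) (Power.Laws.interchange _ _ +ᵛ-isCommutativeMonoid _ _ _ _))

  reduce-* : ∀ {k} (g : Vec Carrier k) a c v → reduce g (a * c) (a *ᵛ v) ≡ a *ᵛ reduce g c v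
  reduce-* g a c v = trans (cong₂ (λ x y → x +ᵛ (y *ᵛ g)) (push-* a c v)
      (trans (cong -_ (pop-* a c v)) (-‿distribʳ-* a (pop c v))))
    (trans (cong (a *ᵛ push c v +ᵛ_) (*ᵛ-assoc a _ g)) (sym (*ᵛ-distribˡ a _ _)))

  -- F[X]/(g), with X acting by a step of the reduction modulo g.
  quotientAction : ∀ {k} → Vec Carrier k → Action (Vec Carrier k)
  quotientAction g = record
    { _+ᴹ_ = _+ᵛ_
    ; 0ᴹ = 0ᵛ
    ; _·_ = _*ᵛ_
    ; T = reduce g 0#
    ; isCM = +ᵛ-isCommutativeMonoid
    ; ·-distribʳ = *ᵛ-distribʳ
    ; ·-distribˡ = *ᵛ-distribˡ
    ; ·-assoc = *ᵛ-assoc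
    ; 1· = 1*ᵛ
    ; 0· = 0*ᵛ
    ; T-+ = λ u v → trans (cong (λ z → reduce g z (u +ᵛ v)) (sym (+-identityʳ 0#))) (reduce-+ g 0# 0# u v)
    ; T-· = λ a v → trans (cong (λ z → reduce g z (a *ᵛ v)) (sym (zeroʳ a))) (reduce-* g a 0# v)
    }

  pad : List Carrier → ∀ k → Vec Carrier k
  pad _        zero    = []
  pad []       (suc k) = 0# ∷ pad [] k
  pad (c ∷ cs) (suc k) = c ∷ pad cs k

  push-pad : ∀ d cs k → push d (pad cs (suc k)) ≡ d ∷ pad cs k
  push-pad d []       zero    = refl
  push-pad d (c ∷ cs) zero    = refl
  push-pad d []       (suc k) = cong (d ∷_) (push-pad 0# [] k)
  push-pad d (c ∷ cs) (suc k) = cong (d ∷_) (push-pad c cs k)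

  pop-pad : ∀ d cs k → length cs ℕ.≤ k → pop d (pad cs (suc k)) ≡ 0#
  pop-pad d []       zero    z≤n      = refl
  pop-pad d []       (suc k) z≤n      = pop-pad 0# [] k z≤n
  pop-pad d (c ∷ cs) (suc k) (s≤s le) = pop-pad c cs k le

  pad-toList : ∀ {k} (v : Vec Carrier k) cs → pad (toList v ++ cs) k ≡ v
  pad-toList []      cs = refl
  pad-toList (x ∷ v) cs = cong (x ∷_) (pad-toList v cs)

  pop-pad-monic : ∀ {k} d (v : Vec Carrier k) → pop d (pad (monic F v) (suc k)) ≡ 1#
  pop-pad-monic d []      = refl
  pop-pad-monic d (x ∷ v) = pop-pad-monic x v

  module Quotient {m : ℕ} (g : Vec Carrier (suc m)) (irr : Irreducible F g) where
    e = suc m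

    open Action (quotientAction g)

    one : Vec Carrier e
    one = 1# ∷ 0ᵛ

    c*one+0∷ : ∀ c (v : Vec Carrier m) → (c *ᵛ one) +ᵛ (0# ∷ v) ≡ c ∷ v
    c*one+0∷ c v = cong₂ _∷_ (trans (+-identityʳ _) (*-identityʳ c))
      (trans (cong (_+ᵛ v) (trans (Vec.map-replicate (c *_) 0# m) (cong (replicate m) (zeroʳ c)))) (+ᵛ-identityˡ v))
      where open IsCommutativeMonoid (+ᵛ-isCommutativeMonoid {m}) using () renaming (identityˡ to +ᵛ-identityˡ)

    -0*ᵛ : ∀ {x} → x ≡ 0# → (v w : Vec Carrier e) → v +ᵛ ((- x) *ᵛ w) ≡ v
    -0*ᵛ refl v w = trans (cong (v +ᵛ_) (trans (cong (_*ᵛ w) -0≡0) (0*ᵛ w))) (+ᴹ-identityʳ v)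
      where
      -0≡0 : - 0# ≡ 0#
      -0≡0 = trans (sym (+-identityˡ _)) (-‿inverseʳ 0#)

    -- With at most e coefficients nothing overflows, so no reduction modulo `g` takes place: `one`
    -- generates the module and a residue acts on it as its own name.
    act-one : ∀ cs → length cs ℕ.≤ e → act cs one ≡ pad cs e
    act-one []       le       = zeros e
      where
      zeros : ∀ k → 0ᵛ ≡ pad [] k
      zeros zero    = refl
      zeros (suc k) = cong (0# ∷_) (zeros k)
    act-one (c ∷ cs) (s≤s le) = begin
      c *ᵛ one +ᵛ reduce g 0# (act cs one)   ≡⟨ cong (λ z → c *ᵛ one +ᵛ reduce g 0# z) (act-one cs (ℕ.≤-trans le (ℕ.n≤1+n m))) ⟩
      c *ᵛ one +ᵛ reduce g 0# (pad cs e)     ≡⟨ cong (c *ᵛ one +ᵛ_) (-0*ᵛ (pop-pad 0# cs m le) _ g) ⟩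
      c *ᵛ one +ᵛ push 0# (pad cs e)         ≡⟨ cong (c *ᵛ one +ᵛ_) (push-pad 0# cs m) ⟩
      c *ᵛ one +ᵛ (0# ∷ pad cs m)            ≡⟨ c*one+0∷ c (pad cs m) ⟩
      c ∷ pad cs m                           ∎
      where open ≡-Reasoning

    act-toList-one : ∀ (v : Vec Carrier e) → act (toList v) one ≡ v
    act-toList-one v = trans (act-one (toList v) (ℕ.≤-reflexive (Vec.length-toList v)))
      (trans (cong (λ l → pad l e) (sym (List.++-identityʳ (toList v)))) (pad-toList v []))

    -- Here exactly one reduction happens: the leading coefficient 1 overflows in the last step, and
    -- `g` is subtracted from its own lower coefficients.
    act-g-one : act (monic F g) one ≡ 0ᵛ
    act-g-one = go g refl
      where
      open ≡-Reasoning
      go : ∀ g′ → g′ ≡ g → act (monic F g′) one ≡ 0ᵛ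
      go (c ∷ v) refl = begin
        c *ᵛ one +ᵛ reduce g 0# (act (monic F v) one)
          ≡⟨ cong (λ z → c *ᵛ one +ᵛ reduce g 0# z) (act-one (monic F v) (ℕ.≤-reflexive (length-monic v))) ⟩
        c *ᵛ one +ᵛ (push 0# (pad (monic F v) e) +ᵛ (- pop 0# (pad (monic F v) e)) *ᵛ g)
          ≡⟨ cong₂ (λ x y → c *ᵛ one +ᵛ (x +ᵛ ((- y) *ᵛ g))) (trans (push-pad 0# (monic F v) m) (cong (0# ∷_) (pad-toList v _))) (pop-pad-monic 0# v) ⟩
        c *ᵛ one +ᵛ ((0# ∷ v) +ᵛ (- 1#) *ᵛ g)   ≡⟨ +ᴹ-assoc _ _ _ ⟨
        c *ᵛ one +ᵛ (0# ∷ v) +ᵛ (- 1#) *ᵛ g     ≡⟨ cong (_+ᵛ ((- 1#) *ᵛ g)) (c*one+0∷ c v) ⟩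
        g +ᵛ (- 1#) *ᵛ g                        ≡⟨ v-v g ⟩
        0ᵛ                                      ∎

    -- The product of F[X]/(g), read off from the module structure; commutativity and associativity
    -- hold because polynomial actions commute and `one` is a generator.
    mul : Vec Carrier e → Vec Carrier e → Vec Carrier e
    mul u v = act (toList u) v

    mul-comm : ∀ u v → mul u v ≡ mul v u
    mul-comm u v = trans (cong (act (toList u)) (sym (act-toList-one v)))
      (trans (act-act (toList u) (toList v) one) (cong (act (toList v)) (act-toList-one u)))

    mul-assoc : ∀ u v w → mul (mul u v) w ≡ mul u (mul v w)
    mul-assoc u v w = trans (mul-comm (mul u v) w) (trans (act-act (toList w) (toList u) v)
      (cong (mul u) (mul-comm w v)))

    mul-identityˡ : ∀ v → mul one v ≡ v
    mul-identityˡ v = trans (mul-comm one v) (act-toList-one v)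

    mul-isCommutativeMonoid : IsCommutativeMonoid _≡_ mul one
    mul-isCommutativeMonoid = record
      { isMonoid = record
        { isSemigroup = record
          { isMagma = record { isEquivalence = isEquivalence ; ∙-cong = cong₂ mul }
          ; assoc = mul-assoc }
        ; identity = mul-identityˡ , act-toList-one }
      ; comm = mul-comm }

    -- The difference of `x` and `y` annihilates `a`, which is also annihilated by the irreducible
    -- `g`; having degree < e, the difference is zero. Cancellation is the form in which `fermat`
    -- uses that F[X]/(g) is a field.
    mul-cancel : ∀ {a x y} → a ≢ 0ᵛ → mul a x ≡ mul a y → x ≡ y
    mul-cancel {a} {x} {y} a≢0 eq = x-y≡0ᵛ⇒x≡y x y
      (irreducible-annihilator g irr a≢0 (trans (cong (act (monic F g)) (sym (act-toList-one a)))
          (trans (act-act (monic F g) (toList a) one) (trans (cong (act (toList a)) act-g-one) (act-0ᴹ (toList a)))))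
        e ℕ.≤-refl (x +ᵛ ((- 1#) *ᵛ y)) difference)
      where
      difference : mul (x +ᵛ ((- 1#) *ᵛ y)) a ≡ 0ᵛ
      difference = trans (mul-comm _ a) (trans (act-+ (toList a) x _)
        (trans (cong₂ _+ᵛ_ eq (act-· (toList a) (- 1#) y)) (v-v (mul a y))))

    -- The class of X; going through `reduce` makes this right for e = 1 as well, where X itself is
    -- not reduced.
    ξ : Vec Carrier e
    ξ = reduce g 0# one

    open Power mul one

    ξ-frobenius : power ξ (size ℕ.^ e) ≡ ξ
    ξ-frobenius = trans (cong (power ξ) (sym (allVecs-length e)))
      (Laws.fermat mul-isCommutativeMonoid 0ᵛ (λ v → act-0ᴹ (toList v)) mul-cancel _≟ᵛ_
        (allVecs F e) allVecs-complete (allVecs-unique e) ξ)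

    power-fixed : ∀ j → power ξ ((size ℕ.^ e) ℕ.^ j) ≡ ξ
    power-fixed zero    = act-toList-one ξ
    power-fixed (suc j) = trans (cong (power ξ) (ℕ.*-comm (size ℕ.^ e) _))
      (trans (Laws.power-* mul-isCommutativeMonoid ξ ((size ℕ.^ e) ℕ.^ j) (size ℕ.^ e))
        (trans (cong (λ z → power z ((size ℕ.^ e) ℕ.^ j)) ξ-frobenius) (power-fixed j)))

    T≡ξ* : ∀ v → T v ≡ mul ξ v
    T≡ξ* v = trans (cong T (sym (act-toList-one v))) (trans (sym (act-T (toList v) one)) (mul-comm v ξ))

    iter-one : ∀ n → iter n one ≡ power ξ n
    iter-one zero    = refl
    iter-one (suc n) = trans (T≡ξ* _) (cong (mul ξ) (iter-one n))

    -- The remainder modulo `g` acts on `one` as X^(n+2) - X does, which is by zero, and a remainder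
    -- equals its own action on `one`.
    divides-X^-X : ∀ n j → j ℕ.+ e ≡ suc (suc n) → power ξ (suc (suc n)) ≡ ξ →
      Σ (Vec Carrier j) λ s → monic F s ⊗ monic F g ≡ monic F (X^-X n)
    divides-X^-X n j eq fix = go (X^-X n) (act-X^-X n one (trans (iter-one (suc (suc n))) fix)) (sym eq)
      where
      go : ∀ {k} (w : Vec Carrier k) → act (monic F w) one ≡ 0ᵛ → k ≡ j ℕ.+ e →
        Σ (Vec Carrier j) λ s → monic F s ⊗ monic F g ≡ monic F w
      go w w0 refl with s , t , d ← divMod g j w
        with refl ← trans (sym (act-toList-one t)) (trans (sym (remainder-act s g t one d act-g-one)) w0)
        = s , trans (sym (product-zeros s g)) d

-- Least witnesses and growth of powers

least : {P : ℕ → Set} → (∀ n → Dec (P n)) → ∀ n → P n → ∃ λ m → P m × (∀ k → k ℕ.< m → ¬ P k)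
least {P} P? n = go n (<-wellFounded n)
  where
  go : ∀ n → Acc ℕ._<_ n → P n → ∃ λ m → P m × (∀ k → k ℕ.< m → ¬ P k)
  go n (acc rs) pn with ℕ.anyUpTo? P? n
  ... | yes (m , m<n , pm) = go m (rs m<n) pm
  ... | no none            = n , pn , λ k k<n pk → none (k , k<n , pk)

n<m^n : ∀ {m} n → 2 ℕ.≤ m → n ℕ.< m ℕ.^ n
n<m^n zero    m≥2 = s≤s z≤n
n<m^n {m} (suc n) m≥2 = ℕ.≤-trans (ℕ.+-mono-≤ (ℕ.≤-trans (s≤s z≤n) (n<m^n n m≥2)) (n<m^n n m≥2))
  (ℕ.≤-trans (ℕ.≤-reflexive (cong (m ℕ.^ n ℕ.+_) (sym (ℕ.+-identityʳ _)))) (ℕ.*-monoˡ-≤ (m ℕ.^ n) m≥2))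

^-cancelʳ-≤ : ∀ m {a b} → 2 ℕ.≤ m → m ℕ.^ a ℕ.≤ m ℕ.^ b → a ℕ.≤ b
^-cancelʳ-≤ m {a} {b} m≥2 le with a ℕ.≤? b
... | yes a≤b = a≤b
... | no  a≰b = contradiction le (ℕ.<⇒≱ (ℕ.^-monoʳ-< m m≥2 (ℕ.≰⇒> a≰b)))

-- The extension L of F: evaluation, Frobenius orbits, minimal polynomials

module Extension (p : ℕ) (pp : Prime p) (n r : ℕ) (F L : FiniteField) (h : Hom F L)
  (sizeF : FiniteField.size F ≡ p ℕ.^ n) (sizeL : FiniteField.size L ≡ (p ℕ.^ n) ℕ.^ r) (r≥1 : 1 ℕ.≤ r) where

  module F = Field F
  open Field L public
  open Polynomial F public using (Action; X^-X; _⊕_; _⊗_; length-monic; length-product; divMod; product-zeros; 0ᵛ; _+ᵛ_; _*ᵛ_; toList-+ᵛ)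
  open Vectors F public
  open Hom h public
  open Characteristic p pp (n ℕ.* r) (trans sizeL (ℕ.^-*-assoc p n r)) public

  q = p ℕ.^ n

  q≥2 : 2 ℕ.≤ q
  q≥2 = subst (2 ℕ.≤_) sizeF F.size≥2

  ι-0 : ι F.0# ≡ 0#
  ι-0 = +-cancelˡ (ι F.0#) _ _ (trans (sym (ι-+ F.0# F.0#)) (trans (cong ι (F.+-identityˡ _)) (sym (+-identityʳ _))))

  ι-pow : ∀ a k → ι (F.pow a k) ≡ pow (ι a) k
  ι-pow a zero    = ι-1
  ι-pow a (suc k) = trans (ι-* a _) (cong (ι a *_) (ι-pow a k))

  σ : ℕ → Carrier → Carrier
  σ i x = pow x (q ℕ.^ i)

  σ-+ : ∀ i x y → σ i (x + y) ≡ σ i x + σ i y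
  σ-+ i x y rewrite ℕ.^-*-assoc p n i = frobenius^-+ (n ℕ.* i) x y

  σ-* : ∀ i x y → σ i (x * y) ≡ σ i x * σ i y
  σ-* i x y = pow-distrib-* x y (q ℕ.^ i)

  σ-0 : ∀ i → σ i 0# ≡ 0#
  σ-0 i = pow-0# (q ℕ.^ i) {{ℕ.m^n≢0 q i {{ℕ.>-nonZero (ℕ.≤-trans (s≤s z≤n) q≥2)}}}}

  σ-comp : ∀ i j x → σ (i ℕ.+ j) x ≡ σ i (σ j x)
  σ-comp i j x = trans (cong (pow x) (ℕ.^-distribˡ-+-* q i j)) (pow-^* x (q ℕ.^ i) (q ℕ.^ j))

  σ-id : ∀ x → σ 0 x ≡ x
  σ-id x = *-identityʳ x

  σ-r : ∀ x → σ r x ≡ x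
  σ-r x = trans (cong (pow x) (sym sizeL)) (pow-size x)

  σ-multiple : ∀ k {e x} → σ e x ≡ x → σ (k ℕ.* e) x ≡ x
  σ-multiple zero    fix = σ-id _
  σ-multiple (suc k) {e} {x} fix = trans (σ-comp e (k ℕ.* e) x) (trans (cong (σ e) (σ-multiple k fix)) fix)

  σ-ι : ∀ i a → σ i (ι a) ≡ ι a
  σ-ι i a = trans (sym (ι-pow a (q ℕ.^ i))) (cong ι (fixed i))
    where
    fixed : ∀ i → F.pow a (q ℕ.^ i) ≡ a
    fixed zero    = F.*-identityʳ a
    fixed (suc i) = trans (F.pow-^* a q (q ℕ.^ i)) (trans (cong (λ z → F.pow z q) (fixed i))
      (trans (cong (F.pow a) (sym sizeF)) (F.pow-size a)))

  eval : List F.Carrier → Carrier → Carrier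
  eval = evalL F L h

  σ-eval : ∀ i P x → σ i (eval P x) ≡ eval P (σ i x)
  σ-eval i []      x = σ-0 i
  σ-eval i (c ∷ P) x = trans (σ-+ i (ι c) _) (cong₂ _+_ (σ-ι i c)
    (trans (σ-* i x _) (cong (σ i x *_) (σ-eval i P x))))

  -- `L` as an F[X]-module with X acting as multiplication by `x`. Evaluation at `x` is the action
  -- on `1#`, so its ring laws and the annihilator argument are those already proved for modules.
  evalAction : Carrier → Action Carrier
  evalAction x = record
    { _+ᴹ_ = _+_
    ; 0ᴹ = 0#
    ; _·_ = λ a m → ι a * m
    ; T = x *_
    ; isCM = +-isCommutativeMonoid
    ; ·-distribʳ = λ m a b → trans (cong (_* m) (ι-+ a b)) (distribʳ m _ _)
    ; ·-distribˡ = λ a m n → distribˡ (ι a) m n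
    ; ·-assoc = λ a b m → trans (cong (_* m) (ι-* a b)) (*-assoc _ _ m)
    ; 1· = λ m → trans (cong (_* m) ι-1) (*-identityˡ m)
    ; 0· = λ m → trans (cong (_* m) ι-0) (zeroˡ m)
    ; T-+ = distribˡ x
    ; T-· = λ a m → x*yz≡y*xz x (ι a) m
    }

  module Ev (x : Carrier) = Polynomial.Action (evalAction x)

  act≡eval* : ∀ x P m → Ev.act x P m ≡ eval P x * m
  act≡eval* x []      m = sym (zeroˡ m)
  act≡eval* x (c ∷ P) m = trans (cong (λ z → ι c * m + x * z) (act≡eval* x P m)) 
    (trans (cong (ι c * m +_) (sym (*-assoc x (eval P x) m))) (sym (distribʳ m (ι c) _)))

  act≡eval : ∀ x P → Ev.act x P 1# ≡ eval P x
  act≡eval x P = trans (act≡eval* x P 1#) (*-identityʳ _)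

  eval-⊕ : ∀ P R x → eval (P ⊕ R) x ≡ eval P x + eval R x
  eval-⊕ P R x = trans (sym (act≡eval x (P ⊕ R))) (trans (Ev.act-⊕ x P R 1#) (cong₂ _+_ (act≡eval x P) (act≡eval x R)))

  eval-⊗ : ∀ P R x → eval (P ⊗ R) x ≡ eval P x * eval R x
  eval-⊗ P R x = trans (sym (act≡eval x (P ⊗ R))) (trans (Ev.act-⊗ x P R 1#)
    (trans (act≡eval* x P _) (cong (eval P x *_) (act≡eval x R))))

  Monic-eval : ∀ {k} (v : Vec F.Carrier k) → Monic k (eval (monic F v))
  Monic-eval []      x = trans (cong₂ _+_ ι-1 (zeroʳ x)) (+-identityʳ 1#)
  Monic-eval (c ∷ v) = ι c , _ , Monic-eval v , λ x → refl

  eval-monic : ∀ {k} (v : Vec F.Carrier k) x → eval (monic F v) x ≡ eval (toList v) x + pow x k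
  eval-monic []      x = trans (Monic-eval [] x) (sym (+-identityˡ 1#))
  eval-monic (c ∷ v) x = trans (cong (λ z → ι c + x * z) (eval-monic v x))
    (trans (cong (ι c +_) (distribˡ x _ _)) (sym (+-assoc _ _ _)))

  iter≡pow : ∀ x k → Ev.iter x k 1# ≡ pow x k
  iter≡pow x zero    = refl
  iter≡pow x (suc k) = cong (x *_) (iter≡pow x k)

  X^-X-root : ∀ k x → pow x (suc (suc k)) ≡ x → eval (monic F (X^-X k)) x ≡ 0#
  X^-X-root k x e = trans (sym (act≡eval x (monic F (X^-X k)))) (Ev.act-X^-X x k 1#
    (trans (iter≡pow x (suc (suc k))) (trans e (sym (*-identityʳ x)))))

  X^-X-root⁻¹ : ∀ k x → eval (monic F (X^-X k)) x ≡ 0# → pow x (suc (suc k)) ≡ x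
  X^-X-root⁻¹ k x e = trans (sym (iter≡pow x (suc (suc k))))
    (trans (Ev.act-X^-X⁻¹ x k 1# (trans (act≡eval x (monic F (X^-X k))) e)) (*-identityʳ x))

  module Root {m : ℕ} (g : Vec F.Carrier (suc m)) (irr : Irreducible F g) where
    open Quotient g irr using (e; divides-X^-X; ξ-frobenius; power-fixed)

    2+ : ∀ {k} → 2 ℕ.≤ k → ∃ λ j → k ≡ suc (suc j)
    2+ (s≤s (s≤s _)) = _ , refl

    -- Evaluates the factorisation of X^k - X into `g` and a cofactor `s` at points of `L`; it is
    -- used for k = q^e, to see that `σ e` fixes the roots of `g`, and for k = q^r, to find a root.
    cofactor : ∀ k → e ℕ.≤ k → 2 ℕ.≤ k → Power.power (Quotient.mul g irr) (Quotient.one g irr) (Quotient.ξ g irr) k ≡ Quotient.ξ g irr →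
      ∃ λ j → j ℕ.+ e ≡ k × Σ (Vec F.Carrier j) λ s →
        (∀ x → pow x k ≡ x → eval (monic F s) x * eval (monic F g) x ≡ 0#) ×
        (∀ x → eval (monic F g) x ≡ 0# → pow x k ≡ x)
    cofactor k e≤k k≥2 fix with l , refl ← 2+ k≥2 with j , e+j ← ℕ.m≤n⇒∃[o]m+o≡n e≤k
      with s , d ← divides-X^-X l j (trans (ℕ.+-comm j e) e+j) fix
      = j , trans (ℕ.+-comm j e) e+j , s ,
        (λ x xk → trans (sym (eval-⊗ (monic F s) (monic F g) x)) (trans (cong (λ P → eval P x) d) (X^-X-root l x xk))) ,
        (λ x gx → X^-X-root⁻¹ l x (trans (cong (λ P → eval P x) (sym d))
          (trans (eval-⊗ (monic F s) (monic F g) x) (trans (cong (eval (monic F s) x *_) gx) (zeroʳ _)))))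

    e<q^e : e ℕ.< q ℕ.^ e
    e<q^e = n<m^n e q≥2

    q^≥2 : ∀ {k} → 1 ℕ.≤ k → 2 ℕ.≤ q ℕ.^ k
    q^≥2 {suc k} _ = ℕ.≤-trans (s≤s (s≤s z≤n)) (n<m^n (suc k) q≥2)

    root-fixed : ∀ a → eval (monic F g) a ≡ 0# → σ e a ≡ a
    root-fixed a ga with ξ-frobenius
    ... | fix rewrite sizeF with _ , _ , _ , _ , root ← cofactor (q ℕ.^ e) (ℕ.<⇒≤ e<q^e) (q^≥2 {e} (s≤s z≤n)) fix = root a ga

    -- All q^r elements of `L` are roots of the product of `g` and its cofactor X^(q^r) - X over
    -- `g`; if `g` had no root, the cofactor, of degree q^r - e, would have too many.
    root-exists : e ∣ r → ∃ λ a → eval (monic F g) a ≡ 0#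
    root-exists (divides k r≡) with any? (λ a → eval (monic F g) a ≟ 0#) elements
    ... | yes any = let a , _ , ga = find any in a , ga
    ... | no none with power-fixed k
    ...   | fix rewrite sizeF | ℕ.^-*-assoc q e k | ℕ.*-comm e k | sym r≡
      with j , j+e , s , roots , _ ← cofactor (q ℕ.^ r) (ℕ.≤-trans (∣⇒≤ {{ℕ.>-nonZero r≥1}} (divides k r≡)) (ℕ.<⇒≤ (n<m^n r q≥2))) (q^≥2 r≥1) fix
      = contradiction (subst (ℕ._≤ j) (trans sizeL (sym j+e)) (root-bound j (Monic-eval s) unique s-root)) (ℕ.<⇒≱ (ℕ.m<m+n j (s≤s z≤n)))
      where
      s-root : ∀ x → x ∈ elements → eval (monic F s) x ≡ 0#
      s-root x x∈ = xy≡0⇒y≡0 (λ gx → none (lose x∈ gx)) (trans (*-comm _ _) (roots x (σ-r x)))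

    module _ (a : Carrier) (ga : eval (monic F g) a ≡ 0#) where

      -- Linear independence over `F` of the first e powers of `a`, from the annihilator argument
      -- for the element `1#` of the module `L`.
      annihilator : ∀ k → k ℕ.≤ e → (v : Vec F.Carrier k) → eval (toList v) a ≡ 0# → v ≡ 0ᵛ
      annihilator k k≤e v va = Ev.irreducible-annihilator a g irr {1#} (λ e → 0≢1 (sym e))
        (trans (act≡eval a (monic F g)) ga) k k≤e v (trans (act≡eval a (toList v)) va)

      eval-injective : ∀ {u v : Vec F.Carrier e} → eval (toList u) a ≡ eval (toList v) a → u ≡ v
      eval-injective {u} {v} eq = x-y≡0ᵛ⇒x≡y u v (annihilator e ℕ.≤-refl _
        (trans (cong (λ P → eval P a) (toList-+ᵛ u _)) (trans (eval-⊕ (toList u) (toList ((F.- F.1#) *ᵛ v)) a)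
          (trans (cong₂ _+_ eq -v) (trans (+-comm _ _) (Ev.-m+m a _))))))
        where
        -v : eval (toList ((F.- F.1#) *ᵛ v)) a ≡ ι (F.- F.1#) * eval (toList v) a
        -v = trans (cong (λ P → eval P a) (Vec.toList-map _ v)) (trans (sym (act≡eval a (List.map (F.- F.1# F.*_) (toList v))))
          (trans (Ev.act-map a (F.- F.1#) (toList v) 1#) (cong (ι (F.- F.1#) *_) (act≡eval a (toList v)))))

      -- The q^e polynomials of degree < e take distinct values at `a`, all fixed by `σ s`, whereas
      -- X^(q^s) - X has at most q^s roots.
      σ-period : ∀ s → 1 ℕ.≤ s → σ s a ≡ a → e ℕ.≤ s
      σ-period s s≥1 fix = ^-cancelʳ-≤ q q≥2 (subst (ℕ._≤ q ℕ.^ s) len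
        (fixed-bound (q ℕ.^ s) (q^≥2 s≥1) (Unique.map⁺ eval-injective (allVecs-unique e)) fixed))
        where
        len : length (List.map (λ v → eval (toList v) a) (allVecs F e)) ≡ q ℕ.^ e
        len = trans (List.length-map _ (allVecs F e)) (trans (allVecs-length e) (cong (ℕ._^ e) sizeF))
        fixed : ∀ x → x ∈ List.map (λ v → eval (toList v) a) (allVecs F e) → σ s x ≡ x
        fixed x x∈ with v , _ , refl ← ∈-map⁻ _ x∈ = trans (σ-eval s (toList v) a) (cong (eval (toList v)) fix)

      σ-fixed⇒∣ : ∀ s → σ s a ≡ a → e ∣ s
      σ-fixed⇒∣ s s-fix = m%n≡0⇒n∣m s e (zero-case (s % e) (m%n<n s e) fix)
        where
        fix : σ (s % e) a ≡ a
        fix = trans (cong (σ (s % e)) (sym (σ-multiple (s / e) (root-fixed a ga))))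
          (trans (sym (σ-comp (s % e) _ a)) (trans (cong (λ k → σ k a) (sym (m≡m%n+[m/n]*n s e))) s-fix))
        zero-case : ∀ s → s ℕ.< e → σ s a ≡ a → s ≡ 0
        zero-case zero    s<e fix = refl
        zero-case (suc s) s<e fix = contradiction (σ-period (suc s) (s≤s z≤n) fix) (ℕ.<⇒≱ s<e)

      e∣r : e ∣ r
      e∣r = σ-fixed⇒∣ r (σ-r a)

      conjugates roots : List Carrier
      conjugates = applyUpTo (λ i → σ i a) e
      roots = filter (λ x → eval (monic F g) x ≟ 0#) elements

      conjugates-unique : Unique conjugates
      conjugates-unique = Unique.applyUpTo⁺₁ (λ i → σ i a) e distinct
        where
        e≤r = ∣⇒≤ {{ℕ.>-nonZero r≥1}} e∣r
        distinct : ∀ {i j} → i ℕ.< j → j ℕ.< e → σ i a ≢ σ j a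
        -- Since k + i = r, applying `σ k` undoes `σ i`; what remains is `σ l a ≡ a` with l = j - i,
        -- positive and smaller than e.
        distinct {i} {j} i<j j<e eq with k , i+k ← ℕ.m≤n⇒∃[o]m+o≡n (ℕ.≤-trans (ℕ.<⇒≤ (ℕ.<-trans i<j j<e)) e≤r)
          with l , refl ← ℕ.m≤n⇒∃[o]m+o≡n (ℕ.<⇒≤ i<j) = contradiction (σ-period l l≥1 fix) (ℕ.<⇒≱ (ℕ.≤-<-trans (ℕ.m≤n+m l i) j<e))
          where
          l≥1 : 1 ℕ.≤ l
          l≥1 = ℕ.+-cancelˡ-< i 0 l (subst (ℕ._< i ℕ.+ l) (sym (ℕ.+-identityʳ i)) i<j)
          k+i : k ℕ.+ i ≡ r
          k+i = trans (ℕ.+-comm k i) i+k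
          fix : σ l a ≡ a
          fix = trans (sym (σ-r _)) (trans (cong (λ z → σ z (σ l a)) (sym k+i)) (trans (σ-comp k i _)
            (trans (cong (σ k) (trans (sym (σ-comp i l a)) (sym eq)))
              (trans (sym (σ-comp k i a)) (trans (cong (λ z → σ z a) k+i) (σ-r a))))))

      conjugate-root : ∀ {x} → x ∈ conjugates → eval (monic F g) x ≡ 0#
      conjugate-root x∈ with i , _ , refl ← ∈-applyUpTo⁻ (λ i → σ i a) x∈ =
        trans (sym (σ-eval i (monic F g) a)) (trans (cong (σ i) ga) (σ-0 i))

      -- The e distinct conjugates of `a` are roots, and degree e allows no more; so Frobenius is
      -- transitive on the roots.
      roots↭conjugates : roots ↭ conjugates
      roots↭conjugates = unique-⊆-≤⇒↭ conjugates-unique (λ m → ∈-filter⁺ (λ x → eval (monic F g) x ≟ 0#) (complete _) (conjugate-root m))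
        (ℕ.≤-trans (root-bound e (Monic-eval g) (Unique.filter⁺ (λ x → eval (monic F g) x ≟ 0#) unique) (λ x m → proj₂ (∈-filter⁻ (λ x → eval (monic F g) x ≟ 0#) {xs = elements} m)))
          (ℕ.≤-reflexive (sym (List.length-applyUpTo (λ i → σ i a) e))))

      root-conjugate : ∀ x → eval (monic F g) x ≡ 0# → ∃ λ i → i ℕ.< e × x ≡ σ i a
      root-conjugate x gx = ∈-applyUpTo⁻ (λ i → σ i a) (∈-resp-↭ roots↭conjugates (∈-filter⁺ (λ x → eval (monic F g) x ≟ 0#) (complete x) gx))

      roots-length : length roots ≡ e
      roots-length = trans (↭-length roots↭conjugates) (List.length-applyUpTo (λ i → σ i a) e)

  degree-≤ : ∀ {e e′} (g : Vec F.Carrier e) (g′ : Vec F.Carrier e′) → Irreducible F g → ∀ a →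
    eval (monic F g) a ≡ 0# → eval (monic F g′) a ≡ 0# → e ℕ.≤ e′
  degree-≤ {suc m} {e′} g g′ irr a ga g′a with suc m ℕ.≤? e′
  ... | yes le = le
  ... | no nle = contradiction (trans (act≡eval a (monic F g′)) g′a)
    (Ev.no-smaller-annihilator a g irr {1#} (λ e → 0≢1 (sym e)) (trans (act≡eval a (monic F g)) ga) e′ (ℕ.≰⇒> nle)
      (λ t ta → Root.annihilator g irr a ga e′ (ℕ.<⇒≤ (ℕ.≰⇒> nle)) t (trans (sym (act≡eval a (toList t))) ta)) g′)
  degree-≤ {zero} g g′ irr a ga g′a = z≤n

  irreducible-unique : ∀ {e} (g g′ : Vec F.Carrier e) → Irreducible F g → ∀ a →
    eval (monic F g) a ≡ 0# → eval (monic F g′) a ≡ 0# → g ≡ g′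
  irreducible-unique {zero}  []  []  irr a ga g′a = refl
  irreducible-unique {suc m} g g′ irr a ga g′a = Root.eval-injective g irr a ga
    (+-cancelʳ (pow a (suc m)) _ _ (trans (sym (eval-monic g a)) (trans ga (trans (sym g′a) (eval-monic g′ a)))))

  -- X^(q^r) - X vanishes at `a`, so a finite search finds a monic polynomial of least degree that
  -- does; in a proper factorisation one factor of smaller degree would vanish at `a` too.
  minimal-polynomial : ∀ a → Σ ℕ λ e → Σ (Vec F.Carrier e) λ g → Irreducible F g × eval (monic F g) a ≡ 0#
  minimal-polynomial a with least {P} P? (q ℕ.^ r) exists
    where
    P : ℕ → Set
    P k = Any (λ v → eval (monic F v) a ≡ 0#) (allVecs F k)
    P? : ∀ k → Dec (P k)
    P? k = any? (λ v → eval (monic F v) a ≟ 0#) (allVecs F k)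
    exists : P (q ℕ.^ r)
    exists = go (q ℕ.^ r) (subst (2 ℕ.≤_) sizeL size≥2) (σ-r a)
      where
      go : ∀ k → 2 ℕ.≤ k → pow a k ≡ a → P k
      go (suc zero)    (s≤s ()) fix
      go (suc (suc k)) _ fix = lose (allVecs-complete (X^-X k)) (X^-X-root k a fix)
  ... | e , Pe , minimal with g , _ , ga ← find Pe = e , g , (positive e g ga , irreducible) , ga
    where
    positive : ∀ e (g : Vec F.Carrier e) → eval (monic F g) a ≡ 0# → 1 ℕ.≤ e
    positive zero    [] ga = contradiction (trans (sym ga) (Monic-eval [] a)) 0≢1
    positive (suc e) g  ga = s≤s z≤n
    irreducible : ¬ (Σ ℕ λ b → Σ ℕ λ c → Σ (Vec F.Carrier b) λ u → Σ (Vec F.Carrier c) λ w →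
         1 ℕ.≤ b × 1 ℕ.≤ c × mulP F (monic F u) (monic F w) ≡ monic F g)
    irreducible (b , c , u , w , b≥1 , c≥1 , eq) with eval (monic F u) a ≟ 0#
    ... | yes ua = minimal b (subst (b ℕ.<_) b+c (ℕ.m<m+n b c≥1)) (lose (allVecs-complete u) ua)
      where
      b+c : b ℕ.+ c ≡ e
      b+c = ℕ.suc-injective (trans (sym (length-product u w)) (trans (cong length eq) (length-monic g)))
    ... | no u≢0 = minimal c (subst (c ℕ.<_) b+c (ℕ.m<n+m c b≥1)) (lose (allVecs-complete w)
        (xy≡0⇒y≡0 u≢0 (trans (sym (eval-⊗ (monic F u) (monic F w) a)) (trans (cong (λ P → eval P a) eq) ga))))
      where
      b+c : b ℕ.+ c ≡ e
      b+c = ℕ.suc-injective (trans (sym (length-product u w)) (trans (cong length eq) (length-monic g)))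

-- Partial traces x + x^B + ... + x^(B^(k-1)), used with B = p and with B = q

module PartialTrace (L : FiniteField) (B : ℕ) where
  open Field L

  φ : ℕ → Carrier → Carrier
  φ k x = pow x (B ℕ.^ k)

  φ-comp : ∀ i j x → φ (i ℕ.+ j) x ≡ φ i (φ j x)
  φ-comp i j x = trans (cong (pow x) (ℕ.^-distribˡ-+-* B i j)) (pow-^* x (B ℕ.^ i) (B ℕ.^ j))

  φ-id : ∀ x → φ 0 x ≡ x
  φ-id = *-identityʳ

  φ-* : ∀ k x y → φ k (x * y) ≡ φ k x * φ k y
  φ-* k x y = pow-distrib-* x y (B ℕ.^ k)

  φ-fixed : ∀ k {x} → φ 1 x ≡ x → φ k x ≡ x
  φ-fixed zero        fix = φ-id _
  φ-fixed (suc k) {x} fix = trans (φ-comp 1 k x) (trans (cong (φ 1) (φ-fixed k fix)) fix)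

  φ-multiple : ∀ k {e x} → φ e x ≡ x → φ (k ℕ.* e) x ≡ x
  φ-multiple zero            fix = φ-id _
  φ-multiple (suc k) {e} {x} fix = trans (φ-comp e (k ℕ.* e) x) (trans (cong (φ e) (φ-multiple k fix)) fix)

  tr : ℕ → Carrier → Carrier
  tr zero    x = 0#
  tr (suc k) x = tr k x + φ k x

  tr-split : ∀ k j x → tr (k ℕ.+ j) x ≡ tr j x + tr k (φ j x)
  tr-split zero    j x = sym (+-identityʳ _)
  tr-split (suc k) j x = trans (cong₂ _+_ (tr-split k j x) (φ-comp k j x)) (+-assoc _ _ _)

  -- The conjugates of `x` repeat with period d, so the sum falls into k equal blocks.
  tr-multiple : ∀ k {d x} → φ d x ≡ x → tr (k ℕ.* d) x ≡ k ×# tr d x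
  tr-multiple zero            fix = refl
  tr-multiple (suc k) {d} {x} fix = trans (tr-split d (k ℕ.* d) x)
    (trans (+-comm _ _) (cong₂ _+_ (cong (tr d) (φ-multiple k fix)) (tr-multiple k fix)))

  tr-scale : ∀ k {c} x → φ 1 c ≡ c → tr k (c * x) ≡ c * tr k x
  tr-scale zero    {c} x fix = sym (zeroʳ c)
  tr-scale (suc k) {c} x fix = trans (cong₂ _+_ (tr-scale k x fix)
    (trans (φ-* k c x) (cong (_* φ k x) (φ-fixed k fix)))) (sym (distribˡ c _ _))

  module Additive (φ-+ : ∀ k x y → φ k (x + y) ≡ φ k x + φ k y) where

    φ-0 : ∀ k → φ k 0# ≡ 0#
    φ-0 k = +-cancelˡ (φ k 0#) _ _ (trans (sym (φ-+ k 0# 0#)) (trans (cong (φ k) (+-identityˡ _)) (sym (+-identityʳ _))))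

    tr-+ : ∀ k x y → tr k (x + y) ≡ tr k x + tr k y
    tr-+ zero    x y = sym (+-identityˡ 0#)
    tr-+ (suc k) x y = trans (cong₂ _+_ (tr-+ k x y) (φ-+ k x y)) (+-interchange _ _ _ _)

    φ-tr : ∀ k x → φ 1 (tr k x) ≡ tr k (φ 1 x)
    φ-tr zero    x = φ-0 1
    φ-tr (suc k) x = trans (φ-+ 1 _ _) (cong₂ _+_ (φ-tr k x)
      (trans (sym (φ-comp 1 k x)) (trans (cong (λ i → φ i x) (ℕ.+-comm 1 k)) (φ-comp k 1 x))))

    tr-shift : ∀ k x → x + tr k (φ 1 x) ≡ tr (suc k) x
    tr-shift k x = trans (cong (_+ tr k (φ 1 x)) (sym (trans (+-identityˡ _) (φ-id x))))
      (trans (sym (tr-split k 1 x)) (cong (λ i → tr i x) (ℕ.+-comm k 1)))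

    -- Prepending `x` to the left side and appending `φ k x` to the right side give the same sum of
    -- k + 1 conjugates; here these two terms agree and cancel.
    tr-φ : ∀ k x → φ k x ≡ x → tr k (φ 1 x) ≡ tr k x
    tr-φ k x fix = +-cancelˡ x _ _ (trans (tr-shift k x) (trans (cong (tr k x +_) fix) (+-comm _ x)))

    tr-fixed : ∀ k x → φ k x ≡ x → φ 1 (tr k x) ≡ tr k x
    tr-fixed k x fix = trans (φ-tr k x) (tr-φ k x fix)

-- The trace to the prime field, additive Hilbert 90, points on y^p - y = f(x)

module Trace (p : ℕ) (pp : Prime p) (n r : ℕ) (F L : FiniteField) (h : Hom F L)
  (sizeF : FiniteField.size F ≡ p ℕ.^ n) (sizeL : FiniteField.size L ≡ (p ℕ.^ n) ℕ.^ r) (r≥1 : 1 ℕ.≤ r) where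
  open Extension p pp n r F L h sizeF sizeL r≥1 public
  open PartialTrace L p public
  open Additive frobenius^-+ public

  N = n ℕ.* r

  sizeL′ : size ≡ p ℕ.^ N
  sizeL′ = trans sizeL (ℕ.^-*-assoc p n r)

  p≥2 : 2 ℕ.≤ p
  p≥2 = ℕ.nonTrivial⇒n>1 p {{prime⇒nonTrivial pp}}

  φ-N : ∀ x → φ N x ≡ x
  φ-N x = trans (cong (pow x) (sym sizeL′)) (pow-size x)

  σ≡φ : ∀ i x → σ i x ≡ φ (n ℕ.* i) x
  σ≡φ i x = cong (pow x) (ℕ.^-*-assoc p n i)

  Tr : Carrier → Carrier
  Tr = tr N

  Tr-φ : ∀ i x → Tr (φ i x) ≡ Tr x
  Tr-φ zero    x = cong Tr (φ-id x)
  Tr-φ (suc i) x = trans (cong Tr (φ-comp 1 i x)) (trans (tr-φ N (φ i x) (φ-N _)) (Tr-φ i x))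

  Tr-σ : ∀ i x → Tr (σ i x) ≡ Tr x
  Tr-σ i x = trans (cong Tr (σ≡φ i x)) (Tr-φ (n ℕ.* i) x)

  Tr-fixed : ∀ x → φ 1 (Tr x) ≡ Tr x
  Tr-fixed x = tr-fixed N x (φ-N x)

  Tr-0 : Tr 0# ≡ 0#
  Tr-0 = +-cancelˡ (Tr 0#) _ _ (trans (sym (tr-+ N 0# 0#)) (trans (cong Tr (+-identityˡ _)) (sym (+-identityʳ _))))

  Tr-×# : ∀ k x → Tr (k ×# x) ≡ k ×# Tr x
  Tr-×# zero    x = Tr-0
  Tr-×# (suc k) x = trans (tr-+ N x _) (cong (Tr x +_) (Tr-×# k x))

  Poly-tr : ∀ k → Poly (p ℕ.^ k) (tr k)
  Poly-tr zero    = Poly-0 1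
  Poly-tr (suc k) = Poly-+ (p ℕ.^ suc k)
    (Poly-≤ (ℕ.≤-trans (ℕ.n≤1+n _) le) (Poly-tr k)) (Poly-≤ le (Monic⇒Poly (p ℕ.^ k) (Monic-pow (p ℕ.^ k))))
    where
    le : suc (p ℕ.^ k) ℕ.≤ p ℕ.^ suc k
    le = ℕ.^-monoʳ-< p p≥2 (ℕ.n<1+n k)

  -- As a polynomial the trace is monic of degree p^(N-1), too small for it to vanish at all p^N
  -- elements of `L`.
  Tr-nonzero : ∃ λ c → Tr c ≢ 0#
  Tr-nonzero with any? (λ c → ¬? (Tr c ≟ 0#)) elements
  ... | yes any = let c , _ , nz = find any in c , nz
  ... | no none = contradiction bound (degree N refl)
    where
    all-zero : ∀ x → Tr x ≡ 0#
    all-zero x with Tr x ≟ 0#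
    ... | yes e = e
    ... | no ne = contradiction (lose (complete x) ne) none
    bound : ∀ k → N ≡ suc k → size ℕ.≤ p ℕ.^ k
    bound k eq = root-bound (p ℕ.^ k) {tr (suc k)}
      (Monic-cong (p ℕ.^ k) (λ x → +-comm (tr k x) _) (Monic+Poly (p ℕ.^ k) (Monic-pow (p ℕ.^ k)) (Poly-tr k)))
      unique (λ x _ → trans (cong (λ i → tr i x) (sym eq)) (all-zero x))
    degree : ∀ k → N ≡ k → ¬ (∀ k → N ≡ suc k → size ℕ.≤ p ℕ.^ k)
    degree zero    eq bound = ℕ.<⇒≱ size≥2 (ℕ.≤-reflexive (trans sizeL′ (cong (p ℕ.^_) eq)))
    degree (suc k) eq bound = ℕ.<⇒≱ (ℕ.^-monoʳ-< p p≥2 (ℕ.n<1+n k))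
      (subst (ℕ._≤ p ℕ.^ k) (trans sizeL′ (cong (p ℕ.^_) eq)) (bound k eq))

  inverse-fixed : ∀ {u w} → u * w ≡ 1# → φ 1 u ≡ u → φ 1 w ≡ w
  inverse-fixed {u} {w} uw fix = *-cancelˡ u≢0 (trans (cong (_* φ 1 w) (sym fix))
    (trans (sym (φ-* 1 u w)) (trans (cong (φ 1) uw) (trans (pow-1# (p ℕ.^ 1)) (sym uw)))))
    where
    u≢0 : u ≢ 0#
    u≢0 refl = 0≢1 (trans (sym (zeroˡ w)) uw)

  Tr-one : ∃ λ c → Tr c ≡ 1#
  Tr-one with c , nz ← Tr-nonzero with w , uw ← inverse (Tr c) nz =
    w * c , trans (tr-scale N c (inverse-fixed uw (Tr-fixed c))) (trans (*-comm w _) uw)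

  φ1≡pow : ∀ x → φ 1 x ≡ pow x p
  φ1≡pow x = cong (pow x) (ℕ.*-identityʳ p)

  -- The additive Hilbert 90: with Tr c = 1, y = Σ_i (b + b^p + ... + b^(p^(i-1))) c^(p^i) satisfies y^p + b = y.
  hilbert90 : ∀ b → Tr b ≡ 0# → ∃ λ y → φ 1 y + b ≡ y
  hilbert90 b b0 with c , c1 ← Tr-one = Y N , (begin
    φ 1 (Y N) + b                     ≡⟨ cong (φ 1 (Y N) +_) (sym (trans (cong (b *_) (trans (tr-φ N c (φ-N c)) c1)) (*-identityʳ b))) ⟩
    φ 1 (Y N) + b * tr N (φ 1 c)      ≡⟨ telescope N ⟩
    Y N + tr N b * φ N c              ≡⟨ cong (λ z → Y N + z * φ N c) b0 ⟩
    Y N + 0# * φ N c                  ≡⟨ cong (Y N +_) (zeroˡ _) ⟩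
    Y N + 0#                          ≡⟨ +-identityʳ _ ⟩
    Y N                               ∎)
    where
    open ≡-Reasoning
    Y : ℕ → Carrier
    Y zero    = 0#
    Y (suc k) = Y k + tr k b * φ k c
    step : ∀ k → φ 1 (tr k b * φ k c) + b * φ k (φ 1 c) ≡ tr (suc k) b * φ (suc k) c
    step k = begin
      φ 1 (tr k b * φ k c) + b * φ k (φ 1 c)     ≡⟨ cong₂ _+_ (φ-* 1 _ _) (cong (b *_) (trans (sym (φ-comp k 1 c)) (cong (λ i → φ i c) (ℕ.+-comm k 1)))) ⟩
      φ 1 (tr k b) * φ 1 (φ k c) + b * φ (suc k) c ≡⟨ cong (λ z → φ 1 (tr k b) * z + b * φ (suc k) c) (sym (φ-comp 1 k c)) ⟩
      φ 1 (tr k b) * φ (suc k) c + b * φ (suc k) c ≡⟨ sym (distribʳ _ _ _) ⟩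
      (φ 1 (tr k b) + b) * φ (suc k) c             ≡⟨ cong (_* φ (suc k) c) (trans (+-comm _ b) (trans (cong (b +_) (φ-tr k b)) (tr-shift k b))) ⟩
      tr (suc k) b * φ (suc k) c ∎
    -- At k = N the left side becomes `φ 1 (Y N) + b` because `c` has trace 1, and the additional
    -- term on the right vanishes because `b` has trace 0.
    telescope : ∀ k → φ 1 (Y k) + b * tr k (φ 1 c) ≡ Y k + tr k b * φ k c
    telescope zero    = cong₂ _+_ (φ-0 1) (trans (zeroʳ b) (sym (zeroˡ _)))
    telescope (suc k) = begin
      φ 1 (Y k + tr k b * φ k c) + b * (tr k (φ 1 c) + φ k (φ 1 c)) ≡⟨ cong₂ _+_ (frobenius^-+ 1 _ _) (distribˡ b _ _) ⟩
      (φ 1 (Y k) + φ 1 (tr k b * φ k c)) + (b * tr k (φ 1 c) + b * φ k (φ 1 c)) ≡⟨ +-interchange _ _ _ _ ⟩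
      (φ 1 (Y k) + b * tr k (φ 1 c)) + (φ 1 (tr k b * φ k c) + b * φ k (φ 1 c)) ≡⟨ cong₂ _+_ (telescope k) (step k) ⟩
      (Y k + tr k b * φ k c) + tr (suc k) b * φ (suc k) c ∎

  ≡⇒-≡ : ∀ {x y b} → x ≡ b + y → x - y ≡ b
  ≡⇒-≡ {y = y} {b} refl = trans (+-assoc b y (- y)) (trans (cong (b +_) (-‿inverseʳ y)) (+-identityʳ b))

  -≡⇒≡ : ∀ {x y b} → x - y ≡ b → x ≡ b + y
  -≡⇒≡ {x} {y} refl = sym (trans (+-assoc x (- y) y) (trans (cong (x +_) (-‿inverseˡ y)) (+-identityʳ x)))

  Tr-neg : ∀ b → Tr b ≡ 0# → Tr (- b) ≡ 0#
  Tr-neg b b0 = trans (sym (+-identityˡ (Tr (- b)))) (trans (cong (_+ Tr (- b)) (sym b0))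
    (trans (sym (tr-+ N b (- b))) (trans (cong Tr (-‿inverseʳ b)) Tr-0)))

  artin-schreier : ∀ b → Tr b ≡ 0# → ∃ λ y → pow y p - y ≡ b
  artin-schreier b b0 = solution (hilbert90 (- b) (Tr-neg b b0))
    where
    solution : (∃ λ y → φ 1 y + (- b) ≡ y) → ∃ λ y → pow y p - y ≡ b
    solution (y , e) =
      y , ≡⇒-≡ {pow y p} {y} {b} (trans (sym (φ1≡pow y)) (trans (-≡⇒≡ {φ 1 y} {b} {y} e) (+-comm y b)))

  artin-schreier⁻¹ : ∀ b y → pow y p - y ≡ b → Tr b ≡ 0#
  artin-schreier⁻¹ b y e = +-cancelʳ (Tr y) (Tr b) 0# (begin
    Tr b + Tr y   ≡⟨ tr-+ N b y ⟨
    Tr (b + y)    ≡⟨ cong Tr (-≡⇒≡ {pow y p} {y} {b} e) ⟨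
    Tr (pow y p)  ≡⟨ cong Tr (φ1≡pow y) ⟨
    Tr (φ 1 y)    ≡⟨ Tr-φ 1 y ⟩
    Tr y          ≡⟨ +-identityˡ (Tr y) ⟨
    0# + Tr y     ∎)
    where open ≡-Reasoning

  -- A Bézout relation 1 + y p = x m or 1 + x m = y p, read in `L` where p is zero, would give 1 = 0
  -- if m were zero too.
  ×#1-nonzero : ∀ {m} → Coprime m p → m ×# 1# ≢ 0#
  ×#1-nonzero {m} cop m0 with coprime-Bézout cop
  ... | Bézout.+- x y eq = 0≢1 (sym (begin
    1#                             ≡⟨ +-identityʳ 1# ⟨
    1# + 0#                        ≡⟨ cong (1# +_) (∣⇒×#≡0 (divides y refl) 1#) ⟨
    suc (y ℕ.* p) ×# 1#            ≡⟨ cong (_×# 1#) eq ⟩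
    (x ℕ.* m) ×# 1#                ≡⟨ trans (×1-homo-* x m) (trans (cong (_ *_) m0) (zeroʳ _)) ⟩
    0#                             ∎))
    where open ≡-Reasoning
  ... | Bézout.-+ x y eq = 0≢1 (sym (begin
    1#                             ≡⟨ +-identityʳ 1# ⟨
    1# + 0#                        ≡⟨ cong (1# +_) (trans (×1-homo-* x m) (trans (cong (_ *_) m0) (zeroʳ _))) ⟨
    suc (x ℕ.* m) ×# 1#            ≡⟨ cong (_×# 1#) eq ⟩
    (y ℕ.* p) ×# 1#                ≡⟨ ∣⇒×#≡0 (divides y refl) 1# ⟩
    0#                             ∎))
    where open ≡-Reasoning

  ×#1-distinct : ∀ {i j} → i ℕ.< j → j ℕ.< p → i ×# 1# ≢ j ×# 1#
  ×#1-distinct {i} i<j j<p eq with k , refl ← ℕ.m≤n⇒∃[o]m+o≡n i<j =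
    ×#1-nonzero (Coprimality.sym (prime⇒coprime pp (ℕ.≤-<-trans (s≤s (ℕ.m≤n+m k i)) j<p)))
      (+-cancelˡ (i ×# 1#) _ _ (trans (sym (×-homo-+ 1# i (suc k)))
        (trans (cong (_×# 1#) (ℕ.+-suc i k)) (trans (sym eq) (sym (+-identityʳ _))))))

  primeField : List Carrier
  primeField = List.map (_×# 1#) (upTo p)

  primeField-unique : Unique primeField
  primeField-unique = subst Unique (sym (List.map-upTo (_×# 1#) p)) (Unique.applyUpTo⁺₁ (_×# 1#) p ×#1-distinct)

  ×#1-fixed : ∀ t → pow (t ×# 1#) p ≡ t ×# 1#
  ×#1-fixed zero    = pow-0# p {{prime⇒nonZero pp}}
  ×#1-fixed (suc t) = trans (frobenius-+ 1# _) (cong₂ _+_ (pow-1# p) (×#1-fixed t))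

  -- The p multiples of `1#` are already p distinct roots of X^p - X, so there is no room for
  -- another one.
  fixed⇒×#1 : ∀ {z} → pow z p ≡ z → ∃ λ t → t ℕ.< p × z ≡ t ×# 1#
  fixed⇒×#1 {z} fix with any? (z ≟_) primeField
  ... | yes z∈ with t , t∈ , e ← ∈-map⁻ (_×# 1#) z∈ = t , ∈-upTo⁻ t∈ , e
  ... | no  z∉ = contradiction (fixed-bound p {z ∷ primeField} p≥2 (All.¬Any⇒All¬ _ z∉ ∷ primeField-unique) fixed)
      (ℕ.<⇒≱ (s≤s (ℕ.≤-reflexive (sym (trans (List.length-map _ (upTo p)) (List.length-upTo p))))))
    where
    fixed : ∀ x → x ∈ z ∷ primeField → pow x p ≡ x
    fixed x (here refl) = fix
    fixed x (there m) with t , _ , refl ← ∈-map⁻ (_×# 1#) m = ×#1-fixed t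

  ×#1-injective : ∀ {i j} → i ℕ.< p → j ℕ.< p → i ×# 1# ≡ j ×# 1# → i ≡ j
  ×#1-injective {i} {j} i<p j<p eq with ℕ.<-cmp i j
  ... | tri< i<j _ _ = contradiction eq (×#1-distinct i<j j<p)
  ... | tri≈ _ e _   = e
  ... | tri> _ _ j<i = contradiction (sym eq) (×#1-distinct j<i i<p)

  negation-fixed : ∀ {u} → φ 1 u ≡ u → φ 1 (- u) ≡ - u
  negation-fixed {u} fu = +-cancelˡ (φ 1 u) _ _ (trans (sym (frobenius^-+ 1 u (- u)))
    (trans (cong (φ 1) (-‿inverseʳ u)) (trans (φ-0 1) (trans (sym (-‿inverseʳ u)) (cong (_+ (- u)) (sym fu))))))

  -- For `u` and `v` in the prime field the solution -u/v lies there as well, hence is `t ×# 1#` for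
  -- a single t < p. This is the origin of the probability 1/p.
  affine-line : ∀ {u v} → φ 1 u ≡ u → φ 1 v ≡ v → v ≢ 0# → ∑ (upTo p) (λ t → 𝟙 (u + t ×# v ≟ 0#)) ≡ 1
  affine-line {u} {v} fu fv v≢0 with w , vw ← inverse v v≢0
    with t , t<p , e ← fixed⇒×#1 {(- u) * w} (trans (sym (φ1≡pow _)) (trans (φ-* 1 (- u) w) (cong₂ _*_ (negation-fixed fu) (inverse-fixed vw fv))))
    = trans (∑-single _ (Unique.upTo⁺ p) (∈-upTo⁺ t<p)
        (λ s s∈ s≢t → 𝟙-no (u + s ×# v ≟ 0#) (λ s0 → s≢t (×#1-injective (∈-upTo⁻ s∈) t<p
          (*-cancelˡ v≢0 (trans (*-comm v _) (trans (sym (×#≡* s v)) (trans (+-cancelˡ u _ _ (trans s0 (sym t0)))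
            (trans (×#≡* t v) (*-comm _ v)))))))))) (𝟙-yes (u + t ×# v ≟ 0#) t0)
    where
    t0 : u + t ×# v ≡ 0#
    t0 = trans (cong (u +_) (trans (×#≡* t v) (trans (cong (_* v) (sym e)) (trans (*-assoc (- u) w v)
      (trans (cong ((- u) *_) (trans (*-comm w v) vw)) (*-identityʳ _)))))) (-‿inverseʳ u)

  -- Two solutions differ by a fixed point of the p-th power map, so the solutions form the coset of
  -- the prime field through `y₀`.
  solution-count : ∀ b y₀ → pow y₀ p - y₀ ≡ b → ∑ elements (λ y → 𝟙 (pow y p - y ≟ b)) ≡ p
  solution-count b y₀ e₀ =
    trans (sym (count≡∑ P? elements)) (trans (ℕ.≤-antisym
      (unique-⊆-length (Unique.filter⁺ P? unique) (λ {y} y∈ → solution (proj₂ (∈-filter⁻ P? {xs = elements} y∈))))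
      (unique-⊆-length solutions-unique (λ y∈ → ∈-filter⁺ P? (complete _) (solution⁻¹ y∈))))
      (trans (List.length-map (y₀ +_) primeField) (trans (List.length-map (_×# 1#) (upTo p)) (List.length-upTo p))))
    where
    P? : ∀ y → Dec (pow y p - y ≡ b)
    P? y = pow y p - y ≟ b
    solutions = List.map (y₀ +_) primeField
    solutions-unique : Unique solutions
    solutions-unique = Unique.map⁺ (+-cancelˡ y₀ _ _) primeField-unique
    y₀ᵖ : pow y₀ p ≡ b + y₀
    y₀ᵖ = -≡⇒≡ e₀
    y-y₀+y₀ : ∀ y → (y - y₀) + y₀ ≡ y
    y-y₀+y₀ y = sym (-≡⇒≡ refl)
    shuffle : ∀ z → b + (z + y₀) ≡ z + (b + y₀)
    shuffle z = trans (sym (+-assoc b z y₀)) (trans (cong (_+ y₀) (+-comm b z)) (+-assoc z b y₀))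
    solution : ∀ {y} → pow y p - y ≡ b → y ∈ solutions
    solution {y} e with t , t<p , z≡ ← fixed⇒×#1 {y - y₀} (+-cancelʳ (pow y₀ p) _ _ (trans (sym (frobenius-+ (y - y₀) y₀))
        (trans (cong (λ z → pow z p) (y-y₀+y₀ y)) (trans (-≡⇒≡ e) (trans (cong (b +_) (sym (y-y₀+y₀ y))) (trans (shuffle (y - y₀)) (cong ((y - y₀) +_) (sym y₀ᵖ))))))))
      = subst (_∈ solutions) (trans (cong (y₀ +_) (sym z≡)) (trans (+-comm y₀ _) (y-y₀+y₀ y)))
          (∈-map⁺ (y₀ +_) (∈-map⁺ (_×# 1#) (∈-upTo⁺ t<p)))
    solution⁻¹ : ∀ {y} → y ∈ solutions → pow y p - y ≡ b
    solution⁻¹ y∈ with z , z∈ , refl ← ∈-map⁻ (y₀ +_) y∈ with t , _ , refl ← ∈-map⁻ (_×# 1#) z∈ =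
      ≡⇒-≡ (trans (frobenius-+ y₀ _) (trans (cong₂ _+_ y₀ᵖ (×#1-fixed t)) (+-assoc b y₀ _)))

  fibre : ∀ b → ∑ elements (λ y → 𝟙 (pow y p - y ≟ b)) ≡ p ℕ.* 𝟙 (Tr b ≟ 0#)
  fibre b = go (Tr b ≟ 0#)
    where
    go : (d : Dec (Tr b ≡ 0#)) → ∑ elements (λ y → 𝟙 (pow y p - y ≟ b)) ≡ p ℕ.* 𝟙 d
    go (yes b≡0) = trans (solution-count b (proj₁ (artin-schreier b b≡0)) (proj₂ (artin-schreier b b≡0))) (sym (ℕ.*-identityʳ p))
    go (no  b≢0) = trans (∑-zero elements (λ y _ → 𝟙-no (pow y p - y ≟ b) (λ e → b≢0 (artin-schreier⁻¹ b y e)))) (sym (ℕ.*-zeroʳ p))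

  -- Over each `x` the curve has p affine points or none, which makes the division by p in `Nf`
  -- exact.
  Nf≡∑ : ∀ {d} (f : Vec F.Carrier d) → Nf F L h p pp f ≡ ∑ elements (λ x → 𝟙 (Tr (eval (monic F f) x) ≟ 0#))
  Nf≡∑ f = trans (cong (λ m → ℕ._/_ m p {{prime⇒nonZero pp}}) points)
    (m*n/n≡m (∑ elements (λ x → 𝟙 (Tr (eval (monic F f) x) ≟ 0#))) p {{prime⇒nonZero pp}})
    where
    points : affinePoints F L h p f ≡ ∑ elements (λ x → 𝟙 (Tr (eval (monic F f) x) ≟ 0#)) ℕ.* p
    points = trans (count≡∑ _ (cartesianProduct elements elements))
      (trans (∑-cartesianProduct elements elements _)
      (trans (∑-cong elements (λ x → fibre (eval (monic F f) x)))
      (trans (∑-*ˡ elements p _) (ℕ.*-comm p _))))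

  -- If b lies in a subfield over which the degree of L is divisible by p, its trace vanishes.
  Tr-subfield : ∀ {e k b} → r ≡ k ℕ.* e → p ∣ k → σ e b ≡ b → Tr b ≡ 0#
  Tr-subfield {e} {k} {b} r≡ p∣k fix = trans (cong (λ i → tr i b) N≡)
    (trans (tr-multiple k (trans (sym (σ≡φ e b)) fix)) (∣⇒×#≡0 p∣k _))
    where
    N≡ : N ≡ k ℕ.* (n ℕ.* e)
    N≡ = trans (cong (n ℕ.*_) r≡) (trans (sym (ℕ.*-assoc n k e)) (trans (cong (ℕ._* e) (ℕ.*-comm n k)) (ℕ.*-assoc k n e)))

-- Interpolation over L and descent of the interpolating polynomial to F

module Interpolation (p : ℕ) (pp : Prime p) (n r : ℕ) (F L : FiniteField) (h : Hom F L)
  (sizeF : FiniteField.size F ≡ p ℕ.^ n) (sizeL : FiniteField.size L ≡ (p ℕ.^ n) ℕ.^ r) (r≥1 : 1 ℕ.≤ r) where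
  open Trace p pp n r F L h sizeF sizeL r≥1 public

  -- With B = q the sum `Rel.tr r` is the relative trace from `L` to `F`, as opposed to the absolute
  -- trace `Tr`.
  module Rel = PartialTrace L q
  module RelAdd = Rel.Additive σ-+

  evalV : ∀ {k} → Vec Carrier k → Carrier → Carrier
  evalV []      x = 0#
  evalV (c ∷ w) x = c + x * evalV w x

  Poly⇒Vec : ∀ k {f} → Poly k f → Σ (Vec Carrier k) λ w → ∀ x → evalV w x ≡ f x
  Poly⇒Vec zero    P               = [] , λ x → sym (P x)
  Poly⇒Vec (suc k) (c , g , P , e) =
    c ∷ proj₁ (Poly⇒Vec k P) , λ x → trans (cong (λ z → c + x * z) (proj₂ (Poly⇒Vec k P) x)) (sym (e x))

  Monic-linear-pow : ∀ k b → Monic k (λ x → pow (x + b) k)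
  Monic-linear-pow zero    b x = refl
  Monic-linear-pow (suc k) b = Monic-cong (suc k) (λ x → distribʳ _ x b)
    (Monic+Poly (suc k) (Monic-x* k (Monic-linear-pow k b)) (Poly-*ˡ (suc k) b (Monic⇒Poly k (Monic-linear-pow k b))))

  -- For m = |L| - 1 this is c at a and 0 elsewhere, since y^m = 1 for y ≠ 0.
  spike : ℕ → Carrier → Carrier → Carrier → Carrier
  spike m a c x = c * (1# + (- 1#) * pow (x + (- a)) m)

  Poly-spike : ∀ m a c → Poly (suc m) (spike m a c)
  Poly-spike m a c = Poly-*ˡ (suc m) c (Poly-+ (suc m) (Poly-const m 1#)
    (Poly-*ˡ (suc m) (- 1#) (Monic⇒Poly m (Monic-linear-pow m (- a)))))

  spike-at : ∀ m a c → spike (suc m) a c a ≡ c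
  spike-at m a c = begin
    c * (1# + (- 1#) * pow (a + (- a)) (suc m)) ≡⟨ cong (λ z → c * (1# + (- 1#) * pow z (suc m))) (-‿inverseʳ a) ⟩
    c * (1# + (- 1#) * pow 0# (suc m))      ≡⟨ cong (λ z → c * (1# + (- 1#) * z)) (pow-0# (suc m)) ⟩
    c * (1# + (- 1#) * 0#)                  ≡⟨ cong (λ z → c * (1# + z)) (zeroʳ (- 1#)) ⟩
    c * (1# + 0#)                           ≡⟨ cong (c *_) (+-identityʳ 1#) ⟩
    c * 1#                                  ≡⟨ *-identityʳ c ⟩
    c                                       ∎
    where open ≡-Reasoning

  spike-off : ∀ m a c x → size ≡ suc m → x ≢ a → spike m a c x ≡ 0#
  spike-off m a c x eq x≢a = trans (cong (c *_) (x≡y⇒x-y≡0 (sym fermat₁))) (zeroʳ c)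
    where
    y = x + (- a)
    y≢0 : y ≢ 0#
    y≢0 e = x≢a (x-y≡0⇒x≡y e)
    fermat₁ : pow y m ≡ 1#
    fermat₁ = *-cancelˡ y≢0 (trans (cong (pow y) (sym eq)) (trans (pow-size y) (sym (*-identityʳ y))))

  -- This is where d ≥ q^r enters: the spike has `size` coefficients, which fit below the leading
  -- term X^d of a polynomial in 𝒢_d.
  spike-vector : ∀ {d} → size ℕ.≤ d → ∀ a c →
    Σ (Vec Carrier d) λ w → evalV w a ≡ c × (∀ x → x ≢ a → evalV w x ≡ 0#)
  spike-vector {d} size≤d a c = go size refl size≥2
    where
    go : ∀ k → size ≡ k → 2 ℕ.≤ k → Σ (Vec Carrier d) λ w → evalV w a ≡ c × (∀ x → x ≢ a → evalV w x ≡ 0#)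
    -- The exponent of the spike is `size` - 1 = m + 1; its being positive is what makes the power
    -- of zero vanish at `a`.
    go (suc (suc m)) eq _ = proj₁ w , trans (proj₂ w a) (spike-at m a c) ,
      λ x x≢a → trans (proj₂ w x) (spike-off (suc m) a c x eq x≢a)
      where
      w = Poly⇒Vec d (Poly-≤ (subst (ℕ._≤ d) eq size≤d) (Poly-spike (suc m) a c))
    go (suc zero) eq (s≤s ())

  ι-injective : ∀ {x y} → ι x ≡ ι y → x ≡ y
  ι-injective {x} {y} e = go (x F.- y F.≟ F.0#)
    where
    go : Dec (x F.- y ≡ F.0#) → x ≡ y
    go (yes x-y≡0) = F.x-y≡0⇒x≡y x-y≡0
    go (no  x-y≢0) with z , inv ← F.inverse (x F.- y) x-y≢0 = contradiction (begin
      0#                     ≡⟨ zeroˡ (ι z) ⟨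
      0# * ι z               ≡⟨ cong (_* ι z) (trans (ι-+ x (F.- y)) (trans (cong (_+ ι (F.- y)) e) (trans (sym (ι-+ y (F.- y))) (trans (cong ι (F.-‿inverseʳ y)) ι-0)))) ⟨
      ι (x F.- y) * ι z      ≡⟨ ι-* _ z ⟨
      ι ((x F.- y) F.* z)    ≡⟨ cong ι inv ⟩
      ι F.1#                 ≡⟨ ι-1 ⟩
      1#                     ∎) 0≢1
      where open ≡-Reasoning

  -- The image of `F` supplies q roots of X^q - X, as many as its degree.
  fixed⇒ι : ∀ {z} → σ 1 z ≡ z → ∃ λ u → ι u ≡ z
  fixed⇒ι {z} fix = go (any? (z ≟_) image)
    where
    image = List.map ι F.elements
    fixed : ∀ x → x ∈ z ∷ image → pow x q ≡ x
    fixed x (here refl) = trans (cong (pow x) (sym (ℕ.*-identityʳ q))) fix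
    fixed x (there m) with u , _ , refl ← ∈-map⁻ ι m = trans (cong (pow (ι u)) (sym (ℕ.*-identityʳ q))) (σ-ι 1 u)
    go : Dec (z ∈ image) → ∃ λ u → ι u ≡ z
    go (yes z∈) = proj₁ (∈-map⁻ ι z∈) , sym (proj₂ (proj₂ (∈-map⁻ ι z∈)))
    go (no  z∉) = contradiction
      (fixed-bound q q≥2 (All.¬Any⇒All¬ _ z∉ ∷ Unique.map⁺ ι-injective F.unique) fixed)
      (ℕ.<⇒≱ (s≤s (ℕ.≤-reflexive (sym (trans (List.length-map ι F.elements) sizeF)))))

  -- Taking relative traces of the coefficients amounts to adding up the r conjugates of the
  -- polynomial `w`; the results are fixed by `σ 1` and so come from `F`.
  descend : ∀ {k} (w : Vec Carrier k) →
    Σ (Vec F.Carrier k) λ v → ∀ x → eval (toList v) x ≡ evalV (Vec.map (Rel.tr r) w) x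
  descend []      = [] , λ x → refl
  descend (c ∷ w) = proj₁ u ∷ proj₁ (descend w) , λ x → cong₂ (λ a b → a + x * b) (proj₂ u) (proj₂ (descend w) x)
    where
    u = fixed⇒ι (RelAdd.tr-fixed r c (σ-r c))

  evalV-tr : ∀ {k} (w : Vec Carrier k) j x → 
    evalV (Vec.map (Rel.tr (suc j)) w) x ≡ evalV (Vec.map (Rel.tr j) w) x + evalV (Vec.map (σ j) w) x
  evalV-tr []      j x = sym (+-identityˡ 0#)
  evalV-tr (c ∷ w) j x = trans (cong (λ z → Rel.tr (suc j) c + x * z) (evalV-tr w j x))
    (trans (cong (Rel.tr (suc j) c +_) (distribˡ x _ _)) (+-interchange _ _ _ _))

  evalV-tr0 : ∀ {k} (w : Vec Carrier k) x → evalV (Vec.map (Rel.tr 0) w) x ≡ 0#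
  evalV-tr0 []      x = refl
  evalV-tr0 (c ∷ w) x = trans (+-identityˡ _) (trans (cong (x *_) (evalV-tr0 w x)) (zeroʳ x))

  σ-evalV : ∀ {k} (w : Vec Carrier k) i x → evalV (Vec.map (σ i) w) (σ i x) ≡ σ i (evalV w x)
  σ-evalV []      i x = sym (σ-0 i)
  σ-evalV (c ∷ w) i x = trans (cong (λ z → σ i c + σ i x * z) (σ-evalV w i x))
    (trans (cong (σ i c +_) (sym (σ-* i x _))) (sym (σ-+ i c _)))

  σ-inverse : ∀ {i} → i ℕ.≤ r → ∀ x → ∃ λ y → x ≡ σ i y
  σ-inverse {i} i≤r x = σ (r ℕ.∸ i) x ,
    sym (trans (sym (σ-comp i (r ℕ.∸ i) x)) (trans (cong (λ j → σ j x) (ℕ.m+[n∸m]≡n i≤r)) (σ-r x)))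

  σ-injective : ∀ {i} → i ℕ.≤ r → ∀ {x y} → σ i x ≡ σ i y → x ≡ y
  σ-injective {i} i≤r {x} {y} e = trans (sym (back x)) (trans (cong (σ (r ℕ.∸ i)) e) (back y))
    where
    back : ∀ z → σ (r ℕ.∸ i) (σ i z) ≡ z
    back z = trans (sym (σ-comp (r ℕ.∸ i) i z)) (trans (cong (λ j → σ j z) (ℕ.m∸n+n≡m i≤r)) (σ-r z))

  -- The number of i < j with `σ i a ≡ a`; at j = r it is the order of the stabiliser of `a` in the
  -- Galois group, that is r/e.
  stabiliser : Carrier → ℕ → ℕ
  stabiliser a zero    = 0
  stabiliser a (suc j) = stabiliser a j ℕ.+ 𝟙 (σ j a ≟ a)

  module _ {d} (w : Vec Carrier d) (a c : Carrier) (w-at : evalV w a ≡ c) (w-off : ∀ x → x ≢ a → evalV w x ≡ 0#) where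

    -- Conjugating the coefficients by `σ i` moves the support of the polynomial from `a` to
    -- `σ i a`.
    conjugate-value : ∀ {i} → i ℕ.≤ r → ∀ {x} → x ≢ σ i a → evalV (Vec.map (σ i) w) x ≡ 0#
    conjugate-value {i} i≤r {x} x≢ = trans (cong (evalV (Vec.map (σ i) w)) x≡) (trans (σ-evalV w i y)
      (trans (cong (σ i) (w-off y λ y≡a → x≢ (trans x≡ (cong (σ i) y≡a)))) (σ-0 i)))
      where
      y  = proj₁ (σ-inverse i≤r x)
      x≡ = proj₂ (σ-inverse i≤r x)

    off-orbit : ∀ j → j ℕ.≤ r → ∀ x → (∀ i → x ≢ σ i a) → evalV (Vec.map (Rel.tr j) w) x ≡ 0#
    off-orbit zero    j≤r x x∉ = evalV-tr0 w x
    off-orbit (suc j) j≤r x x∉ = trans (evalV-tr w j x)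
      (trans (cong₂ _+_ (off-orbit j (ℕ.<⇒≤ j≤r) x x∉) (conjugate-value (ℕ.<⇒≤ j≤r) (x∉ j))) (+-identityˡ 0#))

    -- Among the conjugates of `w` only those with `σ i a ≡ a` are nonzero at `a`; each has the
    -- value `σ i c` there, whose trace is that of `c`.
    on-orbit : ∀ j → j ℕ.≤ r → Tr (evalV (Vec.map (Rel.tr j) w) a) ≡ stabiliser a j ×# Tr c
    on-orbit zero    j≤r = trans (cong Tr (evalV-tr0 w a)) Tr-0
    on-orbit (suc j) j≤r = begin
      Tr (evalV (Vec.map (Rel.tr (suc j)) w) a)
        ≡⟨ cong Tr (evalV-tr w j a) ⟩
      Tr (evalV (Vec.map (Rel.tr j) w) a + evalV (Vec.map (σ j) w) a)
        ≡⟨ tr-+ N _ _ ⟩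
      Tr (evalV (Vec.map (Rel.tr j) w) a) + Tr (evalV (Vec.map (σ j) w) a)
        ≡⟨ cong₂ _+_ (on-orbit j (ℕ.<⇒≤ j≤r)) (term (σ j a ≟ a)) ⟩
      stabiliser a j ×# Tr c + 𝟙 (σ j a ≟ a) ×# Tr c
        ≡⟨ ×-homo-+ (Tr c) (stabiliser a j) (𝟙 (σ j a ≟ a)) ⟨
      stabiliser a (suc j) ×# Tr c ∎
      where
      open ≡-Reasoning
      term : (dec : Dec (σ j a ≡ a)) → Tr (evalV (Vec.map (σ j) w) a) ≡ 𝟙 dec ×# Tr c
      term (yes fix) = trans (cong Tr (trans (cong (evalV (Vec.map (σ j) w)) (sym fix))
        (trans (σ-evalV w j a) (cong (σ j) w-at)))) (trans (Tr-σ j c) (sym (+-identityʳ _)))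
      term (no ¬fix) = trans (cong Tr (conjugate-value (ℕ.<⇒≤ j≤r) (λ e → ¬fix (sym e)))) Tr-0

  stabiliser-multiple : ∀ {a e} → 1 ℕ.≤ e → σ e a ≡ a → (∀ s → 1 ℕ.≤ s → σ s a ≡ a → e ℕ.≤ s) →
    ∀ k → stabiliser a (k ℕ.* e) ≡ k
  stabiliser-multiple {a} {e} e≥1 fix period = go
    where
    first : ∀ i → i ℕ.< e → stabiliser a (suc i) ≡ 1
    first zero    i<e = 𝟙-yes (σ 0 a ≟ a) (σ-id a)
    first (suc i) i<e = cong₂ ℕ._+_ (first i (ℕ.<⇒≤ i<e))
      (𝟙-no (σ (suc i) a ≟ a) (λ e′ → ℕ.<⇒≱ i<e (period (suc i) (s≤s z≤n) e′)))
    block : ∀ e′ → e′ ≡ e → 1 ℕ.≤ e′ → stabiliser a e ≡ 1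
    block (suc i) refl _ = first i ℕ.≤-refl
    periodic : ∀ j → stabiliser a (j ℕ.+ e) ≡ suc (stabiliser a j)
    periodic zero    = block e refl e≥1
    periodic (suc j) = cong₂ ℕ._+_ (periodic j) (𝟙-⇔ (σ (j ℕ.+ e) a ≟ a) (σ j a ≟ a)
      (trans (sym shift)) (trans shift))
      where
      shift : σ (j ℕ.+ e) a ≡ σ j a
      shift = trans (σ-comp j e a) (cong (σ j) fix)
    go : ∀ k → stabiliser a (k ℕ.* e) ≡ k
    go zero    = refl
    go (suc k) = trans (cong (stabiliser a) (ℕ.+-comm e (k ℕ.* e))) (trans (periodic (k ℕ.* e)) (cong suc (go k)))

  -- Descending a spike at `a` of height `c` with nonzero trace gives trace k times `Tr c` at `a`,
  -- where k = r/e is invertible modulo p; away from the orbit of `a` every conjugate spike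
  -- vanishes.
  direction : ∀ {d} → size ℕ.≤ d → ∀ {a e k} → 1 ℕ.≤ e → σ e a ≡ a → (∀ s → 1 ℕ.≤ s → σ s a ≡ a → e ℕ.≤ s) →
    r ≡ k ℕ.* e → Coprime k p → Σ (Vec F.Carrier d) λ v →
      Tr (eval (toList v) a) ≢ 0# × (∀ x → (∀ i → x ≢ σ i a) → eval (toList v) x ≡ 0#)
  direction {d} size≤d {a} {e} {k} e≥1 fix period r≡ cop = go Tr-nonzero
    where
    go : (∃ λ c → Tr c ≢ 0#) → _
    go (c , c≢0) = proj₁ v , nonzero , λ x x∉ → trans (proj₂ v x) (off-orbit w a c w-at w-off r ℕ.≤-refl x x∉)
      where
      spk = spike-vector size≤d a c
      w = proj₁ spk
      w-at = proj₁ (proj₂ spk)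
      w-off = proj₂ (proj₂ spk)
      v = descend w
      nonzero : Tr (eval (toList (proj₁ v)) a) ≢ 0#
      nonzero z = c≢0 (xy≡0⇒y≡0 (×#1-nonzero cop) (begin
        (k ×# 1#) * Tr c          ≡⟨ ×#≡* k (Tr c) ⟨
        k ×# Tr c                 ≡⟨ cong (_×# Tr c) (sym (trans (cong (stabiliser a) r≡) (stabiliser-multiple e≥1 fix period k))) ⟩
        stabiliser a r ×# Tr c    ≡⟨ on-orbit w a c w-at w-off r ℕ.≤-refl ⟨
        Tr (evalV (Vec.map (Rel.tr r) w) a) ≡⟨ cong Tr (proj₂ v a) ⟨
        Tr (eval (toList (proj₁ v)) a)      ≡⟨ z ⟩
        0#                                  ∎))
        where open ≡-Reasoning

-- Independence: counting under a family of commuting conditions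

module BernoulliCount {V O : Set} (all : List V) (p′ : ℕ) (wt : O → ℕ)
  {Z : O → V → Set} (Z? : ∀ o v → Dec (Z o v)) where

  open import Data.Nat using (_+_; _*_; _∸_; _^_; _≤_; _≟_; _≤?_)
  open import Data.Nat.Properties hiding (_≟_; _≤?_)

  p = suc p′

  β : O → V → ℕ
  β o v = 𝟙 (Z? o v)

  S : List O → V → ℕ
  S os v = ∑ os (λ o → wt o * β o v)

  -- A family of permutations s t (t < p) along which exactly one of the p values of t makes Z o hold.
  Balanced : O → (ℕ → V → V) → Set
  Balanced o s = (∀ t (f : V → ℕ) → ∑ all (f ∘ s t) ≡ ∑ all f) × (∀ v → ∑ (upTo p) (λ t → β o (s t v)) ≡ 1)

  -- Each of the p permutations preserves the sum, while for fixed `v` the indicator `β o` adds up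
  -- to 1 over the p shifts and `χ` does not change; exchanging the two sums gives the claim.
  average : ∀ {o s} → Balanced o s → ∀ (χ : V → ℕ) → (∀ t v → χ (s t v) ≡ χ v) →
    p * ∑ all (λ v → χ v * β o v) ≡ ∑ all χ
  average {o} {s} (perm , line) χ χ-inv = begin
    p * ∑ all χβ                               ≡⟨ cong (_* ∑ all χβ) (List.length-upTo p) ⟨
    length (upTo p) * ∑ all χβ                 ≡⟨ ∑-const (upTo p) _ (λ t _ → perm t χβ) ⟨
    ∑ (upTo p) (λ t → ∑ all (χβ ∘ s t))        ≡⟨ ∑-swap (upTo p) all _ ⟩
    ∑ all (λ v → ∑ (upTo p) (λ t → χβ (s t v)))
      ≡⟨ ∑-cong all (λ v → trans (∑-cong (upTo p) (λ t → cong (_* β o (s t v)) (χ-inv t v)))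
           (trans (∑-*ˡ (upTo p) (χ v) _) (trans (cong (χ v *_) (line v)) (*-identityʳ _)))) ⟩
    ∑ all χ                                    ∎
    where
    open ≡-Reasoning
    χβ = λ v → χ v * β o v

  -- Induction over the events with `χ` arbitrary, because it has to carry the conditions already
  -- imposed: χ β and χ (1 - β) are both invariant under the shifts of the remaining events, and by
  -- `average` their totals are in the ratio 1 to p - 1. This is the recursion of `bernWays`.
  distribution : (os : List O) → Unique os → (s : ∀ {o} → o ∈ os → ℕ → V → V) →
    (∀ {o} (m : o ∈ os) → Balanced o (s m)) →
    (∀ {o o′} (m : o ∈ os) → o′ ∈ os → o′ ≢ o → ∀ t v → β o′ (s m t v) ≡ β o′ v) →
    (χ : V → ℕ) → (∀ {o} (m : o ∈ os) t v → χ (s m t v) ≡ χ v) →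
    ∀ k → ∑ all (λ v → χ v * 𝟙 (S os v ≟ k)) * p ^ length os ≡ ∑ all χ * bernWays p (List.map wt os) k
  distribution [] u s bal inv χ χ-inv zero = trans (*-identityʳ _)
    (trans (∑-*ʳ all χ 1) refl)
  distribution [] u s bal inv χ χ-inv (suc k) = trans (*-identityʳ _) (∑-*ʳ all χ 0)
  distribution (o ∷ os) u@(_ ∷ us) s bal inv χ χ-inv k = result
    where
    open ≡-Reasoning
    w = wt o
    χ₀ χ₁ : V → ℕ
    χ₀ v = χ v * β o v
    χ₁ v = χ v * (1 ∸ β o v)
    m = length os
    X₀ = ∑ all χ₀

    β-inv : ∀ {o′} (i : o′ ∈ os) t v → β o (s (there i) t v) ≡ β o v
    β-inv i = inv (there i) (here refl) λ { refl → Unique[x∷xs]⇒x∉xs u i }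

    IH : ∀ (χ′ : V → ℕ) → (∀ {o′} (i : o′ ∈ os) t v → χ′ (s (there i) t v) ≡ χ′ v) → ∀ k →
      ∑ all (λ v → χ′ v * 𝟙 (S os v ≟ k)) * p ^ m ≡ ∑ all χ′ * bernWays p (List.map wt os) k
    IH χ′ χ′-inv = distribution os us (s ∘ there) (bal ∘ there) (λ i j → inv (there i) (there j)) χ′ χ′-inv

    IH₀ = IH χ₀ (λ i t v → cong₂ _*_ (χ-inv (there i) t v) (β-inv i t v))
    IH₁ = IH χ₁ (λ i t v → cong₂ _*_ (χ-inv (there i) t v) (cong (1 ∸_) (β-inv i t v)))

    pX₀ : p * X₀ ≡ ∑ all χ
    pX₀ = average (bal (here refl)) χ (χ-inv (here refl))

    split : ∑ all χ₁ ≡ p′ * X₀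
    split = +-cancelˡ-≡ X₀ _ _ (trans (sym (∑-+ all χ₀ χ₁)) (trans (∑-cong all pointwise) (sym pX₀)))
      where
      pointwise : ∀ v → χ₀ v + χ₁ v ≡ χ v
      pointwise v with Z? o v
      ... | yes _ = trans (cong₂ _+_ (*-identityʳ (χ v)) (*-zeroʳ (χ v))) (+-identityʳ _)
      ... | no  _ = trans (cong₂ _+_ (*-zeroʳ (χ v)) (*-identityʳ (χ v))) refl

    condition : ∑ all (λ v → χ v * 𝟙 (S (o ∷ os) v ≟ k)) ≡
      ∑ all (λ v → χ₀ v * 𝟙 (w + S os v ≟ k)) + ∑ all (λ v → χ₁ v * 𝟙 (S os v ≟ k))
    condition = trans (∑-cong all pointwise) (∑-+ all _ _)
      where
      pointwise : ∀ v → χ v * 𝟙 (S (o ∷ os) v ≟ k) ≡ χ₀ v * 𝟙 (w + S os v ≟ k) + χ₁ v * 𝟙 (S os v ≟ k)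
      pointwise v with Z? o v
      ... | yes _ = trans (cong (λ z → χ v * 𝟙 (z + S os v ≟ k)) (*-identityʳ w))
        (sym (trans (cong₂ _+_ (cong (_* 𝟙 (w + S os v ≟ k)) (*-identityʳ (χ v))) (cong (_* 𝟙 (S os v ≟ k)) (*-zeroʳ (χ v)))) (+-identityʳ _)))
      ... | no _ = trans (cong (λ z → χ v * 𝟙 (z + S os v ≟ k)) (*-zeroʳ w))
        (sym (cong₂ _+_ (cong (_* 𝟙 (w + S os v ≟ k)) (*-zeroʳ (χ v))) (cong (_* 𝟙 (S os v ≟ k)) (*-identityʳ (χ v)))))

    b₁ = bernWays p (List.map wt os)

    arithmetic : ∀ A B P b → A * P ≡ X₀ * b → B * P ≡ (p′ * X₀) * b₁ k →
      (A + B) * (p * P) ≡ (p * X₀) * (b + p′ * b₁ k)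
    arithmetic A B P b e₀ e₁ = begin
      (A + B) * (p * P)          ≡⟨ solve 4 (λ A B q P → (A :+ B) :* (q :* P) := q :* (A :* P :+ B :* P)) refl A B p P ⟩
      p * (A * P + B * P)        ≡⟨ cong₂ (λ x y → p * (x + y)) e₀ e₁ ⟩
      p * (X₀ * b + (p′ * X₀) * b₁ k)
        ≡⟨ solve 5 (λ q X b q′ c → q :* (X :* b :+ (q′ :* X) :* c) := (q :* X) :* (b :+ q′ :* c)) refl p X₀ b p′ (b₁ k) ⟩
      (p * X₀) * (b + p′ * b₁ k) ∎
      where open +-*-Solver

    step : ∀ b → ∑ all (λ v → χ₀ v * 𝟙 (w + S os v ≟ k)) * p ^ m ≡ X₀ * b →
      ∑ all (λ v → χ v * 𝟙 (S (o ∷ os) v ≟ k)) * p ^ suc m ≡ ∑ all χ * (b + p′ * b₁ k)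
    step b e = trans (cong (_* p ^ suc m) condition)
      (trans (arithmetic (∑ all (λ v → χ₀ v * 𝟙 (w + S os v ≟ k))) (∑ all (λ v → χ₁ v * 𝟙 (S os v ≟ k))) (p ^ m) b e (trans (IH₁ k) (cong (_* b₁ k) split)))
        (cong (_* (b + p′ * b₁ k)) pX₀))

    result : ∑ all (λ v → χ v * 𝟙 (S (o ∷ os) v ≟ k)) * p ^ suc m ≡ ∑ all χ * bernWays p (w ∷ List.map wt os) k
    result with wt o ≤? k
    ... | yes w≤k = step (b₁ (k ∸ w)) (trans (cong (_* p ^ m) (∑-cong all λ v → cong (χ₀ v *_)
        (𝟙-⇔ (w + S os v ≟ k) (S os v ≟ k ∸ w)
          (λ e → trans (sym (m+n∸m≡n w _)) (cong (_∸ w) e))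
          (λ e → trans (cong (w +_) e) (m+[n∸m]≡n w≤k))))) (IH₀ (k ∸ w)))
    -- If the event occurs, the sum is at least w > k, so this half contributes `0`; then
    -- `0 + p′ * b₁ k` is by computation the second branch of `bernWays`.
    ... | no w≰k = step 0 (trans (cong (_* p ^ m) (∑-zero all λ v _ → trans (cong (χ₀ v *_)
        (𝟙-no (w + S os v ≟ k) (λ e → w≰k (subst (w ≤_) e (m≤m+n w _))))) (*-zeroʳ (χ₀ v)))) (sym (*-zeroʳ X₀)))

  mean : (os : List O) → (∀ {o} → o ∈ os → ∃ λ s → Balanced o s) →
    p * ∑ all (S os) ≡ length all * ∑ os wt
  mean os bal = begin
    p * ∑ all (S os)                         ≡⟨ cong (p *_) (∑-swap all os _) ⟩
    p * ∑ os (λ o → ∑ all (λ v → wt o * β o v)) ≡⟨ ∑-*ˡ os p _ ⟨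
    ∑ os (λ o → p * ∑ all (λ v → wt o * β o v))
      ≡⟨ ∑-cong-∈ os (λ o o∈ → average (proj₂ (bal o∈)) (λ _ → wt o) (λ _ _ → refl)) ⟩
    ∑ os (λ o → ∑ all (λ _ → wt o))          ≡⟨ ∑-cong os (λ o → ∑-const all (wt o) (λ _ _ → refl)) ⟩
    ∑ os (λ o → length all * wt o)           ≡⟨ ∑-*ˡ os (length all) wt ⟩
    length all * ∑ os wt                     ∎
    where open ≡-Reasoning

-- The number of fixed points of x ↦ x^(N+1) when N divides |K| - 1

module FixedPoints (K : FiniteField) where
  open import Data.Nat using (_+_; _*_; _≤_)
  open import Data.Nat.Properties hiding (_≟_)
  private module K = Field K
  open K using (Carrier; 0#; 1#; pow; Monic; elements)

  -- The geometric sum of x^(jN) over j < i, that is, the quotient of x^(iN) - 1 by x^N - 1.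
  geometric : ℕ → ℕ → Carrier → Carrier
  geometric N zero    x = 0#
  geometric N (suc i) x = 1# K.+ pow x N K.* geometric N i x

  geometric-sum : ∀ N i x → pow x N K.* geometric N i x K.+ 1# ≡ geometric N i x K.+ pow x (i * N)
  geometric-sum N zero    x = cong (K._+ 1#) (K.zeroʳ _)
  geometric-sum N (suc i) x = begin
    y K.* (1# K.+ y K.* G) K.+ 1#     ≡⟨ cong (λ z → y K.* z K.+ 1#) (trans (K.+-comm 1# _) (geometric-sum N i x)) ⟩
    y K.* (G K.+ pow x (i * N)) K.+ 1# ≡⟨ cong (K._+ 1#) (K.distribˡ y G _) ⟩
    (y K.* G K.+ y K.* pow x (i * N)) K.+ 1# ≡⟨ trans (K.+-comm _ 1#) (sym (K.+-assoc 1# _ _)) ⟩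
    (1# K.+ y K.* G) K.+ y K.* pow x (i * N) ≡⟨ cong ((1# K.+ y K.* G) K.+_) (sym (K.pow-+ x N (i * N))) ⟩
    (1# K.+ y K.* G) K.+ pow x (suc i * N) ∎
    where
    open ≡-Reasoning
    y = pow x N
    G = geometric N i x

  Monic-geometric : ∀ N → 1 ≤ N → ∀ i → Monic (i * N) (geometric N (suc i))
  Monic-geometric N N≥1 zero    x = trans (cong (1# K.+_) (K.zeroʳ _)) (K.+-identityʳ 1#)
  Monic-geometric N N≥1 (suc i) = K.Monic-cong (suc i * N) (λ x → K.+-comm 1# _)
    (K.Monic+Poly (suc i * N) (K.Monic-pow* N (Monic-geometric N N≥1 i))
      (K.Poly-≤ (≤-trans N≥1 (m≤m+n N (i * N))) (K.Poly-const 0 1#)))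

  -- X^size - X is the product of X^(N+1) - X and a geometric sum of degree T N. Elements not fixed
  -- are roots of the latter, so at most T N are not fixed and at least N + 1 are; the former allows
  -- no more.
  fixed-count : ∀ N T → 1 ≤ N → K.size ≡ suc (suc T * N) →
    ∑ elements (λ x → 𝟙 (pow x (suc N) K.≟ x)) ≡ suc N
  fixed-count N T N≥1 size≡ = trans (sym (count≡∑ P? elements)) (≤-antisym upper lower)
    where
    P? : ∀ x → Dec (pow x (suc N) ≡ x)
    P? x = pow x (suc N) K.≟ x
    fixed    = filter P? elements
    nonfixed = filter (λ x → ¬? (P? x)) elements
    upper : length fixed ≤ suc N
    upper = K.fixed-bound (suc N) (s≤s N≥1) (Unique.filter⁺ P? K.unique) (λ x m → proj₂ (∈-filter⁻ P? {xs = elements} m))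
    total : length fixed + length nonfixed ≡ suc (suc T * N)
    total = trans (sym (cong₂ _+_ (∑1 fixed) (∑1 nonfixed))) (trans (sym (∑-filter P? elements (λ _ → 1))) (trans (∑1 elements) size≡))
      where
      ∑1 : ∀ (xs : List Carrier) → ∑ xs (λ _ → 1) ≡ length xs
      ∑1 xs = trans (∑-const xs 1 (λ _ _ → refl)) (*-identityʳ _)
    root : ∀ x → x ∈ nonfixed → geometric N (suc T) x ≡ 0#
    root x m = go (geometric N (suc T) x K.≟ 0#)
      where
      ¬fix : ¬ (pow x (suc N) ≡ x)
      ¬fix = proj₂ (∈-filter⁻ (λ x → ¬? (P? x)) {xs = elements} m)
      x≢0 : x ≢ 0#
      x≢0 refl = ¬fix (K.zeroˡ _)
      x^-1 : pow x (suc T * N) ≡ 1#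
      x^-1 = K.*-cancelˡ x≢0 (trans (cong (pow x) (sym size≡)) (trans (K.pow-size x) (sym (K.*-identityʳ x))))
      go : Dec (geometric N (suc T) x ≡ 0#) → geometric N (suc T) x ≡ 0#
      go (yes e) = e
      go (no ne) = contradiction (trans (cong (x K.*_) x^N) (K.*-identityʳ x)) ¬fix
        where
        x^N : pow x N ≡ 1#
        x^N = K.*-cancelˡ ne (trans (K.*-comm _ _) (trans (K.+-cancelʳ 1# _ _
          (trans (geometric-sum N (suc T) x) (cong (geometric N (suc T) x K.+_) x^-1))) (sym (K.*-identityʳ _))))
    lower : suc N ≤ length fixed
    lower = +-cancelʳ-≤ (T * N) (suc N) (length fixed) (≤-trans (≤-reflexive (sym total))
      (+-monoʳ-≤ (length fixed) (K.root-bound (T * N) (Monic-geometric N N≥1 T)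
        (Unique.filter⁺ (λ x → ¬? (P? x)) K.unique) root)))

-- Arithmetic of primes and powers

prime-∤⇒coprime : ∀ {p} → Prime p → ∀ {k} → ¬ (p ∣ k) → Coprime k p
prime-∤⇒coprime pp p∤k (i∣k , i∣p) with prime⇒irreducible pp i∣p
... | inj₁ i≡1  = i≡1
... | inj₂ refl = contradiction i∣k p∤k

coprime⇒∤ : ∀ {p} → Prime p → ∀ {k} → Coprime k p → ¬ (p ∣ k)
coprime⇒∤ {p} pp cop p∣k = ℕ.<-irrefl (sym (cop (p∣k , divides 1 (sym (ℕ.+-identityʳ p)))))
  (ℕ.nonTrivial⇒n>1 p {{prime⇒nonTrivial pp}})

-- N divides (N+1)^(j+1) - 1; the quotient is returned as a successor, the form in which
-- `fixed-count` takes it.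
^≡1+ : ∀ N j → ∃ λ T → suc N ℕ.^ suc j ≡ suc (suc T ℕ.* N)
^≡1+ N zero    = 0 , trans (ℕ.*-identityʳ (suc N)) (cong suc (sym (ℕ.+-identityʳ N)))
^≡1+ N (suc j) = let T , e = ^≡1+ N j in T ℕ.+ suc (N ℕ.* suc T) ,
  trans (cong (suc N ℕ.*_) e) (solve 2 (λ N T →
    (con 1 :+ N) :* (con 1 :+ (N :+ T :* N)) := con 1 :+ (N :+ (T :+ (con 1 :+ N :* (con 1 :+ T))) :* N)) refl N T)
  where
  open +-*-Solver

-- Orbits as irreducible polynomials, the deterministic part, the distribution of N(f)

module Main (p′ : ℕ) (pp : Prime (suc p′)) (n r : ℕ) (F L : FiniteField) (h : Hom F L)
  (sizeF : FiniteField.size F ≡ suc p′ ℕ.^ n) (sizeL : FiniteField.size L ≡ (suc p′ ℕ.^ n) ℕ.^ r) (r≥1 : 1 ℕ.≤ r)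
  (π : ℕ → ℕ) (irreducibles : ∀ e → IsNumIrred F e (π e)) where

  private p = suc p′

  open Interpolation p pp n r F L h sizeF sizeL r≥1

  xs : ∀ e → List (Vec F.Carrier e)
  xs e = proj₁ (irreducibles e)

  xs-unique : ∀ e → Unique (xs e)
  xs-unique e = proj₁ (proj₂ (irreducibles e))

  xs-irreducible : ∀ {e g} → g ∈ xs e → Irreducible F g
  xs-irreducible {e} {g} = proj₁ (proj₁ (proj₂ (proj₂ (irreducibles e))) g)

  xs-complete : ∀ {e g} → Irreducible F g → g ∈ xs e
  xs-complete {e} {g} = proj₂ (proj₁ (proj₂ (proj₂ (irreducibles e))) g)

  -- A pair (e, g) replaces the index (e, i) of a Bernoulli variable, the polynomial `g` standing
  -- for its number i; the first component is also the weight.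
  Place : Set
  Place = Σ ℕ (Vec F.Carrier)

  _vanishes-at_ : Place → Carrier → Set
  (e , g) vanishes-at x = eval (monic F g) x ≡ 0#

  vanishes? : ∀ o x → Dec (o vanishes-at x)
  vanishes? (e , g) x = eval (monic F g) x ≟ 0#

  -- 0# when there is no root
  root : Place → Carrier
  root o with any? (vanishes? o) elements
  ... | yes some = proj₁ (find some)
  ... | no  none = 0#

  root-vanishes : ∀ o → (∃ λ a → o vanishes-at a) → o vanishes-at root o
  root-vanishes o (a , oa) with any? (vanishes? o) elements
  ... | yes some = proj₂ (proj₂ (find some))
  ... | no  none = contradiction (lose (complete a) oa) none

  places : List ℕ → List Place
  places = concatMap (λ e → List.map (e ,_) (xs e))

  ∑-places : ∀ D (f : Place → ℕ) → ∑ (places D) f ≡ ∑ D (λ e → ∑ (xs e) (λ g → f (e , g)))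
  ∑-places D f = trans (∑-concatMap _ D f) (∑-cong D (λ e → ∑-map (e ,_) (xs e) f))

  weights : ∀ D → List.map proj₁ (places D) ≡ concatMap (λ e → List.replicate (π e) e) D
  weights D = trans (List.map-concatMap proj₁ (λ e → List.map (e ,_) (xs e)) D) (List.concatMap-cong (λ e →
    trans (sym (List.map-∘ (xs e))) (trans (constant e (xs e)) (cong (λ k → List.replicate k e) (proj₂ (proj₂ (proj₂ (irreducibles e))))))) D)
    where
    constant : ∀ e {A : Set} (ys : List A) → List.map (λ _ → e) ys ≡ List.replicate (length ys) e
    constant e []       = refl
    constant e (y ∷ ys) = cong (e ∷_) (constant e ys)

  places-unique : ∀ {D} → Unique D → Unique (places D)
  places-unique {D} u = Unique.concat⁺
    (All.map⁺ (All.universal (λ e → Unique.map⁺ (λ { refl → refl }) (xs-unique e)) D))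
    (AllPairs.map⁺ (AllPairs.map disjoint u))
    where
    disjoint : ∀ {e e′} → e ≢ e′ → ∀ {o} → ¬ (o ∈ List.map (e ,_) (xs e) × o ∈ List.map (e′ ,_) (xs e′))
    disjoint e≢e′ (m , m′) with _ , _ , refl ← ∈-map⁻ _ m | _ , _ , eq ← ∈-map⁻ _ m′ = e≢e′ (cong proj₁ eq)

  ∈-places : ∀ {D o} → o ∈ places D → proj₁ o ∈ D × Irreducible F (proj₂ o)
  ∈-places {D} m with e , e∈ , m′ ← find (∈-concatMap⁻ (λ e → List.map (e ,_) (xs e)) {xs = D} m)
    with g , g∈ , refl ← ∈-map⁻ (e ,_) m′ = e∈ , xs-irreducible g∈

  divisors : List ℕ
  divisors = filter (_∣? r) (applyUpTo suc r)

  divisors-unique : Unique divisors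
  divisors-unique = Unique.filter⁺ (_∣? r) (Unique.applyUpTo⁺₁ suc r (λ i<j _ e → ℕ.<⇒≢ i<j (ℕ.suc-injective e)))

  ∈-divisors⁻ : ∀ {e} → e ∈ divisors → e ∣ r
  ∈-divisors⁻ m = proj₂ (∈-filter⁻ (_∣? r) {xs = applyUpTo suc r} m)

  ∈-divisors⁺ : ∀ {e} → 1 ℕ.≤ e → e ∣ r → e ∈ divisors
  ∈-divisors⁺ {suc e} _ e∣r = ∈-filter⁺ (_∣? r) (∈-applyUpTo⁺ suc (∣⇒≤ {{ℕ.>-nonZero r≥1}} e∣r)) e∣r

  place-unique : ∀ {e e′} (g : Vec F.Carrier e) (g′ : Vec F.Carrier e′) → Irreducible F g → Irreducible F g′ →
    ∀ a → (e , g) vanishes-at a → (e′ , g′) vanishes-at a → (e , g) ≡ (e′ , g′)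
  place-unique g g′ irr irr′ a ga g′a
    with refl ← ℕ.≤-antisym (degree-≤ g g′ irr a ga g′a) (degree-≤ g′ g irr′ a g′a ga)
    = cong (_ ,_) (irreducible-unique g g′ irr a ga g′a)

  minimal-place : ∀ x → ∃ λ o → o ∈ places divisors × o vanishes-at x
  minimal-place x = go (minimal-polynomial x)
    where
    go : (Σ ℕ λ e → Σ (Vec F.Carrier e) λ g → Irreducible F g × eval (monic F g) x ≡ 0#) →
      ∃ λ o → o ∈ places divisors × o vanishes-at x
    go (zero  , g , irr , gx) = contradiction (proj₁ irr) λ ()
    go (suc m , g , irr , gx) = (suc m , g) ,
      ∈-concatMap⁺ (λ e → List.map (e ,_) (xs e))
        (lose (∈-divisors⁺ (proj₁ irr) (Root.e∣r g irr x gx)) (∈-map⁺ (suc m ,_) (xs-complete irr))) , gx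

  vanishing-sum : ∀ x → ∑ (places divisors) (λ o → 𝟙 (vanishes? o x)) ≡ 1
  vanishing-sum x = go (minimal-place x)
    where
    go : (∃ λ o → o ∈ places divisors × o vanishes-at x) → ∑ (places divisors) (λ o → 𝟙 (vanishes? o x)) ≡ 1
    go (o , o∈ , ox) = trans (∑-single (λ o → 𝟙 (vanishes? o x)) (places-unique divisors-unique) o∈
      (λ o′ o′∈ o′≢o → 𝟙-no (vanishes? o′ x) (λ o′x → o′≢o
        (place-unique (proj₂ o′) (proj₂ o) (proj₂ (∈-places {divisors} o′∈)) (proj₂ (∈-places {divisors} o∈)) x o′x ox))))
      (𝟙-yes (vanishes? o x) ox)

  -- Gathers the results on degrees of the form `suc m`, so that later arguments need not split on
  -- the degree of a place.
  record RootData (o : Place) : Set where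
    field
      degree≥1  : 1 ℕ.≤ proj₁ o
      degree∣r  : proj₁ o ∣ r
      vanishes  : o vanishes-at root o
      fixed     : σ (proj₁ o) (root o) ≡ root o
      period    : ∀ s → σ s (root o) ≡ root o → proj₁ o ∣ s
      conjugate : ∀ x → o vanishes-at x → ∃ λ i → i ℕ.≤ r × x ≡ σ i (root o)
      number    : ∑ elements (λ x → 𝟙 (vanishes? o x)) ≡ proj₁ o

  rootData : ∀ {o} → o ∈ places divisors → RootData o
  rootData {o} o∈ = go o (∈-divisors⁻ (proj₁ (∈-places {divisors} o∈))) (proj₂ (∈-places {divisors} o∈))
    where
    go : ∀ o → proj₁ o ∣ r → Irreducible F (proj₂ o) → RootData o
    go (zero  , g) e∣r irr = contradiction (proj₁ irr) λ ()
    go o@(suc m , g) e∣r irr = record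
      { degree≥1  = s≤s z≤n
      ; degree∣r  = e∣r
      ; vanishes  = ga
      ; fixed     = Root.root-fixed g irr (root o) ga
      ; period    = Root.σ-fixed⇒∣ g irr (root o) ga
      ; conjugate = λ x gx → let i , i<e , eq = Root.root-conjugate g irr (root o) ga x gx in
          i , ℕ.≤-trans (ℕ.<⇒≤ i<e) (∣⇒≤ {{ℕ.>-nonZero r≥1}} e∣r) , eq
      ; number    = trans (sym (count≡∑ (vanishes? o) elements)) (Root.roots-length g irr (root o) ga)
      }
      where
      ga : o vanishes-at root o
      ga = root-vanishes o (Root.root-exists g irr e∣r)

  σ-Invariant : (Carrier → ℕ) → Set
  σ-Invariant f = ∀ i → i ℕ.≤ r → ∀ x → f (σ i x) ≡ f x

  -- The elements of L are the roots of the irreducible polynomials of degree dividing r, each a root of exactly one.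
  ∑-orbits : ∀ f → σ-Invariant f → ∑ elements f ≡ ∑ (places divisors) (λ o → proj₁ o ℕ.* f (root o))
  ∑-orbits f f-inv = begin
    ∑ elements f
      ≡⟨ ∑-cong elements (λ x → trans (sym (ℕ.*-identityʳ (f x))) (trans (cong (f x ℕ.*_) (sym (vanishing-sum x)))
           (sym (∑-*ˡ (places divisors) (f x) _)))) ⟩
    ∑ elements (λ x → ∑ (places divisors) (λ o → f x ℕ.* 𝟙 (vanishes? o x)))
      ≡⟨ ∑-swap elements (places divisors) _ ⟩
    ∑ (places divisors) (λ o → ∑ elements (λ x → f x ℕ.* 𝟙 (vanishes? o x)))
      ≡⟨ ∑-cong-∈ (places divisors) (λ o o∈ → trans (∑-cong elements (constant o (rootData o∈)))
           (trans (∑-*ˡ elements (f (root o)) _) (trans (ℕ.*-comm (f (root o)) _)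
             (cong (ℕ._* f (root o)) (RootData.number (rootData o∈)))))) ⟩
    ∑ (places divisors) (λ o → proj₁ o ℕ.* f (root o)) ∎
    where
    open ≡-Reasoning
    constant : ∀ o → RootData o → ∀ x → f x ℕ.* 𝟙 (vanishes? o x) ≡ f (root o) ℕ.* 𝟙 (vanishes? o x)
    constant o R x = go (vanishes? o x)
      where
      go : (dec : Dec (o vanishes-at x)) → f x ℕ.* 𝟙 dec ≡ f (root o) ℕ.* 𝟙 dec
      go (yes ox) = let i , i≤r , eq = RootData.conjugate R x ox in
        cong (ℕ._* 1) (trans (cong f eq) (f-inv i i≤r (root o)))
      go (no _)   = trans (ℕ.*-zeroʳ (f x)) (sym (ℕ.*-zeroʳ (f (root o))))

  cop? : ∀ e → Dec (CoprimeQuot r p e)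
  cop? = coprimeQuot? r p

  -- `D₁` consists of the degrees whose orbits carry the random variables, `D₂` of those with p ∣
  -- r/e, where the trace vanishes for every `f`.
  D₁ D₂ : List ℕ
  D₁ = filter cop? divisors
  D₂ = filter (λ e → ¬? (cop? e)) divisors

  ∑-split : ∀ (f : Place → ℕ) → ∑ (places divisors) f ≡ ∑ (places D₁) f ℕ.+ ∑ (places D₂) f
  ∑-split f = trans (∑-places divisors f) (trans (∑-filter cop? divisors _)
    (cong₂ ℕ._+_ (sym (∑-places D₁ f)) (sym (∑-places D₂ f))))

  places-⊆ : ∀ {D D′ o} → (∀ {e} → e ∈ D → e ∈ D′) → o ∈ places D → o ∈ places D′
  places-⊆ {D} {D′} {o} s o∈ =
    ∈-concatMap⁺ (λ e → List.map (e ,_) (xs e)) (lose (s (proj₁ (∈-places {D} o∈))) (∈-map⁺ (proj₁ o ,_) (xs-complete (proj₂ (∈-places {D} o∈)))))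

  D₁⊆ : ∀ {o} → o ∈ places D₁ → o ∈ places divisors
  D₁⊆ = places-⊆ {D₁} (λ m → proj₁ (∈-filter⁻ cop? {xs = divisors} m))

  D₂⊆ : ∀ {o} → o ∈ places D₂ → o ∈ places divisors
  D₂⊆ = places-⊆ {D₂} (λ m → proj₁ (∈-filter⁻ (λ e → ¬? (cop? e)) {xs = divisors} m))

  cop-quotient : ∀ {e} → e ∣ r → 1 ℕ.≤ e → CoprimeQuot r p e → ∃ λ k → r ≡ k ℕ.* e × Coprime k p
  cop-quotient {suc e} e∣r _ cop = r / suc e , sym (m/n*n≡m e∣r) , cop

  noncop-quotient : ∀ {e} → e ∣ r → 1 ℕ.≤ e → ¬ CoprimeQuot r p e → ∃ λ k → r ≡ k ℕ.* e × p ∣ k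
  noncop-quotient {suc e} e∣r _ ncop = go (p ∣? r / suc e)
    where
    go : Dec (p ∣ r / suc e) → _
    go (yes p∣k) = r / suc e , sym (m/n*n≡m e∣r) , p∣k
    go (no  p∤k) = ⊥-elim (ncop (prime-∤⇒coprime pp p∤k))

  D₁-quotient : ∀ {o} → o ∈ places D₁ → ∃ λ k → r ≡ k ℕ.* proj₁ o × Coprime k p
  D₁-quotient o∈ = cop-quotient (RootData.degree∣r R) (RootData.degree≥1 R)
    (proj₂ (∈-filter⁻ cop? {xs = divisors} (proj₁ (∈-places {D₁} o∈))))
    where R = rootData (D₁⊆ o∈)

  D₂-quotient : ∀ {o} → o ∈ places D₂ → ∃ λ k → r ≡ k ℕ.* proj₁ o × p ∣ k
  D₂-quotient o∈ = noncop-quotient (RootData.degree∣r R) (RootData.degree≥1 R)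
    (proj₂ (∈-filter⁻ (λ e → ¬? (cop? e)) {xs = divisors} (proj₁ (∈-places {D₂} o∈))))
    where R = rootData (D₂⊆ o∈)

  -- The number of elements of `L` in orbits with degree in `D₂`. Left unevaluated, it lets one
  -- distribution and one mean serve both cases.
  base : ℕ
  base = ∑ (places D₂) proj₁

  -- Counting the elements of `L` by orbits gives the total weight of `D₁`, as needed for the mean,
  -- without evaluating `π`.
  ∑₁+base : ∑ (places D₁) proj₁ ℕ.+ base ≡ q ℕ.^ r
  ∑₁+base = trans (sym (∑-split proj₁)) (trans (∑-cong (places divisors) (λ o → sym (ℕ.*-identityʳ (proj₁ o))))
    (trans (sym (∑-orbits (λ _ → 1) (λ _ _ _ → refl)))
      (trans (∑-const elements 1 (λ _ _ → refl)) (trans (ℕ.*-identityʳ size) sizeL))))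

  module Degree (d : ℕ) (size≤d : q ℕ.^ r ℕ.≤ d) where

    𝒢 : List (Vec F.Carrier d)
    𝒢 = allVecs F d

    Z : Place → Vec F.Carrier d → Set
    Z o f = Tr (eval (monic F f) (root o)) ≡ 0#

    Z? : ∀ o f → Dec (Z o f)
    Z? o f = Tr (eval (monic F f) (root o)) ≟ 0#

    open BernoulliCount 𝒢 p′ proj₁ Z? using (β; S; Balanced; distribution; mean)

    Nf≡S+base : ∀ f → Nf F L h p pp f ≡ S (places D₁) f ℕ.+ base
    Nf≡S+base f = trans (Nf≡∑ f) (trans (∑-orbits (λ x → 𝟙 (Tr (eval (monic F f) x) ≟ 0#)) invariant)
      (trans (∑-split (λ o → proj₁ o ℕ.* β o f)) (cong (S (places D₁) f ℕ.+_) (∑-cong-∈ (places D₂) constant))))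
      where
      invariant : σ-Invariant (λ x → 𝟙 (Tr (eval (monic F f) x) ≟ 0#))
      invariant i _ x = cong (λ z → 𝟙 (z ≟ 0#)) (trans (cong Tr (sym (σ-eval i (monic F f) x))) (Tr-σ i _))
      constant : ∀ o → o ∈ places D₂ → proj₁ o ℕ.* β o f ≡ proj₁ o
      constant o o∈ = let k , r≡ , p∣k = D₂-quotient o∈ in
        trans (cong (proj₁ o ℕ.*_) (𝟙-yes (Z? o f) (Tr-subfield {proj₁ o} {k} r≡ p∣k
          (trans (σ-eval (proj₁ o) (monic F f) (root o)) (cong (eval (monic F f)) (RootData.fixed (rootData (D₂⊆ o∈))))))))
          (ℕ.*-identityʳ (proj₁ o))

    -- Repeated addition instead of a scalar from `F`: additivity of `Tr` then suffices, and `t` is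
    -- the natural number that occurs in `affine-line`.
    multiple : ℕ → Vec F.Carrier d → Vec F.Carrier d
    multiple zero    v = 0ᵛ
    multiple (suc t) v = v +ᵛ multiple t v

    eval-+ᵛ : ∀ {k} (u v : Vec F.Carrier k) x → eval (toList (u +ᵛ v)) x ≡ eval (toList u) x + eval (toList v) x
    eval-+ᵛ u v x = trans (cong (λ P → eval P x) (toList-+ᵛ u v)) (eval-⊕ (toList u) (toList v) x)

    eval-multiple : ∀ t v x → eval (toList (multiple t v)) x ≡ t ×# eval (toList v) x
    eval-multiple zero    v x = trans (sym (act≡eval x (toList (0ᵛ {d})))) (Ev.act-zeros x d 1#)
    eval-multiple (suc t) v x = trans (eval-+ᵛ v (multiple t v) x) (cong (eval (toList v) x +_) (eval-multiple t v x))

    eval-translate : ∀ (f v : Vec F.Carrier d) x → eval (monic F (f +ᵛ v)) x ≡ eval (monic F f) x + eval (toList v) x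
    eval-translate f v x = begin
      eval (monic F (f +ᵛ v)) x             ≡⟨ eval-monic (f +ᵛ v) x ⟩
      eval (toList (f +ᵛ v)) x + pow x d    ≡⟨ cong (_+ pow x d) (eval-+ᵛ f v x) ⟩
      (eval (toList f) x + eval (toList v) x) + pow x d ≡⟨ trans (+-assoc _ _ _) (trans (cong (eval (toList f) x +_) (+-comm _ _)) (sym (+-assoc _ _ _))) ⟩
      (eval (toList f) x + pow x d) + eval (toList v) x ≡⟨ cong (_+ eval (toList v) x) (eval-monic f x) ⟨
      eval (monic F f) x + eval (toList v) x ∎
      where open ≡-Reasoning

    translate-injective : ∀ v {f f′ : Vec F.Carrier d} → f +ᵛ v ≡ f′ +ᵛ v → f ≡ f′
    translate-injective v {f} {f′} e = trans (sym (back f)) (trans (cong (_+ᵛ ((F.- F.1#) *ᵛ v)) e) (back f′))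
      where
      open IsCommutativeMonoid (+ᵛ-isCommutativeMonoid {d}) using (assoc; identityʳ)
      back : ∀ f → (f +ᵛ v) +ᵛ ((F.- F.1#) *ᵛ v) ≡ f
      back f = trans (assoc f v _) (trans (cong (f +ᵛ_) (v-v v)) (identityʳ f))

    translate-∑ : ∀ v (φ : Vec F.Carrier d → ℕ) → ∑ 𝒢 (λ f → φ (f +ᵛ v)) ≡ ∑ 𝒢 φ
    translate-∑ v φ = trans (sym (∑-map (_+ᵛ v) 𝒢 φ)) (sym (∑-↭ φ (unique-⊆-≤⇒↭
      (Unique.map⁺ (translate-injective v) (allVecs-unique d)) (λ _ → allVecs-complete _)
      (ℕ.≤-reflexive (sym (List.length-map (_+ᵛ v) 𝒢))))))

    Tr-translate : ∀ f t v x → Tr (eval (monic F (f +ᵛ multiple t v)) x) ≡ Tr (eval (monic F f) x) + t ×# Tr (eval (toList v) x)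
    Tr-translate f t v x = trans (cong Tr (trans (eval-translate f (multiple t v) x) (cong (eval (monic F f) x +_) (eval-multiple t v x))))
      (trans (tr-+ N _ _) (cong (Tr (eval (monic F f) x) +_) (Tr-×# t _)))

    size≤d′ : size ℕ.≤ d
    size≤d′ = subst (ℕ._≤ d) (sym sizeL) size≤d

    place-direction : ∀ {o} → o ∈ places D₁ → Σ (Vec F.Carrier d) λ v →
      Tr (eval (toList v) (root o)) ≢ 0# × (∀ x → (∀ i → x ≢ σ i (root o)) → eval (toList v) x ≡ 0#)
    place-direction {o} o∈ = let k , r≡ , cop = D₁-quotient o∈ in
      direction size≤d′ {root o} {proj₁ o} {k} (RootData.degree≥1 R) (RootData.fixed R)
        (λ s s≥1 fix → ∣⇒≤ {{ℕ.>-nonZero s≥1}} (RootData.period R s fix)) r≡ cop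
      where R = rootData (D₁⊆ o∈)

    shift : ∀ {o} → o ∈ places D₁ → ℕ → Vec F.Carrier d → Vec F.Carrier d
    shift o∈ t f = f +ᵛ multiple t (proj₁ (place-direction o∈))

    shift-balanced : ∀ {o} (o∈ : o ∈ places D₁) → Balanced o (shift o∈)
    shift-balanced {o} o∈ = (λ t φ → translate-∑ (multiple t (proj₁ (place-direction o∈))) φ) ,
      λ f → trans (∑-cong (upTo p) (λ t → cong (λ z → 𝟙 (z ≟ 0#)) (Tr-translate f t _ (root o))))
        (affine-line (Tr-fixed _) (Tr-fixed _) (proj₁ (proj₂ (place-direction o∈))))

    -- Conjugates of `root o` are roots of the polynomial of `o`, and distinct places have no root
    -- in common; so the direction for `o` vanishes at `root o′`.
    shift-invariant : ∀ {o o′} (o∈ : o ∈ places D₁) → o′ ∈ places D₁ → o′ ≢ o → ∀ t f → β o′ (shift o∈ t f) ≡ β o′ f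
    shift-invariant {o} {o′} o∈ o′∈ o′≢o t f = cong (λ z → 𝟙 (z ≟ 0#)) (begin
      Tr (eval (monic F (shift o∈ t f)) (root o′))    ≡⟨ Tr-translate f t (proj₁ (place-direction o∈)) (root o′) ⟩
      Tr (eval (monic F f) (root o′)) + t ×# Tr (eval (toList (proj₁ (place-direction o∈))) (root o′))
        ≡⟨ cong (λ z → Tr (eval (monic F f) (root o′)) + t ×# z)
             (trans (cong Tr (proj₂ (proj₂ (place-direction o∈)) (root o′) not-conjugate)) Tr-0) ⟩
      Tr (eval (monic F f) (root o′)) + t ×# 0#       ≡⟨ cong (Tr (eval (monic F f) (root o′)) +_) (×#-0 t) ⟩
      Tr (eval (monic F f) (root o′)) + 0#            ≡⟨ +-identityʳ _ ⟩
      Tr (eval (monic F f) (root o′))                 ∎)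
      where
      open ≡-Reasoning
      not-conjugate : ∀ i → root o′ ≢ σ i (root o)
      not-conjugate i e = o′≢o (place-unique (proj₂ o′) (proj₂ o)
        (proj₂ (∈-places {D₁} o′∈)) (proj₂ (∈-places {D₁} o∈)) (root o′) (RootData.vanishes (rootData (D₁⊆ o′∈)))
        (trans (cong (eval (monic F (proj₂ o))) e) (trans (sym (σ-eval i (monic F (proj₂ o)) (root o)))
          (trans (cong (σ i) (RootData.vanishes (rootData (D₁⊆ o∈)))) (σ-0 i)))))

    W : List ℕ
    W = weightsCop r p π

    weights-W : List.map proj₁ (places D₁) ≡ W
    weights-W = weights D₁

    Nf-distribution : ∀ k → count (λ f → Nf F L h p pp f ℕ.≟ k ℕ.+ base) 𝒢 ℕ.* p ℕ.^ length W ≡ length 𝒢 ℕ.* bernWays p W k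
    Nf-distribution k = begin
      count (λ f → Nf F L h p pp f ℕ.≟ k ℕ.+ base) 𝒢 ℕ.* p ℕ.^ length W
        ≡⟨ cong₂ ℕ._*_ (trans (count≡∑ _ 𝒢) (∑-cong 𝒢 indicator)) (cong (λ W → p ℕ.^ length W) (sym weights-W)) ⟩
      -- The factor 1 is the constant weight with which `distribution` starts, before any condition
      -- is imposed.
      ∑ 𝒢 (λ f → 1 ℕ.* 𝟙 (S (places D₁) f ℕ.≟ k)) ℕ.* p ℕ.^ length (List.map proj₁ (places D₁))
        ≡⟨ cong (λ m → ∑ 𝒢 (λ f → 1 ℕ.* 𝟙 (S (places D₁) f ℕ.≟ k)) ℕ.* p ℕ.^ m) (List.length-map proj₁ (places D₁)) ⟩
      ∑ 𝒢 (λ f → 1 ℕ.* 𝟙 (S (places D₁) f ℕ.≟ k)) ℕ.* p ℕ.^ length (places D₁)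
        ≡⟨ distribution (places D₁) (places-unique (Unique.filter⁺ cop? divisors-unique)) shift shift-balanced shift-invariant
             (λ _ → 1) (λ _ _ _ → refl) k ⟩
      ∑ 𝒢 (λ _ → 1) ℕ.* bernWays p (List.map proj₁ (places D₁)) k
        ≡⟨ cong₂ (λ a W → a ℕ.* bernWays p W k) (trans (∑-const 𝒢 1 (λ _ _ → refl)) (ℕ.*-identityʳ (length 𝒢))) weights-W ⟩
      length 𝒢 ℕ.* bernWays p W k ∎
      where
      open ≡-Reasoning
      indicator : ∀ f → 𝟙 (Nf F L h p pp f ℕ.≟ k ℕ.+ base) ≡ 1 ℕ.* 𝟙 (S (places D₁) f ℕ.≟ k)
      indicator f = trans (𝟙-⇔ (Nf F L h p pp f ℕ.≟ k ℕ.+ base) (S (places D₁) f ℕ.≟ k)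
        (λ e → ℕ.+-cancelʳ-≡ base _ _ (trans (sym (Nf≡S+base f)) e))
        (λ e → trans (Nf≡S+base f) (cong (ℕ._+ base) e))) (sym (ℕ.*-identityˡ _))

    -- With X the total weight of `D₁`, p times the mean is X + p `base`, and X + `base` = q^r.
    Nf-mean : p ℕ.* sum (List.map (Nf F L h p pp) 𝒢) ≡ length 𝒢 ℕ.* (q ℕ.^ r ℕ.+ p′ ℕ.* base)
    Nf-mean = begin
      p ℕ.* ∑ 𝒢 (Nf F L h p pp)                              ≡⟨ cong (p ℕ.*_) (trans (∑-cong 𝒢 Nf≡S+base) (∑-+ 𝒢 (S (places D₁)) (λ _ → base))) ⟩
      p ℕ.* (∑ 𝒢 (S (places D₁)) ℕ.+ ∑ 𝒢 (λ _ → base))       ≡⟨ ℕ.*-distribˡ-+ p (∑ 𝒢 (S (places D₁))) _ ⟩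
      p ℕ.* ∑ 𝒢 (S (places D₁)) ℕ.+ p ℕ.* ∑ 𝒢 (λ _ → base)
        ≡⟨ cong₂ ℕ._+_ (mean (places D₁) (λ o∈ → shift o∈ , shift-balanced o∈)) (cong (p ℕ.*_) (∑-const 𝒢 base (λ _ _ → refl))) ⟩
      A ℕ.* X ℕ.+ p ℕ.* (A ℕ.* base)
        ≡⟨ solve 4 (λ A X b p′ → A :* X :+ (con 1 :+ p′) :* (A :* b) := A :* ((X :+ b) :+ p′ :* b)) refl A X base p′ ⟩
      A ℕ.* ((X ℕ.+ base) ℕ.+ p′ ℕ.* base)                   ≡⟨ cong (λ z → A ℕ.* (z ℕ.+ p′ ℕ.* base)) ∑₁+base ⟩
      A ℕ.* (q ℕ.^ r ℕ.+ p′ ℕ.* base)                        ∎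
      where
      open ≡-Reasoning
      open +-*-Solver
      A = length 𝒢
      X = ∑ (places D₁) proj₁

    base≤Nf : ∀ f → base ℕ.≤ Nf F L h p pp f
    base≤Nf f = subst (base ℕ.≤_) (sym (Nf≡S+base f)) (ℕ.m≤n+m base _)

  base-coprime : Coprime r p → base ≡ 0
  base-coprime cop = ∑-zero (places D₂) λ o o∈ → contradiction
    (let k , r≡ , p∣k = D₂-quotient o∈ in subst (p ∣_) (sym r≡) (∣-trans p∣k (divides (proj₁ o) (ℕ.*-comm k _))))
    (coprime⇒∤ pp cop)

  weights-coprime : Coprime r p → weightsAll r π ≡ weightsCop r p π
  weights-coprime cop = cong (concatMap (λ e → List.replicate (π e) e))
    (trans (List.filter-all (λ _ → yes tt) (All.universal (λ _ → tt) divisors))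
      (sym (List.filter-all cop? (All.tabulate (λ {e} e∈ → quotient-coprime e (∈-divisors⁻ e∈))))))
    where
    quotient-coprime : ∀ e → e ∣ r → CoprimeQuot r p e
    quotient-coprime zero    0∣r = contradiction (sym (0∣⇒≡0 0∣r)) (ℕ.<⇒≢ r≥1)
    quotient-coprime (suc e) e∣r (i∣ , i∣p) = cop (∣-trans i∣ (m/n∣m e∣r) , i∣p)

  module Divisible (s : ℕ) (r≡ : r ≡ s ℕ.* p) where

    s≥1 : 1 ℕ.≤ s
    s≥1 = go s r≡
      where
      go : ∀ s → r ≡ s ℕ.* p → 1 ℕ.≤ s
      go zero    e = contradiction (sym e) (ℕ.<⇒≢ r≥1)
      go (suc s) e = s≤s z≤n

    fixed? : ∀ x → Dec (σ s x ≡ x)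
    fixed? x = σ s x ≟ x

    -- Since `size` is the p-th power of q^s, q^s - 1 divides `size` - 1, which is what
    -- `fixed-count` asks for.
    subfield-size : ∑ elements (λ x → 𝟙 (fixed? x)) ≡ q ℕ.^ s
    subfield-size = go (q ℕ.^ s) (ℕ.≤-trans (s≤s s≥1) (n<m^n s q≥2)) (trans sizeL (trans (cong (q ℕ.^_) r≡) (sym (ℕ.^-*-assoc q s p))))
      where
      go : ∀ A → 2 ℕ.≤ A → size ≡ A ℕ.^ p → ∑ elements (λ x → 𝟙 (pow x A ≟ x)) ≡ A
      go (suc N) (s≤s N≥1) eq = let T , e = ^≡1+ N p′ in FixedPoints.fixed-count L N T N≥1 (trans eq e)

    -- With r = s p, p divides r/e just when e divides s, so the orbits with degree in `D₂` make up
    -- the fixed field of `σ s`; its elements are counted by orbits.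
    base≡ : base ≡ q ℕ.^ s
    base≡ = sym (begin
      q ℕ.^ s                                          ≡⟨ subfield-size ⟨
      ∑ elements (λ x → 𝟙 (fixed? x))                  ≡⟨ ∑-orbits (λ x → 𝟙 (fixed? x)) invariant ⟩
      ∑ (places divisors) (λ o → proj₁ o ℕ.* 𝟙 (fixed? (root o)))
        ≡⟨ ∑-split (λ o → proj₁ o ℕ.* 𝟙 (fixed? (root o))) ⟩
      ∑ (places D₁) (λ o → proj₁ o ℕ.* 𝟙 (fixed? (root o))) ℕ.+ ∑ (places D₂) (λ o → proj₁ o ℕ.* 𝟙 (fixed? (root o)))
        ≡⟨ cong₂ ℕ._+_ (∑-zero (places D₁) moved) (∑-cong-∈ (places D₂) kept) ⟩
      base ∎)
      where
      open ≡-Reasoning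
      σ-swap : ∀ i x → σ s (σ i x) ≡ σ i (σ s x)
      σ-swap i x = trans (sym (σ-comp s i x)) (trans (cong (λ j → σ j x) (ℕ.+-comm s i)) (σ-comp i s x))
      invariant : σ-Invariant (λ x → 𝟙 (fixed? x))
      invariant i i≤r x = 𝟙-⇔ (fixed? (σ i x)) (fixed? x)
        (λ e → σ-injective i≤r (trans (sym (σ-swap i x)) e)) (λ e → trans (σ-swap i x) (cong (σ i) e))
      moved : ∀ o → o ∈ places D₁ → proj₁ o ℕ.* 𝟙 (fixed? (root o)) ≡ 0
      moved o o∈ = trans (cong (proj₁ o ℕ.*_) (𝟙-no (fixed? (root o)) (λ fix →
        not-divisible (RootData.period (rootData (D₁⊆ o∈)) s fix)))) (ℕ.*-zeroʳ (proj₁ o))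
        where
        not-divisible : ¬ (proj₁ o ∣ s)
        not-divisible (divides j s≡) = let k , rk , cop = D₁-quotient o∈ in coprime⇒∤ pp cop (divides j
          (ℕ.*-cancelʳ-≡ k (j ℕ.* p) (proj₁ o) {{ℕ.>-nonZero (RootData.degree≥1 (rootData (D₁⊆ o∈)))}}
            (trans (sym rk) (trans r≡ (trans (cong (ℕ._* p) s≡) (trans (ℕ.*-assoc j (proj₁ o) p)
              (trans (cong (j ℕ.*_) (ℕ.*-comm (proj₁ o) p)) (sym (ℕ.*-assoc j p (proj₁ o))))))))))
      kept : ∀ o → o ∈ places D₂ → proj₁ o ℕ.* 𝟙 (fixed? (root o)) ≡ proj₁ o
      kept o o∈ = trans (cong (proj₁ o ℕ.*_) (𝟙-yes (fixed? (root o)) fix)) (ℕ.*-identityʳ _)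
        where
        fix : σ s (root o) ≡ root o
        fix = go (D₂-quotient o∈)
          where
          go : (∃ λ k → r ≡ k ℕ.* proj₁ o × p ∣ k) → σ s (root o) ≡ root o
          go (k , rk , divides j k≡) = trans (cong (λ i → σ i (root o)) s≡) (σ-multiple j (RootData.fixed (rootData (D₂⊆ o∈))))
            where
            s≡ : s ≡ j ℕ.* proj₁ o
            s≡ = ℕ.*-cancelʳ-≡ s (j ℕ.* proj₁ o) p (trans (sym r≡) (trans rk (trans (cong (ℕ._* proj₁ o) k≡)
              (trans (ℕ.*-assoc j p (proj₁ o)) (trans (cong (j ℕ.*_) (ℕ.*-comm p (proj₁ o))) (sym (ℕ.*-assoc j (proj₁ o) p)))))))

-- Both cases of the theorem from the common distribution and mean

open import Data.Nat using (_+_; _*_; _∸_; _^_; _≤_; _≟_)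
open import Data.List using (map)

theorem5 : (p n r d : ℕ) (pp : Prime p) (F L : FiniteField) (h : Hom F L) (π : ℕ → ℕ) →
    FiniteField.size F ≡ p ^ n →
    FiniteField.size L ≡ (p ^ n) ^ r →
    1 ≤ r →
    Coprime d p →
    (p ^ n) ^ r ≤ d →
    (∀ e → IsNumIrred F e (π e)) →
    (Coprime r p →
    (∀ k → count (λ f → Nf F L h p pp f ≟ k) (allVecs F d) * p ^ length (weightsAll r π)
    ≡ length (allVecs F d) * bernWays p (weightsAll r π) k)
    × p * sum (map (Nf F L h p pp) (allVecs F d)) ≡ length (allVecs F d) * (p ^ n) ^ r)
    ×
    (p ∣ r →
    (∀ k → count (λ f → Nf F L h p pp f ≟ k + (p ^ n) ^ (_/_ r p {{prime⇒nonZero pp}})) (allVecs F d)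
    * p ^ length (weightsCop r p π)
    ≡ length (allVecs F d) * bernWays p (weightsCop r p π) k)
    × (∀ (f : Vec (FiniteField.Carrier F) d) → (p ^ n) ^ (_/_ r p {{prime⇒nonZero pp}}) ≤ Nf F L h p pp f)
    × p * sum (map (Nf F L h p pp) (allVecs F d))
    ≡ length (allVecs F d) * ((p ^ n) ^ r + (p ∸ 1) * (p ^ n) ^ (_/_ r p {{prime⇒nonZero pp}})))
-- Matching on `p` lets `p ∸ 1` compute to `p′`, in the statement as well as in `bernWays`.
theorem5 zero n r d pp = contradiction pp ¬prime[0]
theorem5 (suc p′) n r d pp F L h π sizeF sizeL r≥1 _ qʳ≤d irreducibles = coprime-case , divisible-case
  where
  open Main p′ pp n r F L h sizeF sizeL r≥1 π irreducibles using (base; base-coprime; weights-coprime; module Degree; module Divisible)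
  open Degree d qʳ≤d using (𝒢; Nf-distribution; Nf-mean; base≤Nf)

  p q : ℕ
  p = suc p′
  q = p ^ n

  N : Vec (FiniteField.Carrier F) d → ℕ
  N = Nf F L h p pp

  Distribution : ℕ → _ → Set
  Distribution b W = ∀ k → count (λ f → N f ≟ k + b) 𝒢 * p ^ length W ≡ length 𝒢 * bernWays p W k

  coprime-case : Coprime r p →
    (∀ k → count (λ f → N f ≟ k) 𝒢 * p ^ length (weightsAll r π) ≡ length 𝒢 * bernWays p (weightsAll r π) k)
    × p * sum (map N 𝒢) ≡ length 𝒢 * q ^ r
  coprime-case cop =
    -- For `base` equal to 0 the common result speaks of `k + 0`, which does not reduce to `k`.
    (λ k → subst (λ m → count (λ f → N f ≟ m) 𝒢 * p ^ length (weightsAll r π) ≡ length 𝒢 * bernWays p (weightsAll r π) k)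
      (ℕ.+-identityʳ k) (subst₂ Distribution (base-coprime cop) (sym (weights-coprime cop)) Nf-distribution k)) ,
    trans Nf-mean (cong (length 𝒢 *_) (trans (cong (λ b → q ^ r + p′ * b) (base-coprime cop))
      (trans (cong (q ^ r +_) (ℕ.*-zeroʳ p′)) (ℕ.+-identityʳ _))))

  divisible-case : p ∣ r →
    Distribution (q ^ (r / p)) (weightsCop r p π) × (∀ f → q ^ (r / p) ≤ N f)
    × p * sum (map N 𝒢) ≡ length 𝒢 * (q ^ r + p′ * q ^ (r / p))
  divisible-case p∣r =
    subst (λ b → Distribution b (weightsCop r p π)) base≡ Nf-distribution ,
    (λ f → subst (_≤ N f) base≡ (base≤Nf f)) ,
    trans Nf-mean (cong (λ b → length 𝒢 * (q ^ r + p′ * b)) base≡)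
    where
    base≡ : base ≡ q ^ (r / p)
    base≡ = Divisible.base≡ (r / p) (sym (m/n*n≡m p∣r))
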